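{- Let $\tau$ be a finite relational vocabulary and let $\mathcal{C}$ be a class of finite $\tau$-structures that admits CMSO-definable ordered tree decompositions of bounded adhesion. Then order-invariant MSO and CMSO have the same expressive power on $\mathcal{C}$; that is, for every order-invariant MSO-sentence $\varphi$ of vocabulary $\tau\cup\{\le\}$ there is a CMSO-sentence $\psi$ of vocabulary $\tau$ such that every $A\in\mathcal{C}$ satisfies $\varphi$ (in the order-invariant sense) if and only if $A\models\psi$, and conversely for every CMSO-sentence $\psi$ of vocabulary $\tau$ there is such an order-invariant MSO-sentence $\varphi$.
   Context: Structures are finite and vocabularies are finite and relational. $U(A)$ denotes the universe of $A$. Logics. MSO is monadic second-order logic. CMSO extends MSO by atoms $C_m(R)$ and $C_m(X)$ for $m\in\mathbb{N}$, $R$ a relation symbol, $X$ a set variable, true iff $m$ divides $|R|$ (resp. $|X|$). Let $\le$ be a binary symbol not in $\tau$. An MSO-sentence $\varphi$ of vocabulary $\tau\cup\{\le\}$ is order-invariant if for all $\tau$-structures $A$ and all linear orders $\le_1,\le_2$ of $U(A)$: $(A,\le_1)\models\varphi$ iff $(A,\le_2)\models\varphi$. A $\tau$-structure $A$ satisfies such $\varphi$ (in the order-invariant sense) if $(A,\le)\models\varphi$ for some (equivalently all) linear orders $\le$ of $U(A)$. Tree decompositions. A tree decomposition $(T,\beta)$ of a structure $A$ is a tree $T$ (directed away from a root) with $\beta\colon V(T)\to 2^{U(A)}$ such that for every $v\in U(A)$ the set $\{t\mid v\in\beta(t)\}$ is nonempty and connected in $T$, and for every tuple of a relation of $A$ some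 $\beta(t)$ contains all its entries. Its adhesion is $\max_{(t,u)\in E(T)}|\beta(t)\cap\beta(u)|$. Transductions. A CMSO$[\tau,\tau']$-transduction $\Lambda$ of width $w$ with $p$ parameters consists of CMSO-formulas over $\tau\cup\{P_1,\dots,P_p\}$ ($P_j$ new unary symbols): a sentence $\lambda_{\mathrm{valid}}$, formulas $\lambda_U^1(x),\dots,\lambda_U^w(x)$, and for each $R\in\tau'$ of arity $r$ and each $(i_1,\dots,i_r)\in\{1,\dots,w\}^r$ a formula $\lambda_R^{(i_1,\dots,i_r)}(x_1,\dots,x_r)$. For a $\tau$-structure $A$ and $P_1,\dots,P_p\subseteq U(A)$, $\Lambda[A,P_1,\dots,P_p]$ is the $\tau'$-structure with universe $\{(a,i)\in U(A)\times\{1,\dots,w\}\mid (A,\bar P)\models\lambda_U^i(a)\}$ in which $R$ holds of $((a_1,i_1),\dots,(a_r,i_r))$ (tuples over this universe) iff $(A,\bar P)\models\lambda_R^{(i_1,\dots,i_r)}(a_1,\dots,a_r)$. Then $\Lambda[A]$ is the set of all $\Lambda[A,\bar P]$ with $(A,\bar P)\models\lambda_{\mathrm{valid}}$. Ordered tree extensions. Let $\tau^\star=\tau\cup\{V_S,V_T,E_T,R_\beta,R_\preceq\}$ with new symbols, $V_S,V_T$ unary, $E_T,R_\beta$ binary, $R_\preceq$ ternary. An ordered tree extension (otx) of a $\tau$-structure $A$ is a $\tau^\star$-structure $A^\star$ that extends $A$ by a tree decomposition $(T,\beta)$ of $A$ and a linear order $\preceq_t$ of $\beta(t)$ for each $t\in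 V(T)$: its universe is the disjoint union of $U(A)$ and $V(T)$, the symbols of $\tau$ are interpreted as in $A$, $V_S=U(A)$, $V_T=V(T)$, $E_T=E(T)$, $R_\beta=\{(t,v)\mid v\in\beta(t)\}$, $R_\preceq=\{(t,v,w)\mid v,w\in\beta(t),\ v\preceq_t w\}$. Its adhesion is that of $(T,\beta)$. The class $\mathcal{C}$ admits CMSO-definable ordered tree decompositions of bounded adhesion if there are $k\in\mathbb{N}$ and a CMSO$[\tau,\tau^\star]$-transduction $\Lambda^\star$ such that for every $A\in\mathcal{C}$ the set $\Lambda^\star[A]$ is nonempty and each of its members is isomorphic to an otx of $A$ of adhesion at most $k$. -}

module Defs where

open import Data.Bool using (Bool; true; false; T; _∧_)
open import Data.Bool.Properties using (T-irrelevant)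
open import Data.Empty using (⊥-elim)
open import Data.Fin using (Fin; zero; suc; _≟_)
open import Data.Fin.Subset using (Subset)
open import Data.Fin.Subset.Properties using (anySubset?)
open import Data.List using (List; []; _∷_; length; filterᵇ; cartesianProduct; cartesianProductWith; allFin)
import Data.List as List
open import Data.List.Extrema.Nat using (max)
open import Data.List.Membership.Propositional using (_∈_; lose)
open import Data.List.Membership.Propositional.Properties
  using (∈-map⁺; ∈-map⁻; ∈-++⁺ˡ; ∈-++⁺ʳ; ∈-cartesianProduct⁺; ∈-allFin)
open import Data.List.Properties using (filter-≐)
open import Data.List.Relation.Unary.All using (All; []; _∷_)
open import Data.List.Relation.Unary.AllPairs using ([]; _∷_)
open import Data.List.Relation.Unary.Any using (any?; here; there; index; satisfied)
open import Data.List.Relation.Unary.Any.Properties using (lookup-index)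
open import Data.List.Relation.Unary.Unique.Propositional using (Unique)
import Data.List.Relation.Unary.Unique.Propositional.Properties as Unique
open import Data.Nat using (ℕ; zero; suc; _≤_)
open import Data.Nat.Divisibility using (_∣_; _∣?_)
open import Data.Product using (Σ; ∃; _×_; _,_; proj₁; proj₂)
open import Data.Sum using (_⊎_; inj₁; inj₂; [_,_]′)
open import Data.Sum.Properties using (inj₁-injective; inj₂-injective)
open import Data.Unit using (⊤; tt)
open import Data.Vec using (Vec; []; _∷_; map; lookup; tabulate)
open import Data.Vec.Properties using (lookup∘tabulate)
import Data.Vec.Relation.Unary.All as Vec
open import Function using (_∘_; _⇔_; _↔_; Inverse)
open import Level using (Level; 0ℓ) renaming (suc to lsuc; _⊔_ to _⊔ˡ_)
open import Relation.Binary.Construct.Closure.Equivalence using (EqClosure)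
open import Relation.Binary.Construct.Closure.ReflexiveTransitive using (Star)
open import Relation.Binary.PropositionalEquality
  using (_≡_; _≢_; refl; sym; trans; cong; subst)
open import Relation.Binary.Structures using (IsTotalOrder)
open import Relation.Nullary using (Dec; yes; no; ¬_; does)
open import Relation.Nullary.Decidable using (map′; T?; ¬?; _×-dec_)

private variable
  ℓ : Level
  A B : Set

record Finite (A : Set) : Set where
  field
    elements : List A
    complete : ∀ x → x ∈ elements
    unique   : Unique elements

open Finite

-- Subsets of (and relations on) a finite set are Bool-valued; this is the
-- cardinality of the subset p when xs lists its superset without repetition.
count : (A → Bool) → List A → ℕ
count p xs = length (filterᵇ p xs)

tuples : List A → (r : ℕ) → List (Vec A r)
tuples xs zero    = [] ∷ []
tuples xs (suc r) = cartesianProductWith _∷_ xs (tuples xs r)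

Fin-finite : ∀ n → Finite (Fin n)
Fin-finite n = record
  { elements = allFin n ; complete = ∈-allFin ; unique = Unique.allFin⁺ n }

⊤-finite : Finite ⊤
⊤-finite = record
  { elements = tt ∷ [] ; complete = λ _ → here refl ; unique = [] ∷ [] }

⊎-finite : Finite A → Finite B → Finite (A ⊎ B)
⊎-finite FA FB = record
  { elements = List.map inj₁ (elements FA) List.++ List.map inj₂ (elements FB)
  ; complete = λ where
      (inj₁ a) → ∈-++⁺ˡ (∈-map⁺ inj₁ (complete FA a))
      (inj₂ b) → ∈-++⁺ʳ _ (∈-map⁺ inj₂ (complete FB b))
  ; unique   = Unique.++⁺ (Unique.map⁺ inj₁-injective (unique FA))
                          (Unique.map⁺ inj₂-injective (unique FB))
                          λ (p , q) → clash (∈-map⁻ inj₁ p) (∈-map⁻ inj₂ q)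
  }
  where
  clash : ∀ {z : A ⊎ B} {P : A → Set} {Q : B → Set} →
          (∃ λ a → P a × z ≡ inj₁ a) → ¬ (∃ λ b → Q b × z ≡ inj₂ b)
  clash (_ , _ , refl) (_ , _ , ())

×-finite : Finite A → Finite B → Finite (A × B)
×-finite FA FB = record
  { elements = cartesianProduct (elements FA) (elements FB)
  ; complete = λ (a , b) → ∈-cartesianProduct⁺ (complete FA a) (complete FB b)
  ; unique   = Unique.cartesianProduct⁺ (unique FA) (unique FB)
  }

⟪_⟫ : (A → Bool) → Set
⟪ p ⟫ = ∃ (T ∘ p)

⟪⟫-finite : Finite A → (p : A → Bool) → Finite ⟪ p ⟫
⟪⟫-finite {A} F p = record
  { elements = sub (elements F)
  ; complete = λ (x , px) → sub-complete px (complete F x)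
  ; unique   = sub-unique (unique F)
  }
  where
  sub : List A → List ⟪ p ⟫
  sub []       = []
  sub (x ∷ xs) with T? (p x)
  ... | yes px = (x , px) ∷ sub xs
  ... | no  _  = sub xs

  sub-complete : ∀ {x xs} (px : T (p x)) → x ∈ xs → (x , px) ∈ sub xs
  sub-complete {x} px (here {xs = xs} refl) with T? (p x)
  ... | yes qx = here (cong (x ,_) (T-irrelevant px qx))
  ... | no ¬px = ⊥-elim (¬px px)
  sub-complete px (there {x = y} x∈) with T? (p y)
  ... | yes _ = there (sub-complete px x∈)
  ... | no  _ = sub-complete px x∈

  sub-fresh : ∀ {x xs} (px : T (p x)) → All (x ≢_) xs → All ((x , px) ≢_) (sub xs)
  sub-fresh px []                    = []
  sub-fresh px (_∷_ {x = y} x≢y fr) with T? (p y)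
  ... | yes _ = (x≢y ∘ cong proj₁) ∷ sub-fresh px fr
  ... | no  _ = sub-fresh px fr

  sub-unique : ∀ {xs} → Unique xs → Unique (sub xs)
  sub-unique []                    = []
  sub-unique (_∷_ {x = x} fr uniq) with T? (p x)
  ... | yes px = sub-fresh px fr ∷ sub-unique uniq
  ... | no  _  = sub-unique uniq

record LinearOrder (A : Set) : Set where
  field
    le           : A → A → Bool
    isTotalOrder : IsTotalOrder _≡_ (λ x y → T (le x y))

open LinearOrder public

record Vocabulary : Set₁ where
  field
    Symbol        : Set
    symbol-finite : Finite Symbol
    arity         : Symbol → ℕ

open Vocabulary public

infixl 6 _⊕_

_⊕_ : Vocabulary → Vocabulary → Vocabulary
τ ⊕ σ = record
  { Symbol        = Symbol τ ⊎ Symbol σ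
  ; symbol-finite = ⊎-finite (symbol-finite τ) (symbol-finite σ)
  ; arity         = [ arity τ , arity σ ]′
  }

orderVoc : Vocabulary
orderVoc = record { Symbol = ⊤ ; symbol-finite = ⊤-finite ; arity = λ _ → 2 }

setsVoc : ℕ → Vocabulary
setsVoc p = record { Symbol = Fin p ; symbol-finite = Fin-finite p ; arity = λ _ → 1 }

record Structure (τ : Vocabulary) : Set₁ where
  field
    U        : Set
    U-finite : Finite U
    rel      : (R : Symbol τ) → Vec U (arity τ R) → Bool

open Structure public

private variable
  τ τ′ : Vocabulary

infix 4 _≅_

record _≅_ (M N : Structure τ) : Set where
  field
    bijection : U M ↔ U N
    preserves : ∀ R xs → rel M R xs ≡ rel N R (map (Inverse.to bijection) xs)

infixl 6 _◃_ _◂_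

_◃_ : (M : Structure τ) → LinearOrder (U M) → Structure (τ ⊕ orderVoc)
M ◃ o = record
  { U        = U M
  ; U-finite = U-finite M
  ; rel      = λ where
      (inj₁ R) xs           → rel M R xs
      (inj₂ _) (x ∷ y ∷ []) → le o x y
  }

_◂_ : (M : Structure τ) {p : ℕ} → (Fin p → U M → Bool) → Structure (τ ⊕ setsVoc p)
M ◂ P = record
  { U        = U M
  ; U-finite = U-finite M
  ; rel      = λ where
      (inj₁ R) xs       → rel M R xs
      (inj₂ j) (x ∷ []) → P j x
  }

data Logic : Set where
  mso cmso : Logic

-- Formulas with n free element variables and m free set variables (de Bruijn
-- indices; a quantifier binds variable zero). The remaining connectives and
-- the universal quantifiers are the usual abbreviations: satisfaction is
-- decidable, so the classical equivalences hold.
data Formula (τ : Vocabulary) : Logic → ℕ → ℕ → Set where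
  atom   : ∀ {L n m} (R : Symbol τ) → Vec (Fin n) (arity τ R) → Formula τ L n m
  _≐_    : ∀ {L n m} → Fin n → Fin n → Formula τ L n m
  _∈̇_    : ∀ {L n m} → Fin n → Fin m → Formula τ L n m
  ¬̇_     : ∀ {L n m} → Formula τ L n m → Formula τ L n m
  _∧̇_    : ∀ {L n m} → Formula τ L n m → Formula τ L n m → Formula τ L n m
  ∃̇      : ∀ {L n m} → Formula τ L (suc n) m → Formula τ L n m
  ∃̇ₛ     : ∀ {L n m} → Formula τ L n (suc m) → Formula τ L n m
  modRel : ∀ {n m} → ℕ → Symbol τ → Formula τ cmso n m
  modSet : ∀ {n m} → ℕ → Fin m → Formula τ cmso n m

Sentence : Vocabulary → Logic → Set
Sentence τ L = Formula τ L 0 0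

private variable
  L : Logic
  n m : ℕ

-- Divisibility here satisfies 0 ∣ k ⇔ k ≡ 0.
Sat : (M : Structure τ) → Vec (U M) n → Vec (U M → Bool) m → Formula τ L n m → Set
Sat M ρ Ξ (atom R xs)  = T (rel M R (map (lookup ρ) xs))
Sat M ρ Ξ (x ≐ y)      = lookup ρ x ≡ lookup ρ y
Sat M ρ Ξ (x ∈̇ X)      = T (lookup Ξ X (lookup ρ x))
Sat M ρ Ξ (¬̇ φ)        = ¬ Sat M ρ Ξ φ
Sat M ρ Ξ (φ ∧̇ ψ)      = Sat M ρ Ξ φ × Sat M ρ Ξ ψ
Sat M ρ Ξ (∃̇ φ)        = Σ (U M) λ a → Sat M (a ∷ ρ) Ξ φ
Sat M ρ Ξ (∃̇ₛ φ)       = Σ (U M → Bool) λ S → Sat M ρ (S ∷ Ξ) φ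
Sat {τ = τ} M ρ Ξ (modRel k R) =
  k ∣ count (rel M R) (tuples (elements (U-finite M)) (arity τ R))
Sat M ρ Ξ (modSet k X) = k ∣ count (lookup Ξ X) (elements (U-finite M))

infix 4 _⊨_

_⊨_ : Structure τ → Sentence τ L → Set
M ⊨ φ = Sat M [] [] φ

-- Decidability of satisfaction. Quantified sets are enumerated only up to
-- pointwise equality, whence Sat-ext.

private
  count-ext : (p q : A → Bool) → (∀ x → p x ≡ q x) → ∀ xs → count p xs ≡ count q xs
  count-ext p q p≗q xs = cong length (filter-≐ (T? ∘ p) (T? ∘ q)
    ((λ {x} → subst T (p≗q x)) , (λ {x} → subst T (sym (p≗q x)))) xs)

  _≗ₛ_ : Vec (A → Bool) m → Vec (A → Bool) m → Set
  Ξ ≗ₛ Ξ′ = ∀ X x → lookup Ξ X x ≡ lookup Ξ′ X x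

  ≗ₛ-cons : {Ξ Ξ′ : Vec (A → Bool) m} {S S′ : A → Bool} →
            (∀ x → S x ≡ S′ x) → Ξ ≗ₛ Ξ′ → (S ∷ Ξ) ≗ₛ (S′ ∷ Ξ′)
  ≗ₛ-cons s e zero    = s
  ≗ₛ-cons s e (suc X) = e X

Sat-ext : (M : Structure τ) {ρ : Vec (U M) n} {Ξ Ξ′ : Vec (U M → Bool) m} →
          (∀ X x → lookup Ξ X x ≡ lookup Ξ′ X x) →
          (φ : Formula τ L n m) → Sat M ρ Ξ φ → Sat M ρ Ξ′ φ
Sat-ext M e (atom R xs)      s       = s
Sat-ext M e (x ≐ y)          s       = s
Sat-ext M e (x ∈̇ X)          s       = subst T (e X _) s
Sat-ext M e (¬̇ φ)            s       = s ∘ Sat-ext M (λ X x → sym (e X x)) φ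
Sat-ext M e (φ ∧̇ ψ)          (s , t) = Sat-ext M e φ s , Sat-ext M e ψ t
Sat-ext M e (∃̇ φ)            (a , s) = a , Sat-ext M e φ s
Sat-ext M {Ξ = Ξ} {Ξ′} e (∃̇ₛ φ) (S , s) =
  S , Sat-ext M (≗ₛ-cons {Ξ = Ξ} {Ξ′} (λ _ → refl) e) φ s
Sat-ext M e (modRel k R)     s       = s
Sat-ext M e (modSet k X)     s       =
  subst (k ∣_) (count-ext _ _ (e X) (elements (U-finite M))) s

module _ (F : Finite A) where

  private
    ix : (x : A) → Fin (length (elements F))
    ix x = index (complete F x)

    at-ix : ∀ x → x ≡ List.lookup (elements F) (ix x)
    at-ix x = lookup-index (complete F x)

  finite-≟ : (x y : A) → Dec (x ≡ y)
  finite-≟ x y = map′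
    (λ e → trans (at-ix x) (trans (cong (List.lookup (elements F)) e) (sym (at-ix y))))
    (cong ix) (ix x ≟ ix y)

  finite-any? : {P : A → Set ℓ} → (∀ x → Dec (P x)) → Dec (Σ A P)
  finite-any? P? = map′ satisfied (λ (x , px) → lose (complete F x) px) (any? P? (elements F))

  finite-anySet? : {P : (A → Bool) → Set ℓ} →
                   (∀ {S S′} → (∀ x → S x ≡ S′ x) → P S → P S′) →
                   (∀ S → Dec (P S)) → Dec (Σ (A → Bool) P)
  finite-anySet? P-ext P? = map′
    (λ (s , ps) → decode s , ps)
    (λ (S , pS) → encode S , P-ext (λ x → sym (decode-encode S x)) pS)
    (anySubset? (P? ∘ decode))
    where
    decode : Subset (length (elements F)) → A → Bool
    decode s x = lookup s (ix x)

    encode : (A → Bool) → Subset (length (elements F))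
    encode S = tabulate (S ∘ List.lookup (elements F))

    decode-encode : ∀ S x → decode (encode S) x ≡ S x
    decode-encode S x = trans (lookup∘tabulate _ (ix x)) (cong S (sym (at-ix x)))

sat? : (M : Structure τ) (ρ : Vec (U M) n) (Ξ : Vec (U M → Bool) m) →
       (φ : Formula τ L n m) → Dec (Sat M ρ Ξ φ)
sat? M ρ Ξ (atom R xs)  = T? _
sat? M ρ Ξ (x ≐ y)      = finite-≟ (U-finite M) _ _
sat? M ρ Ξ (x ∈̇ X)      = T? _
sat? M ρ Ξ (¬̇ φ)        = ¬? (sat? M ρ Ξ φ)
sat? M ρ Ξ (φ ∧̇ ψ)      = sat? M ρ Ξ φ ×-dec sat? M ρ Ξ ψ
sat? M ρ Ξ (∃̇ φ)        = finite-any? (U-finite M) λ a → sat? M (a ∷ ρ) Ξ φ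
sat? M ρ Ξ (∃̇ₛ φ)       = finite-anySet? (U-finite M)
  (λ S≗S′ → Sat-ext M (≗ₛ-cons {Ξ = Ξ} {Ξ} S≗S′ (λ _ _ → refl)) φ)
  (λ S → sat? M ρ (S ∷ Ξ) φ)
sat? M ρ Ξ (modRel k R) = k ∣? _
sat? M ρ Ξ (modSet k X) = k ∣? _

OrderInvariant : Sentence (τ ⊕ orderVoc) mso → Set₁
OrderInvariant {τ} φ =
  (M : Structure τ) (o₁ o₂ : LinearOrder (U M)) → (M ◃ o₁ ⊨ φ) ⇔ (M ◃ o₂ ⊨ φ)

infix 4 _⊨≤_

_⊨≤_ : Structure τ → Sentence (τ ⊕ orderVoc) mso → Set
M ⊨≤ φ = Σ (LinearOrder (U M)) λ o → M ◃ o ⊨ φ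

record Transduction (τ τ′ : Vocabulary) : Set where
  field
    width params : ℕ

  CMSO : ℕ → Set
  CMSO r = Formula (τ ⊕ setsVoc params) cmso r 0

  field
    λ-valid : CMSO 0
    λ-U     : Fin width → CMSO 1
    λ-R     : (R : Symbol τ′) → Vec (Fin width) (arity τ′ R) → CMSO (arity τ′ R)

open Transduction public

module _ (Λ : Transduction τ τ′) (M : Structure τ) where

  Parameters : Set
  Parameters = Fin (params Λ) → U M → Bool

  Valid : Parameters → Set
  Valid P = M ◂ P ⊨ λ-valid Λ

  output : Parameters → Structure τ′
  output P = record
    { U        = ⟪ inU ⟫
    ; U-finite = ⟪⟫-finite (×-finite (U-finite M) (Fin-finite (width Λ))) inU
    ; rel      = λ R xs → does (sat? (M ◂ P) (map (proj₁ ∘ proj₁) xs) []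
                                     (λ-R Λ R (map (proj₂ ∘ proj₁) xs)))
    }
    where
    inU : U M × Fin (width Λ) → Bool
    inU (a , i) = does (sat? (M ◂ P) (a ∷ []) [] (λ-U Λ i))

-- A finite directed graph with exactly one walk from the root to each vertex,
-- i.e. a finite tree with all edges directed away from the root.
record RootedTree : Set₁ where
  field
    V        : Set
    V-finite : Finite V
    edge     : V → V → Bool
    root     : V

  _⟶_ : V → V → Set
  t ⟶ u = T (edge t u)

  field
    walk        : ∀ t → Star _⟶_ root t
    walk-unique : ∀ {t} (p q : Star _⟶_ root t) → p ≡ q

  -- Connectedness ignores the direction of edges.
  Connected : (V → Bool) → Set
  Connected S = ∀ {t u} → T (S t) → T (S u) →
    EqClosure (λ a b → T (S a) × T (S b) × a ⟶ b) t u

open RootedTree public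

record TreeDecomposition {τ : Vocabulary} (M : Structure τ) : Set₁ where
  field
    tree      : RootedTree
    β         : V tree → U M → Bool
    nonempty  : ∀ v → ∃ λ t → T (β t v)
    connected : ∀ v → Connected tree (λ t → β t v)
    covers    : ∀ R xs → T (rel M R xs) → ∃ λ t → Vec.All (T ∘ β t) xs

  -- The maximum over no edges is 0.
  adhesion : ℕ
  adhesion = max 0 (List.map
    (λ (t , u) → count (λ v → β t v ∧ β u v) (elements (U-finite M)))
    (filterᵇ (λ (t , u) → edge tree t u) (cartesianProduct nodes nodes)))
    where
    nodes : List (V tree)
    nodes = elements (V-finite tree)

open TreeDecomposition public

data OTXSymbol : Set where
  V-S V-T E-T R-β R-≼ : OTXSymbol

otxVoc : Vocabulary
otxVoc = record
  { Symbol        = OTXSymbol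
  ; symbol-finite = record
    { elements = V-S ∷ V-T ∷ E-T ∷ R-β ∷ R-≼ ∷ []
    ; complete = λ where
        V-S → here refl
        V-T → there (here refl)
        E-T → there (there (here refl))
        R-β → there (there (there (here refl)))
        R-≼ → there (there (there (there (here refl))))
    ; unique   = ((λ ()) ∷ (λ ()) ∷ (λ ()) ∷ (λ ()) ∷ [])
               ∷ ((λ ()) ∷ (λ ()) ∷ (λ ()) ∷ [])
               ∷ ((λ ()) ∷ (λ ()) ∷ [])
               ∷ ((λ ()) ∷ [])
               ∷ [] ∷ []
    }
  ; arity         = λ where
      V-S → 1
      V-T → 1
      E-T → 2
      R-β → 2
      R-≼ → 3
  }

record OTX {τ : Vocabulary} (M : Structure τ) : Set₁ where
  field
    decomposition : TreeDecomposition M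
    order         : (t : V (tree decomposition)) → LinearOrder ⟪ β decomposition t ⟫

open OTX public

-- A relation on A as a relation on A ⊎ B, with the same tuples.
liftRel : ∀ {r} → (Vec A r → Bool) → Vec (A ⊎ B) r → Bool
liftRel R []            = R []
liftRel R (inj₁ a ∷ xs) = liftRel (λ as → R (a ∷ as)) xs
liftRel R (inj₂ _ ∷ xs) = false

-- An order on a subset p as a relation on A, with the same pairs.
extendOrder : (p : A → Bool) → LinearOrder ⟪ p ⟫ → A → A → Bool
extendOrder p o v w with T? (p v) | T? (p w)
... | yes pv | yes pw = le o (v , pv) (w , pw)
... | _      | _      = false

otxStructure : {M : Structure τ} → OTX M → Structure (τ ⊕ otxVoc)
otxStructure {M = M} E = record
  { U        = U M ⊎ V T′
  ; U-finite = ⊎-finite (U-finite M) (V-finite T′)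
  ; rel      = λ where
      (inj₁ R)   xs                                → liftRel (rel M R) xs
      (inj₂ V-S) (inj₁ _ ∷ [])                     → true
      (inj₂ V-T) (inj₂ _ ∷ [])                     → true
      (inj₂ E-T) (inj₂ t ∷ inj₂ u ∷ [])            → edge T′ t u
      (inj₂ R-β) (inj₂ t ∷ inj₁ v ∷ [])            → β D t v
      (inj₂ R-≼) (inj₂ t ∷ inj₁ v ∷ inj₁ w ∷ [])   → extendOrder (β D t) (order E t) v w
      (inj₂ _)   _                                 → false
  }
  where
  D  = decomposition E
  T′ = tree D

record AdmitsOrderedTreeDecompositions {τ : Vocabulary} (C : Structure τ → Set ℓ) :
       Set (lsuc 0ℓ ⊔ˡ ℓ) where
  field
    k            : ℕ
    Λ⋆           : Transduction τ (τ ⊕ otxVoc)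
    inhabited    : ∀ M → C M → ∃ (Valid Λ⋆ M)
    outputs-otx  : ∀ M → C M → ∀ P → Valid Λ⋆ M P →
                   Σ (OTX M) λ E →
                     (adhesion (decomposition E) ≤ k) × (output Λ⋆ M P ≅ otxStructure E)

{-# OPTIONS --safe #-}
module Submission where

-- CMSO is translated to MSO with an order by running, along the order, a finite
-- automaton that counts modulo the divisor; its run is guessed as a labelling.
--
-- Conversely, an ordered tree extension of A almost defines an order of A: list
-- the elements owned by a vertex (in its bag but not in that of its parent) in
-- the order of the bag, and then the subtrees of its children. Siblings with
-- different adhesion sets are ordered lexicographically; only the order of
-- siblings with the same adhesion set is not definable. As φ is order-invariant,
-- we may sort such siblings by the state (a finite quantifier-rank type, relative
-- to the at most k elements of the adhesion set) of their subtrees. The state of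
-- the union of a group of such siblings is then obtained by iterating, for each
-- state σ, the composition with σ as often as σ occurs. These iterates are
-- eventually periodic, so CMSO can compute the state of the group. The state of
-- the subtree of a vertex is definable from its bag and from the states of its
-- groups by a Feferman-Vaught argument in which every set quantifier over the
-- subtree becomes a set quantifier over the bag and a guess of new states of the
-- groups. A CMSO-sentence can therefore guess and verify the states of all
-- subtrees, and the transduction pulls this sentence back to A.

open import Defs
open import Data.Bool using (Bool; true; false; T; if_then_else_; _∧_; not; _∨_)
open import Data.Bool.Properties using (T-∧; T-irrelevant)
open import Data.Empty using (⊥; ⊥-elim)
open import Data.Fin using (Fin; zero; suc; _↑ˡ_; _↑ʳ_; combine; remQuot; toℕ; fromℕ<)
open import Data.List
  using (List; []; _∷_; _++_; length; filterᵇ; concatMap; cartesianProductWith; allFin; foldr;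
         cartesianProduct)
open import Data.List.Extrema.Nat using (max; xs≤max)
open import Data.List.Membership.Propositional using (_∈_; find; lose)
open import Data.List.Membership.Propositional.Properties
  using (∈-++⁺ˡ; ∈-++⁺ʳ; ∈-++⁻; ∈-filter⁺; ∈-filter⁻; ∈-map⁺; ∈-map⁻; ∈-concatMap⁺; ∈-concatMap⁻;
         ∈-cartesianProductWith⁺; ∈-lookup; ∈-cartesianProduct⁺)
open import Data.List.Membership.Propositional.Properties.WithK using (unique∧set⇒bag)
open import Data.List.Properties
  using (filter-++; length-++; length-map; foldr-++; ++-cancelˡ; ∷-injectiveˡ; ∷ʳ-injective;
         concatMap-cong; filter-≐)
open import Data.List.Relation.Binary.BagAndSetEquality using (∼bag⇒↭)
open import Data.List.Relation.Binary.Permutation.Propositional using (_↭_; ↭-sym; ↭⇒↭ₛ)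
open import Data.List.Relation.Binary.Permutation.Propositional.Properties
  using (↭-length; ∈-resp-↭)
open import Data.List.Relation.Unary.All using (All; []; _∷_)
open import Data.List.Relation.Unary.AllPairs using (AllPairs; []; _∷_)
open import Data.List.Relation.Unary.Any using (here; there; index; any?)
open import Data.List.Relation.Unary.Any.Properties using (lookup-index)
open import Data.List.Relation.Unary.Sorted.TotalOrder.Properties using (Sorted⇒AllPairs)
open import Data.List.Relation.Unary.Unique.Propositional using (Unique)
open import Data.Maybe using (Maybe; just; nothing; maybe′)
open import Data.Maybe.Properties using (just-injective)
open import Data.Nat using (ℕ; zero; suc; _+_; _*_; _∸_; _<_; _≤_; _<?_; s≤s; z≤n)
open import Data.Nat.DivMod using (_/_; _%_; m≡m%n+[m/n]*n; m%n<n; _mod_; %-distribˡ-+; m%n%n≡m%n)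
open import Data.Nat.Divisibility using (_∣_; divides; _∣0; 0∣⇒≡0; m%n≡0⇔n∣m)
open import Data.Nat.ListAction using (sum)
open import Data.Nat.Properties using (suc-injective)
open import Data.Nat.Tactic.RingSolver using (solve-∀)
open import Data.Product using (Σ; ∃; _×_; _,_; proj₁; proj₂)
open import Data.Product.Function.NonDependent.Propositional using (_×-⇔_)
open import Data.Product.Properties using (,-injective)
open import Data.Sum using (_⊎_; inj₁; inj₂; [_,_]′)
open import Data.Sum.Function.Propositional using (_⊎-⇔_)
open import Data.Unit using (⊤; tt)
open import Data.Vec using (Vec; []; _∷_; lookup; tabulate; replicate)
open import Data.Vec.Properties
  using (lookup∘tabulate; tabulate-cong; tabulate∘lookup; ∷-injective; map-∘; map-cong;
         lookup-++ˡ; lookup-++ʳ; lookup-map)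
open import Function using (_∘_; id; _⇔_; mk⇔; Equivalence; Inverse)
open import Level using (Level) renaming (zero to lzero; suc to lsuc; _⊔_ to _⊔ˡ_)
open import Relation.Binary.Bundles using (DecTotalOrder)
open import Relation.Binary.Construct.Closure.ReflexiveTransitive using (Star; ε; _◅_; _◅◅_)
open import Relation.Binary.Construct.Closure.Symmetric using (fwd; bwd)
open import Relation.Binary.PropositionalEquality
  using (_≡_; _≢_; refl; sym; trans; cong; cong₂; subst)
open import Relation.Binary.Structures using (IsTotalOrder)
open import Relation.Nullary using (Dec; yes; no; ¬_; does)
open import Relation.Nullary.Decidable
  using (map′; T?; ¬?; _×-dec_; _⊎-dec_; _→-dec_; decidable-stable; does-⇔)
import Data.Fin.Properties as Fin
import Data.List as List
import Data.List.Relation.Binary.Permutation.Setoid.Properties as Permutationₛ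
import Data.List.Relation.Unary.All as All
import Data.List.Relation.Unary.Unique.Propositional.Properties as Unique
import Data.List.Sort as Sort
import Data.Maybe.Properties as Maybe
import Data.Nat.Properties as ℕ
import Data.Vec as Vec
import Data.Vec.Membership.Propositional.Properties as VecMembership
import Data.Vec.Properties as Vec
import Data.Vec.Relation.Unary.All as VecAll
import Relation.Binary.PropositionalEquality as ≡

-- The order constructed for `A` depends on `φ`: siblings are sorted by their states, and the state
-- of a subtree refers to the order already chosen inside it, so lists and states arise in one
-- recursion from the leaves. No formula mentions this order. The labels are guessed, and since the
-- verified conditions determine the label of a vertex from those of its children, the guess is
-- forced to be the true one. Order-invariance enters once, to pass from an arbitrary order to the
-- constructed one. The bound `k` makes the type of states finite and independent of the structure:
-- a subtree is attached to the rest through at most `k` elements, so that a set contributes its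
-- owned part and `k` bits. Element variables become singletons, which leaves one kind of quantifier
-- and avoids a case distinction on the piece that contains an element. Both directions are phrased
-- as definability of semantic predicates in coded structures; formulas are assembled by combinators
-- along with the proof of what they define.

private variable
  ι : Level
  A B C X : Set
  τ : Vocabulary
  𝓛 : Logic
  n m n′ m′ j : ℕ

-- Finite types and lists

open Finite public
open Equivalence public using (to; from)

infixr 3 _⟩⇔⟨_

⇔-refl : ∀ {a} {P : Set a} → P ⇔ P
⇔-refl = mk⇔ id id

⇔-sym : ∀ {a b} {P : Set a} {Q : Set b} → P ⇔ Q → Q ⇔ P
⇔-sym e = mk⇔ (from e) (to e)

_⟩⇔⟨_ : ∀ {a b c} {P : Set a} {Q : Set b} {R : Set c} → P ⇔ Q → Q ⇔ R → P ⇔ R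
e ⟩⇔⟨ f = mk⇔ (to f ∘ to e) (from e ∘ from f)

¬-⇔ : ∀ {a b} {P : Set a} {Q : Set b} → P ⇔ Q → (¬ P) ⇔ (¬ Q)
¬-⇔ e = mk⇔ (_∘ from e) (_∘ to e)

Σ-⇔ : ∀ {a b c} {X : Set a} {P : X → Set b} {Q : X → Set c} → (∀ x → P x ⇔ Q x) → Σ X P ⇔ Σ X Q
Σ-⇔ e = mk⇔ (λ (x , p) → x , to (e x) p) (λ (x , q) → x , from (e x) q)

Π-⇔ : ∀ {a b c} {X : Set a} {P : X → Set b} {Q : X → Set c} →
      (∀ x → P x ⇔ Q x) → (∀ x → P x) ⇔ (∀ x → Q x)
Π-⇔ e = mk⇔ (λ p x → to (e x) (p x)) (λ q x → from (e x) (q x))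

T-does : {P : Set} (P? : Dec P) → T (does P?) ⇔ P
T-does (yes p) = mk⇔ (λ _ → p) (λ _ → tt)
T-does (no ¬p) = mk⇔ (λ ()) ¬p

T-ext : ∀ {a b} → T a ⇔ T b → a ≡ b
T-ext {false} {false} e = refl
T-ext {false} {true}  e = ⊥-elim (from e tt)
T-ext {true}  {false} e = ⊥-elim (to e tt)
T-ext {true}  {true}  e = refl

T-≡ : ∀ {a b} → a ≡ b → T a ⇔ T b
T-≡ refl = ⇔-refl

T-true : ∀ {b} → T b ⇔ (b ≡ true)
T-true {false} = mk⇔ (λ ()) (λ ())
T-true {true}  = mk⇔ (λ _ → refl) (λ _ → tt)

_⇔-dec_ : {P Q : Set} → Dec P → Dec Q → Dec (P ⇔ Q)
yes p ⇔-dec yes q = yes (mk⇔ (λ _ → q) (λ _ → p))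
yes p ⇔-dec no ¬q = no λ e → ¬q (to e p)
no ¬p ⇔-dec yes q = no λ e → ¬p (from e q)
no ¬p ⇔-dec no ¬q = yes (mk⇔ (⊥-elim ∘ ¬p) (⊥-elim ∘ ¬q))

finite-all? : Finite A → {P : A → Set} → (∀ x → Dec (P x)) → Dec (∀ x → P x)
finite-all? F P? = map′ (λ ¬∃ x → decidable-stable (P? x) (λ ¬p → ¬∃ (x , ¬p)))
                        (λ p (x , ¬p) → ¬p (p x))
                        (¬? (finite-any? F (¬? ∘ P?)))

∈-finite? : Finite A → (x : A) (xs : List A) → Dec (x ∈ xs)
∈-finite? F x = any? (finite-≟ F x)

Bool-finite : Finite Bool
Bool-finite = record
  { elements = false ∷ true ∷ []
  ; complete = λ where false → here refl ; true → there (here refl)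
  ; unique   = ((λ ()) ∷ []) ∷ [] ∷ []
  }

∈-tuples⁺ : {xs : List A} {r : ℕ} {v : Vec A r} → (∀ i → lookup v i ∈ xs) → v ∈ tuples xs r
∈-tuples⁺ {v = []}    h = here refl
∈-tuples⁺ {v = x ∷ v} h = ∈-cartesianProductWith⁺ _∷_ (h zero) (∈-tuples⁺ (h ∘ suc))

tuples-unique : {xs : List A} → Unique xs → ∀ r → Unique (tuples xs r)
tuples-unique u zero    = [] ∷ []
tuples-unique u (suc r) = Unique.cartesianProductWith⁺ _∷_ ∷-injective u (tuples-unique u r)

Vec-finite : Finite A → ∀ n → Finite (Vec A n)
Vec-finite F n = record
  { elements = tuples (elements F) n
  ; complete = λ v → ∈-tuples⁺ (λ i → complete F (lookup v i))
  ; unique   = tuples-unique (unique F) n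
  }

lookup-injective : {xs : List A} → Unique xs → ∀ i j → List.lookup xs i ≡ List.lookup xs j → i ≡ j
lookup-injective (x∉ ∷ u) zero    zero    e = refl
lookup-injective (x∉ ∷ u) zero    (suc j) e = ⊥-elim (All.lookup x∉ (∈-lookup j) e)
lookup-injective (x∉ ∷ u) (suc i) zero    e = ⊥-elim (All.lookup x∉ (∈-lookup i) (sym e))
lookup-injective (x∉ ∷ u) (suc i) (suc j) e = cong suc (lookup-injective u i j e)

vec-ext : ∀ {n} {v w : Vec A n} → (∀ i → lookup v i ≡ lookup w i) → v ≡ w
vec-ext {v = v} {w} h = trans (sym (tabulate∘lookup v)) (trans (tabulate-cong h) (tabulate∘lookup w))

-- Subsets as bit vectors rather than Boolean functions: propositional equality is then extensional
-- and decidable, and the subsets of a finite type form a finite type. States contain nested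
-- subsets, which need all three properties.
Pow : Finite A → Set
Pow F = Vec Bool (length (elements F))

Pow-finite : (F : Finite A) → Finite (Pow F)
Pow-finite F = Vec-finite Bool-finite _

module _ (F : Finite A) where

  private
    ix : A → Fin (length (elements F))
    ix x = index (complete F x)

  abstract
    mem : Pow F → A → Bool
    mem p x = lookup p (ix x)

    comprehend : (A → Bool) → Pow F
    comprehend f = tabulate (f ∘ List.lookup (elements F))

    mem-comprehend : ∀ f x → mem (comprehend f) x ≡ f x
    mem-comprehend f x =
      trans (lookup∘tabulate _ (ix x)) (cong f (sym (lookup-index (complete F x))))

    Pow-ext : ∀ {p q} → (∀ x → mem p x ≡ mem q x) → p ≡ q
    Pow-ext {p} {q} h = vec-ext λ i →
      subst (λ j → lookup p j ≡ lookup q j)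
            (lookup-injective (unique F) (ix (List.lookup (elements F) i)) i
              (sym (lookup-index (complete F (List.lookup (elements F) i)))))
            (h (List.lookup (elements F) i))

unique∧set⇒↭ : {xs ys : List A} → Unique xs → Unique ys → (∀ x → x ∈ xs ⇔ x ∈ ys) → xs ↭ ys
unique∧set⇒↭ u v e = ∼bag⇒↭ (unique∧set⇒bag u v (λ {x} → e x))

∈-filterᵇ : (p : A → Bool) (xs : List A) {x : A} → x ∈ filterᵇ p xs ⇔ (x ∈ xs × T (p x))
∈-filterᵇ p xs = mk⇔ (∈-filter⁻ (T? ∘ p)) (λ (m , t) → ∈-filter⁺ (T? ∘ p) m t)

filterᵇ-unique : (p : A → Bool) {xs : List A} → Unique xs → Unique (filterᵇ p xs)
filterᵇ-unique p = Unique.filter⁺ (T? ∘ p)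

∈-concatMap : {f : A → List B} {xs : List A} {y : B} →
              y ∈ concatMap f xs ⇔ ∃ λ x → x ∈ xs × y ∈ f x
∈-concatMap {f = f} = mk⇔ (find ∘ ∈-concatMap⁻ f) (λ (x , x∈ , y∈) → ∈-concatMap⁺ f (lose x∈ y∈))

concatMap-unique : {f : A → List B} {xs : List A} → Unique xs →
                   (∀ x → x ∈ xs → Unique (f x)) →
                   (∀ {x x′ y} → x ∈ xs → x′ ∈ xs → y ∈ f x → y ∈ f x′ → x ≡ x′) →
                   Unique (concatMap f xs)
concatMap-unique []                   h d = []
concatMap-unique {f = f} {x ∷ xs} (x∉ ∷ u) h d =
  Unique.++⁺ (h x (here refl))
             (concatMap-unique u (λ z z∈ → h z (there z∈)) (λ a b → d (there a) (there b)))
             λ (y∈ , y∈′) → let (z , z∈ , y∈z) = to (∈-concatMap {f = f}) y∈′ in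
               All.lookup x∉ z∈ (d (here refl) (there z∈) y∈ y∈z)

-- Linear orders are handled as lists without repetitions, with `Before` as the strict order.
-- Concatenation is then the ordered sum, and the order of a subtree can be assembled from those of
-- its parts.
Before : List A → A → A → Set
Before []       x y = ⊥
Before (z ∷ zs) x y = (x ≡ z × y ∈ zs) ⊎ Before zs x y

before? : Finite A → (xs : List A) → ∀ x y → Dec (Before xs x y)
before? F []       x y = no λ ()
before? F (z ∷ zs) x y = (finite-≟ F x z ×-dec ∈-finite? F y zs) ⊎-dec before? F zs x y

Before-∈ˡ : {xs : List A} {x y : A} → Before xs x y → x ∈ xs
Before-∈ˡ {xs = _ ∷ _} (inj₁ (e , _)) = here e
Before-∈ˡ {xs = _ ∷ _} (inj₂ b)       = there (Before-∈ˡ b)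

Before-∈ʳ : {xs : List A} {x y : A} → Before xs x y → y ∈ xs
Before-∈ʳ {xs = _ ∷ _} (inj₁ (_ , m)) = there m
Before-∈ʳ {xs = _ ∷ _} (inj₂ b)       = there (Before-∈ʳ b)

Before-irrefl : {xs : List A} {x : A} → Unique xs → ¬ Before xs x x
Before-irrefl (z∉ ∷ u) (inj₁ (refl , m)) = All.lookup z∉ m refl
Before-irrefl (z∉ ∷ u) (inj₂ b)          = Before-irrefl u b

Before-trans : {xs : List A} {x y z : A} → Unique xs → Before xs x y → Before xs y z → Before xs x z
Before-trans (w∉ ∷ u) (inj₁ (refl , m)) (inj₁ (refl , _)) = ⊥-elim (All.lookup w∉ m refl)
Before-trans (w∉ ∷ u) (inj₁ (refl , m)) (inj₂ b)          = inj₁ (refl , Before-∈ʳ b)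
Before-trans (w∉ ∷ u) (inj₂ b)          (inj₁ (refl , _)) = ⊥-elim (All.lookup w∉ (Before-∈ʳ b) refl)
Before-trans (w∉ ∷ u) (inj₂ b)          (inj₂ c)          = inj₂ (Before-trans u b c)

Before-connex : {xs : List A} {x y : A} → x ∈ xs → y ∈ xs → x ≡ y ⊎ Before xs x y ⊎ Before xs y x
Before-connex (here refl) (here refl) = inj₁ refl
Before-connex (here refl) (there y∈)  = inj₂ (inj₁ (inj₁ (refl , y∈)))
Before-connex (there x∈)  (here refl) = inj₂ (inj₂ (inj₁ (refl , x∈)))
Before-connex (there x∈)  (there y∈)  with Before-connex x∈ y∈
... | inj₁ e        = inj₁ e
... | inj₂ (inj₁ b) = inj₂ (inj₁ (inj₂ b))
... | inj₂ (inj₂ b) = inj₂ (inj₂ (inj₂ b))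

Before-++ : (xs : List A) {ys : List A} {x y : A} →
            Before (xs ++ ys) x y ⇔ (Before xs x y ⊎ Before ys x y ⊎ (x ∈ xs × y ∈ ys))
Before-++ []       = mk⇔ (inj₂ ∘ inj₁) λ where
  (inj₂ (inj₁ b)) → b
  (inj₁ ())
  (inj₂ (inj₂ (() , _)))
Before-++ (z ∷ zs) {ys} {x} {y} = mk⇔ f g
  where
  f : Before (z ∷ zs ++ ys) x y → _
  f (inj₁ (e , m)) with ∈-++⁻ zs m
  ... | inj₁ m′ = inj₁ (inj₁ (e , m′))
  ... | inj₂ m′ = inj₂ (inj₂ (here e , m′))
  f (inj₂ b) with to (Before-++ zs) b
  ... | inj₁ b′               = inj₁ (inj₂ b′)
  ... | inj₂ (inj₁ b′)        = inj₂ (inj₁ b′)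
  ... | inj₂ (inj₂ (m , m′))  = inj₂ (inj₂ (there m , m′))
  g : _ → Before (z ∷ zs ++ ys) x y
  g (inj₁ (inj₁ (e , m)))         = inj₁ (e , ∈-++⁺ˡ m)
  g (inj₁ (inj₂ b))               = inj₂ (from (Before-++ zs) (inj₁ b))
  g (inj₂ (inj₁ b))               = inj₂ (from (Before-++ zs) (inj₂ (inj₁ b)))
  g (inj₂ (inj₂ (here e , m)))    = inj₁ (e , ∈-++⁺ʳ zs m)
  g (inj₂ (inj₂ (there m , m′)))  = inj₂ (from (Before-++ zs) (inj₂ (inj₂ (m , m′))))

Before-filterᵇ : (p : A → Bool) (xs : List A) {x y : A} →
                 Before (filterᵇ p xs) x y ⇔ (Before xs x y × T (p x) × T (p y))
Before-filterᵇ p []       = mk⇔ (λ ()) (λ ())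
Before-filterᵇ p (z ∷ zs) {x} {y} with p z in eq
... | true = mk⇔
  (λ where
    (inj₁ (refl , m)) → let (m′ , py) = to (∈-filterᵇ p zs) m in
                          inj₁ (refl , m′) , from T-true eq , py
    (inj₂ b)          → let (b′ , q) = to (Before-filterᵇ p zs) b in inj₂ b′ , q)
  (λ where
    (inj₁ (refl , m) , _ , py) → inj₁ (refl , from (∈-filterᵇ p zs) (m , py))
    (inj₂ b , q)               → inj₂ (from (Before-filterᵇ p zs) (b , q)))
... | false = mk⇔
  (λ b → let (b′ , q) = to (Before-filterᵇ p zs) b in inj₂ b′ , q)
  (λ where
    (inj₁ (refl , _) , px , _) → ⊥-elim (subst T eq px)
    (inj₂ b , q)               → from (Before-filterᵇ p zs) (b , q))

Before-map : {f : A → B} → (∀ {x y} → f x ≡ f y → x ≡ y) → (xs : List A) {x y : A} →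
             Before (List.map f xs) (f x) (f y) ⇔ Before xs x y
Before-map {f = f} inj []       = ⇔-refl
Before-map {f = f} inj (z ∷ zs) =
  (mk⇔ inj (cong f) ×-⇔ mk⇔ (λ m → let (w , w∈ , e) = ∈-map⁻ f m in subst (_∈ zs) (sym (inj e)) w∈)
                            (∈-map⁺ f))
  ⊎-⇔ Before-map inj zs

Before-concatMap : (f : A → List B) (xs : List A) {y y′ : B} →
  Before (concatMap f xs) y y′ ⇔
  ((∃ λ x → x ∈ xs × Before (f x) y y′) ⊎
   (∃ λ x → ∃ λ x′ → Before xs x x′ × y ∈ f x × y′ ∈ f x′))
Before-concatMap f []       = mk⇔ (λ ()) λ where (inj₁ (_ , () , _)) ; (inj₂ (_ , _ , () , _))
Before-concatMap f (z ∷ zs) {y} {y′} = Before-++ (f z) ⟩⇔⟨ mk⇔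
  (λ where
    (inj₁ b)        → inj₁ (z , here refl , b)
    (inj₂ (inj₁ b)) → case₁ (to (Before-concatMap f zs) b)
    (inj₂ (inj₂ (m , m′))) → let (x , x∈ , m″) = to ∈-concatMap m′ in
      inj₂ (z , x , inj₁ (refl , x∈) , m , m″))
  (λ where
    (inj₁ (_ , here refl , b)) → inj₁ b
    (inj₁ (x , there x∈ , b))  → inj₂ (inj₁ (from (Before-concatMap f zs) (inj₁ (x , x∈ , b))))
    (inj₂ (_ , x′ , inj₁ (refl , x′∈) , m , m′)) → inj₂ (inj₂ (m , from ∈-concatMap (x′ , x′∈ , m′)))
    (inj₂ (x , x′ , inj₂ b , q)) → inj₂ (inj₁ (from (Before-concatMap f zs) (inj₂ (x , x′ , b , q)))))
  where
  case₁ : _ → _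
  case₁ (inj₁ (x , x∈ , b))     = inj₁ (x , there x∈ , b)
  case₁ (inj₂ (x , x′ , b , q)) = inj₂ (x , x′ , inj₂ b , q)

cartesianProductWith≡concatMap : (f : A → B → C) (xs : List A) (ys : List B) →
  cartesianProductWith f xs ys ≡ concatMap (λ x → List.map (f x) ys) xs
cartesianProductWith≡concatMap f []       ys = refl
cartesianProductWith≡concatMap f (x ∷ xs) ys =
  cong (List.map (f x) ys ++_) (cartesianProductWith≡concatMap f xs ys)

-- The enumeration of all vectors is lexicographic. Siblings are compared by their vectors of
-- sources, and this makes the comparison definable entry by entry.
Before-tuples-∷ : {xs : List A} {r : ℕ} {x x′ : A} {v v′ : Vec A r} →
  x ∈ xs → v ∈ tuples xs r → v′ ∈ tuples xs r →
  Before (tuples xs (suc r)) (x ∷ v) (x′ ∷ v′) ⇔ (Before xs x x′ ⊎ (x ≡ x′ × Before (tuples xs r) v v′))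
Before-tuples-∷ {A} {xs} {r} {x} {x′} {v} {v′} x∈ v∈ v′∈ =
  subst (λ l → Before l (x ∷ v) (x′ ∷ v′) ⇔ Lex)
        (sym (cartesianProductWith≡concatMap _∷_ xs (tuples xs r)))
        (Before-concatMap (λ z → List.map (z ∷_) (tuples xs r)) xs ⟩⇔⟨ mk⇔ f g)
  where
  Lex Split : Set
  Lex   = Before xs x x′ ⊎ (x ≡ x′ × Before (tuples xs r) v v′)
  row : A → List (Vec A (suc r))
  row z = List.map (z ∷_) (tuples xs r)
  Split = (∃ λ z → z ∈ xs × Before (row z) (x ∷ v) (x′ ∷ v′)) ⊎
          (∃ λ z → ∃ λ z′ → Before xs z z′ × (x ∷ v) ∈ row z × (x′ ∷ v′) ∈ row z′)
  tail-inj : ∀ {z : A} {u w : Vec A r} → z ∷ u ≡ z ∷ w → u ≡ w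
  tail-inj refl = refl
  f : Split → Lex
  f (inj₁ (z , _ , b)) with ∈-map⁻ (z ∷_) (Before-∈ˡ b) | ∈-map⁻ (z ∷_) (Before-∈ʳ b)
  ... | _ , _ , refl | _ , _ , refl = inj₂ (refl , to (Before-map tail-inj (tuples xs r)) b)
  f (inj₂ (z , z′ , b , m , m′)) with ∈-map⁻ (z ∷_) m | ∈-map⁻ (z′ ∷_) m′
  ... | _ , _ , refl | _ , _ , refl = inj₁ b
  g : Lex → Split
  g (inj₁ b)          = inj₂ (x , x′ , b , ∈-map⁺ (x ∷_) v∈ , ∈-map⁺ (x′ ∷_) v′∈)
  g (inj₂ (refl , b)) = inj₁ (x , x∈ , from (Before-map tail-inj (tuples xs r)) b)

-- The reflexive order is the negation of the reversed strict one; order atoms are translated to set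
-- formulas in the same way.
listOrder : Finite A → {xs : List A} → Unique xs → (∀ x → x ∈ xs) → LinearOrder A
listOrder F {xs} u c = record
  { le           = λ x y → does (¬? (before? F xs y x))
  ; isTotalOrder = record
    { isPartialOrder = record
      { isPreorder = record
        { isEquivalence = record { refl = refl ; sym = sym ; trans = trans }
        ; reflexive     = λ where refl → in′ (Before-irrefl u)
        ; trans         = λ {x} {y} {z} p q → in′ λ b → tr (out p) (out q) b (Before-connex (c x) (c y))
        }
      ; antisym = λ {x} {y} p q → anti (out p) (out q) (Before-connex (c x) (c y))
      }
    ; total = tot
    }
  }
  where
  in′ : ∀ {x y} → ¬ Before xs y x → T (does (¬? (before? F xs y x)))
  in′ {x} {y} = from (T-does (¬? (before? F xs y x)))
  out : ∀ {x y} → T (does (¬? (before? F xs y x))) → ¬ Before xs y x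
  out {x} {y} = to (T-does (¬? (before? F xs y x)))
  tr : ∀ {x y z} → ¬ Before xs y x → ¬ Before xs z y → Before xs z x → x ≡ y ⊎ Before xs x y ⊎
    Before xs y x → ⊥
  tr p q b (inj₁ refl)     = q b
  tr p q b (inj₂ (inj₁ l)) = q (Before-trans u b l)
  tr p q b (inj₂ (inj₂ l)) = p l
  anti : ∀ {x y} → ¬ Before xs y x → ¬ Before xs x y → x ≡ y ⊎ Before xs x y ⊎ Before xs y x → x ≡ y
  anti p q (inj₁ e)        = e
  anti p q (inj₂ (inj₁ l)) = ⊥-elim (q l)
  anti p q (inj₂ (inj₂ l)) = ⊥-elim (p l)
  tot : ∀ x y → T (does (¬? (before? F xs y x))) ⊎ T (does (¬? (before? F xs x y)))
  tot x y with before? F xs y x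
  ... | no _  = inj₁ tt
  ... | yes b = inj₂ (in′ λ b′ → Before-irrefl u (Before-trans u b b′))

le-listOrder : (F : Finite A) {xs : List A} (u : Unique xs) (c : ∀ x → x ∈ xs) → ∀ {x y} →
               T (le (listOrder F u c) x y) ⇔ (¬ Before xs y x)
le-listOrder F {xs} u c {x} {y} = T-does (¬? (before? F xs y x))

-- Formulas

module Linearization (F : Finite A) (o : LinearOrder A) where

  private
    dto : DecTotalOrder _ _ _
    dto = record { Carrier = A ; _≈_ = _≡_ ; _≤_ = λ x y → T (le o x y)
                 ; isDecTotalOrder = record { isTotalOrder = isTotalOrder o
                                            ; _≟_ = finite-≟ F ; _≤?_ = λ x y → T? _ } }
    module S = Sort dto

  linearize : List A
  linearize = S.sort (elements F)

  linearize-complete : ∀ x → x ∈ linearize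
  linearize-complete x = ∈-resp-↭ (↭-sym (S.sort-↭ _)) (complete F x)

  linearize-unique : Unique linearize
  linearize-unique = Permutationₛ.Unique-resp-↭ (≡.setoid A) (↭⇒↭ₛ (↭-sym (S.sort-↭ _))) (unique F)

  private
    sorted-before : ∀ {xs x y} → AllPairs (λ x y → T (le o x y)) xs → Before xs x y → T (le o x y)
    sorted-before (h ∷ hs) (inj₁ (refl , m)) = All.lookup h m
    sorted-before (h ∷ hs) (inj₂ b)          = sorted-before hs b

    module O = IsTotalOrder (isTotalOrder o)

  Before-linearize : ∀ {x y} → Before linearize x y ⇔ (T (le o x y) × x ≢ y)
  Before-linearize {x} {y} = mk⇔
    (λ b → before-le b , λ { refl → Before-irrefl linearize-unique b })
    (λ (l , x≢y) → pick l x≢y (Before-connex (linearize-complete x) (linearize-complete y)))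
    where
    before-le : ∀ {x y} → Before linearize x y → T (le o x y)
    before-le = sorted-before (Sorted⇒AllPairs (DecTotalOrder.totalOrder dto) (S.sort-↗ (elements F)))
    pick : T (le o x y) → x ≢ y → x ≡ y ⊎ Before linearize x y ⊎ Before linearize y x → Before linearize x y
    pick l x≢y (inj₁ e)        = ⊥-elim (x≢y e)
    pick l x≢y (inj₂ (inj₁ b)) = b
    pick l x≢y (inj₂ (inj₂ b)) = ⊥-elim (x≢y (O.antisym l (before-le b)))

open Linearization public

count-cong : {p q : A → Bool} → (∀ x → T (p x) ⇔ T (q x)) → ∀ xs → count p xs ≡ count q xs
count-cong h []       = refl
count-cong {p = p} {q} h (x ∷ xs) with p x | q x | T-ext (h x)
... | false | .false | refl = count-cong h xs
... | true  | .true  | refl = cong suc (count-cong h xs)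

-- The images of the solutions of `p` and the solutions of `q` form two lists without repetitions
-- and with the same members, hence permutations of each other. It serves to compare counts across
-- universes and across enumerations.
count-bijection : (F : Finite A) (G : Finite B) {p : A → Bool} {q : B → Bool} (f : A → B) →
  (∀ {x y} → T (p x) → T (p y) → f x ≡ f y → x ≡ y) →
  (∀ b → T (q b) ⇔ (∃ λ a → T (p a) × f a ≡ b)) →
  count p (elements F) ≡ count q (elements G)
count-bijection F G {p} {q} f inj h =
  trans (sym (length-map f ps))
        (↭-length (unique∧set⇒↭ (map-unique (filterᵇ-unique p (unique F)) λ m →
          proj₂ (to (∈-filterᵇ p (elements F)) m))
                                (filterᵇ-unique q (unique G)) same))
  where
  ps = filterᵇ p (elements F)
  map-unique : ∀ {xs} → Unique xs → (∀ {x} → x ∈ xs → T (p x)) → Unique (List.map f xs)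
  map-unique []       all = []
  map-unique (_∷_ {x = x} x∉ u) all =
    All.tabulate (λ m e → let (y , y∈ , e′) = ∈-map⁻ f m in
      All.lookup x∉ y∈ (inj (all (here refl)) (all (there y∈)) (trans e e′)))
    ∷ map-unique u (all ∘ there)
  same : ∀ b → b ∈ List.map f ps ⇔ b ∈ filterᵇ q (elements G)
  same b = mk⇔
    (λ m → let (a , a∈ , e) = ∈-map⁻ f m in
      from (∈-filterᵇ q (elements G))
        (complete G b , from (h b) (a , proj₂ (to (∈-filterᵇ p (elements F)) a∈) , sym e)))
    (λ m → let (a , pa , e) = to (h b) (proj₂ (to (∈-filterᵇ q (elements G)) m)) in
      subst (_∈ _) e (∈-map⁺ f (from (∈-filterᵇ p (elements F)) (complete F a , pa))))

count-⊎ : {p q r : A → Bool} → (∀ x → T (r x) ⇔ (T (p x) ⊎ T (q x))) → (∀ x → T (p x) → ¬ T (q x)) →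
          ∀ xs → count r xs ≡ count p xs + count q xs
count-⊎ h d []       = refl
count-⊎ {p = p} {q} {r} h d (x ∷ xs) with p x | q x | r x | h x | d x
... | false | false | false | _ | _ = count-⊎ h d xs
... | false | false | true  | e | _ = ⊥-elim ([ id , id ]′ (to e tt))
... | false | true  | false | e | _ = ⊥-elim (from e (inj₂ tt))
... | false | true  | true  | _ | _ =
  trans (cong suc (count-⊎ h d xs)) (sym (ℕ.+-suc _ _))
... | true  | false | false | e | _ = ⊥-elim (from e (inj₁ tt))
... | true  | false | true  | _ | _ = cong suc (count-⊎ h d xs)
... | true  | true  | _     | _ | c = ⊥-elim (c tt tt)

count-none : {p : A → Bool} → (∀ x → ¬ T (p x)) → ∀ xs → count p xs ≡ 0
count-none h []       = refl
count-none {p = p} h (x ∷ xs) with p x | h x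
... | false | _ = count-none h xs
... | true  | c = ⊥-elim (c tt)

count-some : {p : A → Bool} (xs : List A) → count p xs ≢ 0 → ∃ λ x → T (p x)
count-some []       h = ⊥-elim (h refl)
count-some {p = p} (x ∷ xs) h with p x in eq
... | true  = x , subst T (sym eq) tt
... | false = count-some xs h

count-remove : (F : Finite A) {p q : A → Bool} {a : A} → T (p a) →
  (∀ x → T (q x) ⇔ (T (p x) × x ≢ a)) → count p (elements F) ≡ suc (count q (elements F))
count-remove F {p} {q} {a} pa h = trans
  (count-⊎ {p = λ x → does (finite-≟ F x a)} {q}
    (λ x → mk⇔ (λ px → split x px (finite-≟ F x a)) λ where
      (inj₁ t) → subst (T ∘ p) (sym (to (T-does (finite-≟ F x a)) t)) pa
      (inj₂ t) → proj₁ (to (h x) t))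
    (λ x t t′ → proj₂ (to (h x) t′) (to (T-does (finite-≟ F x a)) t)) (elements F))
  (cong (_+ count q (elements F))
    (count-bijection F ⊤-finite {q = λ _ → true} (λ _ → tt)
      (λ {x} {y} t t′ _ → trans (to (T-does (finite-≟ F x a)) t) (sym (to (T-does (finite-≟ F y a)) t′)))
      (λ _ → mk⇔ (λ _ → a , from (T-does (finite-≟ F a a)) refl , refl) (λ _ → tt))))
  where
  split : ∀ x → T (p x) → Dec (x ≡ a) → T (does (finite-≟ F x a)) ⊎ T (q x)
  split x px (yes e)  = inj₁ (from (T-does (finite-≟ F x a)) e)
  split x px (no x≢a) = inj₂ (from (h x) (px , x≢a))

-- Renaming, parameters, derived connectives and counting formulas

ext : (Fin n → Fin m) → Fin (suc n) → Fin (suc m)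
ext f zero    = zero
ext f (suc x) = suc (f x)

rename : (Fin n → Fin n′) → (Fin m → Fin m′) → Formula τ 𝓛 n m → Formula τ 𝓛 n′ m′
rename f g (atom R xs)  = atom R (Vec.map f xs)
rename f g (x ≐ y)      = f x ≐ f y
rename f g (x ∈̇ X)      = f x ∈̇ g X
rename f g (¬̇ φ)        = ¬̇ rename f g φ
rename f g (φ ∧̇ ψ)      = rename f g φ ∧̇ rename f g ψ
rename f g (∃̇ φ)        = ∃̇ (rename (ext f) g φ)
rename f g (∃̇ₛ φ)       = ∃̇ₛ (rename f (ext g) φ)
rename f g (modRel k R) = modRel k R
rename f g (modSet k X) = modSet k (g X)

≡-⇔ : {x y x′ y′ : A} → x ≡ x′ → y ≡ y′ → (x ≡ y) ⇔ (x′ ≡ y′)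
≡-⇔ refl refl = ⇔-refl

∣count-⇔ : ∀ {k} {p q : A → Bool} → (∀ x → p x ≡ q x) → ∀ xs → (k ∣ count p xs) ⇔ (k ∣ count q xs)
∣count-⇔ {k = k} h xs = mk⇔ (subst (k ∣_) e) (subst (k ∣_) (sym e))
  where e = count-cong (λ x → T-≡ (h x)) xs

rename-sat : (M : Structure τ) {ρ : Vec (U M) n} {ρ′ : Vec (U M) n′}
  {Ξ : Vec (U M → Bool) m} {Ξ′ : Vec (U M → Bool) m′}
  {f : Fin n → Fin n′} {g : Fin m → Fin m′} →
  (∀ x → lookup ρ′ (f x) ≡ lookup ρ x) → (∀ X a → lookup Ξ′ (g X) a ≡ lookup Ξ X a) →
  (φ : Formula τ 𝓛 n m) → Sat M ρ′ Ξ′ (rename f g φ) ⇔ Sat M ρ Ξ φ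
rename-sat M e s (atom R xs) =
  T-≡ (cong (rel M R) (trans (sym (map-∘ _ _ xs)) (map-cong e xs)))
rename-sat M e s (x ≐ y)      = ≡-⇔ (e x) (e y)
rename-sat M {Ξ = Ξ} e s (x ∈̇ X) = T-≡ (trans (s X _) (cong (lookup Ξ X) (e x)))
rename-sat M e s (¬̇ φ)        = ¬-⇔ (rename-sat M e s φ)
rename-sat M e s (φ ∧̇ ψ)      = rename-sat M e s φ ×-⇔ rename-sat M e s ψ
rename-sat M e s (∃̇ φ)        =
  Σ-⇔ λ a → rename-sat M (λ { zero → refl ; (suc x) → e x }) s φ
rename-sat M e s (∃̇ₛ φ)       =
  Σ-⇔ λ S → rename-sat M e (λ { zero _ → refl ; (suc X) → s X }) φ
rename-sat M e s (modRel k R) = ⇔-refl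
rename-sat M e s (modSet k X) = ∣count-⇔ (s X) (elements (U-finite M))

-- The parameters P₀, …, Pₚ₋₁ become the last p free set variables.
bindParams : ∀ p → Formula (τ ⊕ setsVoc p) cmso n m → Formula τ cmso n (m + p)
bindParams p (atom (inj₁ R) xs)         = atom R xs
bindParams {m = m} p (atom (inj₂ j) (x ∷ [])) = x ∈̇ (m ↑ʳ j)
bindParams p (x ≐ y)                    = x ≐ y
bindParams p (x ∈̇ X)                    = x ∈̇ (X ↑ˡ p)
bindParams p (¬̇ φ)                      = ¬̇ bindParams p φ
bindParams p (φ ∧̇ ψ)                    = bindParams p φ ∧̇ bindParams p ψ
bindParams p (∃̇ φ)                      = ∃̇ (bindParams p φ)
bindParams p (∃̇ₛ φ)                     = ∃̇ₛ (bindParams p φ)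
bindParams p (modRel k (inj₁ R))        = modRel k R
bindParams {m = m} p (modRel k (inj₂ j)) = modSet k (m ↑ʳ j)
bindParams p (modSet k X)               = modSet k (X ↑ˡ p)

-- Bridges the cardinality of a unary relation, which counts vectors of length one, and that of a
-- set variable, which counts elements.
count-tuples₁ : (p : Vec A 1 → Bool) (xs : List A) → count p (tuples xs 1) ≡ count (λ x → p (x ∷ [])) xs
count-tuples₁ p []       = refl
count-tuples₁ p (x ∷ xs) with p (x ∷ [])
... | true  = cong suc (count-tuples₁ p xs)
... | false = count-tuples₁ p xs

bindParams-sat : (M : Structure τ) {p : ℕ} (P : Fin p → U M → Bool) {ρ : Vec (U M) n}
  {Ξ : Vec (U M → Bool) m} {Ξ′ : Vec (U M → Bool) (m + p)} →
  (∀ X a → lookup Ξ′ (X ↑ˡ p) a ≡ lookup Ξ X a) → (∀ j a → lookup Ξ′ (m ↑ʳ j) a ≡ P j a) →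
  (φ : Formula (τ ⊕ setsVoc p) cmso n m) →
  Sat M ρ Ξ′ (bindParams p φ) ⇔ Sat (M ◂ P) ρ Ξ φ
bindParams-sat M P s t (atom (inj₁ R) xs)  = ⇔-refl
bindParams-sat M P s t (atom (inj₂ j) (x ∷ [])) = T-≡ (t j _)
bindParams-sat M P s t (x ≐ y)             = ⇔-refl
bindParams-sat M P s t (x ∈̇ X)             = T-≡ (s X _)
bindParams-sat M P s t (¬̇ φ)               = ¬-⇔ (bindParams-sat M P s t φ)
bindParams-sat M P s t (φ ∧̇ ψ)             = bindParams-sat M P s t φ ×-⇔ bindParams-sat M P s t ψ
bindParams-sat M P s t (∃̇ φ)               = Σ-⇔ λ a → bindParams-sat M P s t φ
bindParams-sat M P s t (∃̇ₛ φ)              =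
  Σ-⇔ λ S → bindParams-sat M P (λ { zero _ → refl ; (suc X) → s X }) t φ
bindParams-sat M P s t (modRel k (inj₁ R)) = ⇔-refl
bindParams-sat M P s t (modRel k (inj₂ j)) =
  ∣count-⇔ (t j) xs ⟩⇔⟨ mk⇔ (subst (k ∣_) (sym e)) (subst (k ∣_) e)
  where
  xs = elements (U-finite M)
  e = count-tuples₁ (rel (M ◂ P) (inj₂ j)) xs
bindParams-sat M P s t (modSet k X)        = ∣count-⇔ (s X) (elements (U-finite M))

∃ₛ* : ∀ N → Formula τ 𝓛 n (N + m) → Formula τ 𝓛 n m
∃ₛ* zero    φ = φ
∃ₛ* (suc N) φ = ∃ₛ* N (∃̇ₛ φ)

∃ₛ*-sat : (M : Structure τ) {ρ : Vec (U M) n} {Ξ : Vec (U M → Bool) m} → ∀ N (φ : Formula τ 𝓛 n (N + m)) →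
  Sat M ρ Ξ (∃ₛ* N φ) ⇔ ∃ λ (Ys : Vec (U M → Bool) N) → Sat M ρ (Ys Vec.++ Ξ) φ
∃ₛ*-sat M zero    φ = mk⇔ ([] ,_) λ { ([] , s) → s }
∃ₛ*-sat M (suc N) φ = ∃ₛ*-sat M N (∃̇ₛ φ) ⟩⇔⟨
  mk⇔ (λ (Ys , S , s) → S ∷ Ys , s) (λ { (S ∷ Ys , s) → Ys , S , s })

-- The existential form is false in the empty structure as well.
⊥̇ : Formula τ 𝓛 n m
⊥̇ = ∃̇ (¬̇ (zero ≐ zero))

infixr 5 _∨̇_
_∨̇_ : Formula τ 𝓛 n m → Formula τ 𝓛 n m → Formula τ 𝓛 n m
φ ∨̇ ψ = ¬̇ ((¬̇ φ) ∧̇ (¬̇ ψ))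

∀̇ : Formula τ 𝓛 (suc n) m → Formula τ 𝓛 n m
∀̇ φ = ¬̇ (∃̇ (¬̇ φ))

_⇒̇_ _⇔̇_ : Formula τ 𝓛 n m → Formula τ 𝓛 n m → Formula τ 𝓛 n m
φ ⇒̇ ψ = ¬̇ (φ ∧̇ (¬̇ ψ))
φ ⇔̇ ψ = (φ ⇒̇ ψ) ∧̇ (ψ ⇒̇ φ)

constF : {P : Set} → Dec P → Formula τ 𝓛 n m
constF P? = if does P? then (¬̇ ⊥̇) else ⊥̇

⋁̇ : {K : Set} → Finite K → (K → Formula τ 𝓛 n m) → Formula τ 𝓛 n m
⋁̇ F f = List.foldr (λ k φ → f k ∨̇ φ) ⊥̇ (elements F)

module _ (M : Structure τ) (ρ : Vec (U M) n) (Ξ : Vec (U M → Bool) m) where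

  private
    S? : (φ : Formula τ 𝓛 n m) → Dec (Sat M ρ Ξ φ)
    S? = sat? M ρ Ξ

  ⊥̇-sat : ¬ Sat M ρ Ξ (⊥̇ {𝓛 = 𝓛})
  ⊥̇-sat (_ , h) = h refl

  constF-sat : {P : Set} (P? : Dec P) → Sat M ρ Ξ (constF {𝓛 = 𝓛} P?) ⇔ P
  constF-sat {𝓛} (yes p) = mk⇔ (λ _ → p) (λ _ → ⊥̇-sat {𝓛})
  constF-sat {𝓛} (no ¬p) = mk⇔ (⊥-elim ∘ ⊥̇-sat {𝓛}) (⊥-elim ∘ ¬p)

  ∨̇-sat : (φ ψ : Formula τ 𝓛 n m) → Sat M ρ Ξ (φ ∨̇ ψ) ⇔ (Sat M ρ Ξ φ ⊎ Sat M ρ Ξ ψ)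
  ∨̇-sat φ ψ = mk⇔
    (λ h → decidable-stable (S? φ ⊎-dec S? ψ) λ n → h (n ∘ inj₁ , n ∘ inj₂))
    (λ { (inj₁ s) (n , _) → n s ; (inj₂ s) (_ , n) → n s })

  ∀̇-sat : (φ : Formula τ 𝓛 (suc n) m) → Sat M ρ Ξ (∀̇ φ) ⇔ (∀ a → Sat M (a ∷ ρ) Ξ φ)
  ∀̇-sat φ = mk⇔ (λ h a → decidable-stable (sat? M (a ∷ ρ) Ξ φ) λ n → h (a , n)) (λ h (a , n) → n (h a))

  ∀⇔̇-sat : (φ ψ : Formula τ 𝓛 (suc n) m) → Sat M ρ Ξ (∀̇ (φ ⇔̇ ψ)) ⇔
    (∀ a → Sat M (a ∷ ρ) Ξ φ ⇔ Sat M (a ∷ ρ) Ξ ψ)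
  ∀⇔̇-sat φ ψ = ∀̇-sat (φ ⇔̇ ψ) ⟩⇔⟨ Π-⇔ λ a → iff a
    where
    iff : ∀ a → Sat M (a ∷ ρ) Ξ (φ ⇔̇ ψ) ⇔ (Sat M (a ∷ ρ) Ξ φ ⇔ Sat M (a ∷ ρ) Ξ ψ)
    iff a = (imp φ ψ ×-⇔ imp ψ φ) ⟩⇔⟨ mk⇔ (λ (f , g) → mk⇔ f g) (λ e → to e , from e)
      where
      imp : (φ ψ : Formula τ 𝓛 (suc n) m) →
            Sat M (a ∷ ρ) Ξ (φ ⇒̇ ψ) ⇔ (Sat M (a ∷ ρ) Ξ φ → Sat M (a ∷ ρ) Ξ ψ)
      imp φ ψ = mk⇔ (λ h s → decidable-stable (sat? M (a ∷ ρ) Ξ ψ) λ n → h (s , n)) (λ h (s , n) → n (h s))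

  ⋁̇-sat : {K : Set} (F : Finite K) (f : K → Formula τ 𝓛 n m) →
          Sat M ρ Ξ (⋁̇ F f) ⇔ ∃ λ k → Sat M ρ Ξ (f k)
  ⋁̇-sat {𝓛} {K} F f = go (elements F) ⟩⇔⟨ mk⇔ (λ (k , _ , s) → k , s) (λ (k , s) → k , complete F k , s)
    where
    go : ∀ ks → Sat M ρ Ξ (List.foldr (λ k φ → f k ∨̇ φ) ⊥̇ ks) ⇔ ∃ λ k → k ∈ ks × Sat M ρ Ξ (f k)
    go []       = mk⇔ (⊥-elim ∘ ⊥̇-sat {𝓛}) λ { (_ , () , _) }
    go (k ∷ ks) = ∨̇-sat (f k) (List.foldr (λ k φ → f k ∨̇ φ) ⊥̇ ks) ⟩⇔⟨ mk⇔
      (λ where (inj₁ s) → k , here refl , s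
               (inj₂ s) → let (k′ , m , s′) = to (go ks) s in k′ , there m , s′)
      (λ where (_ , here refl , s) → inj₁ s
               (k′ , there m , s)  → inj₂ (from (go ks) (k′ , m , s)))

-- For `d = 0` this forces `c` to equal `r`; otherwise it says that `c` is at least `r` and
-- congruent to `r` modulo `d`. One notion thus covers both the exact values below a threshold and
-- the residues above it.
_≈⟨_,_⟩ : ℕ → ℕ → ℕ → Set
c ≈⟨ r , d ⟩ = ∃ λ q → c ≡ r + q × d ∣ q

_without_ : Fin m → Fin n → Formula τ 𝓛 (suc n) m
X without x = (zero ∈̇ X) ∧̇ (¬̇ (zero ≐ suc x))

-- The atoms of CMSO only express that `d` divides a cardinality; an offset `r` is expressed by
-- deleting `r` elements one after another.
cardₛ : ℕ → ℕ → Fin m → Formula τ cmso n m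
cardₛ d zero    X = modSet d X
cardₛ d (suc r) X = ∃̇
  ((zero ∈̇ X) ∧̇ ∃̇ₛ ((∀̇ ((zero ∈̇ zero) ⇔̇ (suc X without zero))) ∧̇ cardₛ d r zero))

cardₛ-sat : (M : Structure τ) (ρ : Vec (U M) n) (Ξ : Vec (U M → Bool) m) → ∀ d r X →
  Sat M ρ Ξ (cardₛ {m = m} d r X) ⇔ count (lookup Ξ X) (elements (U-finite M)) ≈⟨ r , d ⟩
cardₛ-sat M ρ Ξ d zero    X = mk⇔ (λ h → _ , refl , h) (λ { (_ , refl , h) → h })
cardₛ-sat M ρ Ξ d (suc r) X = mk⇔
  (λ (a , a∈ , Y , e , s) →
    let (q , e′ , d∣q) = to (cardₛ-sat M (a ∷ ρ) (Y ∷ Ξ) d r zero) s in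
    q , trans (count-remove (U-finite M) a∈ (to (isWithout a Y) e)) (cong suc e′) , d∣q)
  (λ (q , e , d∣q) →
    let (a , a∈) = count-some {p = lookup Ξ X} (elements (U-finite M)) (λ z → 0≢suc (trans (sym z) e))
        Y = λ x → does (isY? a x)
    in a , a∈ , Y , from (isWithout a Y) (isY a) ,
       from (cardₛ-sat M (a ∷ ρ) (Y ∷ Ξ) d r zero)
         (q , suc-injective (trans (sym (count-remove (U-finite M) a∈ (isY a))) e) , d∣q))
  where
  0≢suc : ∀ {k} → 0 ≢ suc k
  0≢suc ()
  isWithout : ∀ a Y → Sat {L = cmso} M (a ∷ ρ) (Y ∷ Ξ) (∀̇ ((zero ∈̇ zero) ⇔̇ (suc X without zero))) ⇔
              (∀ x → T (Y x) ⇔ (T (lookup Ξ X x) × x ≢ a))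
  isWithout a Y = ∀⇔̇-sat M (a ∷ ρ) (Y ∷ Ξ) {cmso} (zero ∈̇ zero) (suc X without zero)
  isY? : ∀ a x → Dec (T (lookup Ξ X x) × x ≢ a)
  isY? a x = T? _ ×-dec ¬? (finite-≟ (U-finite M) x a)
  isY : ∀ a x → T (does (isY? a x)) ⇔ (T (lookup Ξ X x) × x ≢ a)
  isY a x = T-does (isY? a x)

card : ℕ → ℕ → Formula τ cmso (suc n) m → Formula τ cmso n m
card d r φ = ∃̇ₛ ((∀̇ ((zero ∈̇ zero) ⇔̇ rename id suc φ)) ∧̇ cardₛ d r zero)

card-sat : (M : Structure τ) (ρ : Vec (U M) n) (Ξ : Vec (U M → Bool) m) → ∀ d r φ →
  Sat M ρ Ξ (card d r φ) ⇔
  count (λ a → does (sat? M (a ∷ ρ) Ξ φ)) (elements (U-finite M)) ≈⟨ r , d ⟩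
card-sat {τ} M ρ Ξ d r φ = mk⇔
  (λ (Y , e , s) → subst (_≈⟨ r , d ⟩) (count-cong (λ a →
       to (defines Y) e a ⟩⇔⟨ φ-sat a Y ⟩⇔⟨ ⇔-sym (T-does (sat? M (a ∷ ρ) Ξ φ)))
       (elements (U-finite M))) (to (cardₛ-sat M ρ (Y ∷ Ξ) d r zero) s))
  (λ s → let Y = λ a → does (sat? M (a ∷ ρ) Ξ φ) in Y ,
    from (defines Y) (λ a → T-does (sat? M (a ∷ ρ) Ξ φ) ⟩⇔⟨ ⇔-sym (φ-sat a Y)) ,
    from (cardₛ-sat M ρ (Y ∷ Ξ) d r zero) s)
  where
  φ′ : Formula τ cmso _ _
  φ′ = rename id suc φ
  φ-sat : ∀ a Y → Sat M (a ∷ ρ) (Y ∷ Ξ) φ′ ⇔ Sat M (a ∷ ρ) Ξ φ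
  φ-sat a Y = rename-sat M (λ _ → refl) (λ _ _ → refl) φ
  defines : ∀ Y → Sat M ρ (Y ∷ Ξ) (∀̇ ((zero ∈̇ zero) ⇔̇ φ′)) ⇔
                  (∀ a → T (Y a) ⇔ Sat M (a ∷ ρ) (Y ∷ Ξ) φ′)
  defines Y = ∀⇔̇-sat M ρ (Y ∷ Ξ) (zero ∈̇ zero) φ′

-- Definability in coded structures

iter : (X → X) → ℕ → X → X
iter f zero    x = x
iter f (suc n) x = f (iter f n x)

iter-+ : (f : X → X) (a b : ℕ) (x : X) → iter f (a + b) x ≡ iter f a (iter f b x)
iter-+ f zero    b x = refl
iter-+ f (suc a) b x = cong f (iter-+ f a b x)

record EventuallyPeriodic (g : ℕ → X) : Set where
  field
    preperiod  : ℕ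
    period-1   : ℕ

  period : ℕ
  period = suc period-1

  field
    periodic : ∀ n → g (n + preperiod + period) ≡ g (n + preperiod)

  periodic* : ∀ n q → g (n + preperiod + q * period) ≡ g (n + preperiod)
  periodic* n zero    = cong g (ℕ.+-identityʳ _)
  periodic* n (suc q) = trans (cong g (shift n preperiod period (q * period)))
                              (trans (periodic* (n + period) q)
                                (trans (cong g (swap n period preperiod)) (periodic n)))
    where
    shift : ∀ a b c d → a + b + (c + d) ≡ a + c + b + d
    shift = solve-∀
    swap : ∀ a b c → a + b + c ≡ a + c + b
    swap = solve-∀

-- Among one more iterates than there are elements, two coincide by the pigeonhole principle, and
-- from the earlier of them on the sequence repeats.
iter-eventuallyPeriodic : Finite X → (f : X → X) (x : X) → EventuallyPeriodic (λ n → iter f n x)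
iter-eventuallyPeriodic {X} F f x = record
  -- The period is the distance between the two equal iterates; it is positive as `i₁` lies before
  -- `i₂`, and its predecessor is stored.
  { preperiod = toℕ i₁ ; period-1 = toℕ i₂ ∸ suc (toℕ i₁) ; periodic = λ n → trans
      (cong (λ a → iter f a x) (trans (ℕ.+-assoc n _ _) (cong (n +_) j≡)))
      (trans (iter-+ f n (toℕ i₂) x) (trans (cong (iter f n) (sym same)) (sym (iter-+ f n (toℕ i₁) x)))) }
  where
  position : X → Fin (List.length (elements F))
  position y = index (complete F y)
  collision = Fin.pigeonhole (ℕ.n<1+n _) (λ a → position (iter f (toℕ a) x))
  i₁ = proj₁ collision
  i₂ = proj₁ (proj₂ collision)
  same : iter f (toℕ i₁) x ≡ iter f (toℕ i₂) x
  same = trans (lookup-index (complete F _))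
           (trans (cong (List.lookup (elements F)) (proj₂ (proj₂ (proj₂ collision))))
                  (sym (lookup-index (complete F _))))
  j≡ : toℕ i₁ + suc (toℕ i₂ ∸ suc (toℕ i₁)) ≡ toℕ i₂
  j≡ = trans (ℕ.+-suc _ _) (ℕ.m+[n∸m]≡n (proj₁ (proj₂ (proj₂ collision))))

module _ {g : ℕ → X} (E : EventuallyPeriodic g) where

  open EventuallyPeriodic E

  -- A value below the preperiod has to be met exactly, hence the modulus 0, which divides only 0.
  -- From the preperiod on only the class modulo the period counts.
  modulusOf : {P : Set} → Dec P → ℕ
  modulusOf (yes _) = 0
  modulusOf (no _)  = period

  modulus : ℕ → ℕ
  modulus r = modulusOf (r <? preperiod)

  -- A number below the preperiod represents itself; any other one is represented by the preperiod
  -- plus the remainder of the excess. Hence finitely many tests determine the value of `g c`.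
  periodic-⇔ : ∀ {c z} → (g c ≡ z) ⇔
    ∃ λ (r : Fin (preperiod + period)) → g (toℕ r) ≡ z × c ≈⟨ toℕ r , modulus (toℕ r) ⟩
  periodic-⇔ {c} {z} = mk⇔ (λ e → residue e (c <? preperiod)) (λ (r , e , q , c≡ , d) →
    trans (collapse (toℕ r) q c≡ d) e)
    where
    collapse : ∀ r q → c ≡ r + q → modulus r ∣ q → g c ≡ g r
    collapse r q refl d = cases (r <? preperiod) d
      where
      cases : (r< : Dec (r < preperiod)) → modulusOf r< ∣ q → g (r + q) ≡ g r
      cases (yes _) d = cong g (trans (cong (r +_) (0∣⇒≡0 d)) (ℕ.+-identityʳ r))
      cases (no r≮) (divides k refl) =
        subst (λ a → g (a + k * period) ≡ g a) (ℕ.m∸n+n≡m (ℕ.≮⇒≥ r≮)) (periodic* (r ∸ preperiod) k)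
    residue : g c ≡ z → Dec (c < preperiod) → _
    residue e (yes c<) = fromℕ< lt , trans (cong g eq) e , 0 , trans (sym eq) (sym (ℕ.+-identityʳ _)) , _ ∣0
      where
      lt : c < preperiod + period
      lt = ℕ.<-≤-trans c< (ℕ.m≤m+n _ _)
      eq = Fin.toℕ-fromℕ< lt
    residue e (no c≮) = fromℕ< lt , trans (sym (collapse _ q c≡ d)) e , q , c≡ , d
      where
      r = (c ∸ preperiod) % period
      q = (c ∸ preperiod) / period * period
      lt : preperiod + r < preperiod + period
      lt = ℕ.+-monoʳ-< preperiod (m%n<n (c ∸ preperiod) period)
      eq : toℕ (fromℕ< lt) ≡ preperiod + r
      eq = Fin.toℕ-fromℕ< lt
      c≡ : c ≡ toℕ (fromℕ< lt) + q
      c≡ = trans (sym (ℕ.m+[n∸m]≡n (ℕ.≮⇒≥ c≮)))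
             (trans (cong (preperiod +_) (m≡m%n+[m/n]*n (c ∸ preperiod) period))
               (trans (sym (ℕ.+-assoc preperiod r q)) (cong (_+ q) (sym eq))))
      d : modulus (toℕ (fromℕ< lt)) ∣ q
      d = cases (toℕ (fromℕ< lt) <? preperiod)
        where
        cases : (r< : Dec (toℕ (fromℕ< lt) < preperiod)) → modulusOf r< ∣ q
        cases (yes h) = ⊥-elim (ℕ.m+n≮m preperiod r (subst (_< preperiod) eq h))
        cases (no _)  = divides ((c ∸ preperiod) / period) refl

-- The iterates of a map on a finite set are eventually periodic, so the number
-- of solutions of φ matters only up to a threshold and modulo a period.
iterate : Finite X → (X → X) → X → X → Formula τ cmso (suc n) m → Formula τ cmso n m
iterate F f x z φ = ⋁̇ (Fin-finite (preperiod + period)) λ r →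
  constF (finite-≟ F (iter f (toℕ r) x) z) ∧̇ card (modulus ep (toℕ r)) (toℕ r) φ
  where
  ep = iter-eventuallyPeriodic F f x
  open EventuallyPeriodic ep

iterate-sat : (M : Structure τ) (ρ : Vec (U M) n) (Ξ : Vec (U M → Bool) m) →
  (F : Finite X) (f : X → X) (x z : X) (φ : Formula τ cmso (suc n) m) →
  Sat M ρ Ξ (iterate F f x z φ) ⇔
  (iter f (count (λ a → does (sat? M (a ∷ ρ) Ξ φ)) (elements (U-finite M))) x ≡ z)
iterate-sat M ρ Ξ F f x z φ =
  ⋁̇-sat M ρ Ξ (Fin-finite _) _ ⟩⇔⟨
  Σ-⇔ (λ r → constF-sat M ρ Ξ (finite-≟ F (iter f (toℕ r) x) z)
             ×-⇔ card-sat M ρ Ξ (modulus ep (toℕ r)) (toℕ r) φ) ⟩⇔⟨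
  ⇔-sym (periodic-⇔ ep)
  where
  ep = iter-eventuallyPeriodic F f x

-- Contexts are families of types of variables, one type for each sort, so that weakening and
-- renaming are plain functions on variables.
data _▹_ {X : Set} (E : X → Set) (κ : X) : X → Set where
  new : (E ▹ κ) κ
  old : ∀ {κ′} → E κ′ → (E ▹ κ) κ′

infixl 5 _▹_
infixr 5 _▸_

_▸_ : ∀ {ℓ} {X : Set} {E : X → Set} {F : X → Set ℓ} {κ : X} → F κ → (∀ κ′ → E κ′ → F κ′) → ∀ κ′ →
  (E ▹ κ) κ′ → F κ′
(a ▸ η) _ new     = a
(a ▸ η) _ (old x) = η _ x

-- A family of many-sorted universes Car i, each coded into w copies of the
-- universe of a structure M i: the elements of sort κ in the j-th copy are
-- defined by image κ j.
record Coding (ι : Level) (L : Logic) (σ : Vocabulary) : Set (lsuc (lsuc lzero ⊔ˡ ι)) where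
  field
    I           : Set ι
    M           : I → Structure σ
    w           : ℕ
    Sort        : Set
    Car         : I → Sort → Set
    Car-finite  : ∀ i κ → Finite (Car i κ)
    code        : ∀ i κ → Car i κ → U (M i) × Fin w
    decode      : ∀ i κ → U (M i) × Fin w → Maybe (Car i κ)
    decode-code : ∀ i κ v → decode i κ (code i κ v) ≡ just v
    image       : Sort → Fin w → Formula σ L 1 0
    image-sat   : ∀ i κ a j → Sat (M i) (a ∷ []) [] (image κ j) ⇔ ∃ λ v → code i κ v ≡ (a , j)
    Kind        : Set
    sortOf      : Kind → Sort
    Val         : Kind → Set
    Val-finite  : ∀ κ → Finite (Val κ)

  elt : ∀ i κ → Car i κ → U (M i)
  elt i κ v = proj₁ (code i κ v)

  copy : ∀ i κ → Car i κ → Fin w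
  copy i κ v = proj₂ (code i κ v)

  code-injective : ∀ i κ {v v′} → code i κ v ≡ code i κ v′ → v ≡ v′
  code-injective i κ {v} {v′} e = just-injective
    (trans (sym (decode-code i κ v)) (trans (cong (decode i κ) e) (decode-code i κ v′)))

module Definability {ι L σ} (𝒞 : Coding ι L σ) where

  open Coding 𝒞

  Elts : (Sort → Set) → I → Set
  Elts E i = ∀ κ → E κ → Car i κ

  Labs : (Kind → Set) → I → Set
  Labs S i = ∀ κ → S κ → Car i (sortOf κ) → Val κ

  private variable
    E E′ : Sort → Set
    S S′ : Kind → Set
    κ : Sort

  module _ (E : Sort → Set) (S : Kind → Set) where

    EltVars : ℕ → Set
    EltVars n = ∀ κ → E κ → Fin n × Fin w

    -- A labelling by finitely many values becomes one set variable for each value and each copy: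
    -- the set of those base elements that code, in this copy, an element with this label.
    LabVars : ℕ → Set
    LabVars m = ∀ κ → S κ → Val κ → Fin w → Fin m

  module _ (i : I) where

    record Coded {n m} (η : Elts E i) (Θ : Labs S i) (e : EltVars E S n) (s : LabVars E S m)
                 (ρ : Vec (U (M i)) n) (Ξ : Vec (U (M i) → Bool) m) : Set where
      field
        elts : ∀ κ x → code i κ (η κ x) ≡ (lookup ρ (proj₁ (e κ x)) , proj₂ (e κ x))
        labs : ∀ κ X v k → T (lookup Ξ (s κ X k (copy i _ v)) (elt i _ v)) ⇔ (Θ κ X v ≡ k)

  open Coded

  -- Definability is stated of a semantic predicate `P`. The formula is a witness that must be right
  -- for every structure of the family and for every way of coding the arguments in the variables at
  -- hand, which makes definable predicates closed under the combinators below.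
  record Def (E : Sort → Set) (S : Kind → Set) (P : ∀ i → Elts E i → Labs S i → Set) :
         Set (lsuc lzero ⊔ˡ ι) where
    field
      fm  : ∀ {n m} → EltVars E S n → LabVars E S m → Formula σ L n m
      sat : ∀ {n m} i {η Θ} (e : EltVars E S n) (s : LabVars E S m) ρ Ξ →
            Coded i η Θ e s ρ Ξ → Sat (M i) ρ Ξ (fm e s) ⇔ P i η Θ

  open Def public

  private variable
    P Q : ∀ i → Elts E i → Labs S i → Set

  resp : (∀ i η Θ → P i η Θ ⇔ Q i η Θ) → Def E S P → Def E S Q
  resp h d .fm = d .fm
  resp h d .sat i {η} {Θ} e s ρ Ξ c = d .sat i e s ρ Ξ c ⟩⇔⟨ h i η Θ

  along : (f : ∀ κ → E κ → E′ κ) (g : ∀ κ → S κ → S′ κ) → Def E S P →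
          Def E′ S′ (λ i η Θ → P i (λ κ x → η κ (f κ x)) (λ κ X → Θ κ (g κ X)))
  along f g d .fm e s = d .fm (λ κ x → e κ (f κ x)) (λ κ X → s κ (g κ X))
  along f g d .sat i e s ρ Ξ c = d .sat i _ _ ρ Ξ record
    { elts = λ κ x → c .elts κ (f κ x) ; labs = λ κ X → c .labs κ (g κ X) }

  ¬D : Def E S P → Def E S (λ i η Θ → ¬ P i η Θ)
  ¬D d .fm e s = ¬̇ d .fm e s
  ¬D d .sat i e s ρ Ξ c = ¬-⇔ (d .sat i e s ρ Ξ c)

  infixr 6 _∧D_
  infixr 5 _∨D_
  infixr 4 _⇒D_ _⇔D_

  _∧D_ : Def E S P → Def E S Q → Def E S (λ i η Θ → P i η Θ × Q i η Θ)
  (d ∧D d′) .fm e s = d .fm e s ∧̇ d′ .fm e s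
  (d ∧D d′) .sat i e s ρ Ξ c = d .sat i e s ρ Ξ c ×-⇔ d′ .sat i e s ρ Ξ c

  _∨D_ : Def E S P → Def E S Q → Def E S (λ i η Θ → P i η Θ ⊎ Q i η Θ)
  (d ∨D d′) .fm e s = d .fm e s ∨̇ d′ .fm e s
  (d ∨D d′) .sat i e s ρ Ξ c =
    ∨̇-sat (M i) ρ Ξ (d .fm e s) (d′ .fm e s) ⟩⇔⟨ (d .sat i e s ρ Ξ c ⊎-⇔ d′ .sat i e s ρ Ξ c)

  private
    imp : ∀ {M : Structure σ} {ρ : Vec (U M) n} {Ξ : Vec (U M → Bool) m} (φ ψ : Formula σ L n m)
      {P Q : Set} →
          Sat M ρ Ξ φ ⇔ P → Sat M ρ Ξ ψ ⇔ Q → Sat M ρ Ξ (φ ⇒̇ ψ) ⇔ (P → Q)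
    imp {M = M} {ρ} {Ξ} φ ψ e f = mk⇔
      (λ h p → to f (decidable-stable (sat? M ρ Ξ ψ) λ n → h (from e p , n)))
      (λ h (s , n) → n (from f (h (to e s))))

  _⇒D_ : Def E S P → Def E S Q → Def E S (λ i η Θ → P i η Θ → Q i η Θ)
  (d ⇒D d′) .fm e s = d .fm e s ⇒̇ d′ .fm e s
  (d ⇒D d′) .sat i e s ρ Ξ c = imp (d .fm e s) (d′ .fm e s) (d .sat i e s ρ Ξ c) (d′ .sat i e s ρ Ξ c)

  _⇔D_ : Def E S P → Def E S Q → Def E S (λ i η Θ → P i η Θ ⇔ Q i η Θ)
  d ⇔D d′ = resp (λ i η Θ → mk⇔ (λ (f , g) → mk⇔ f g) (λ e → to e , from e)) ((d ⇒D d′) ∧D (d′ ⇒D d))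

  constD : {K : Set} → Dec K → Def E S (λ _ _ _ → K)
  constD K? .fm e s = constF K?
  constD K? .sat i e s ρ Ξ c = constF-sat (M i) ρ Ξ K?

  ⋁D : {K : Set} → Finite K → {P : K → ∀ i → Elts E i → Labs S i → Set} → (∀ k → Def E S (P k)) →
       Def E S (λ i η Θ → Σ K λ k → P k i η Θ)
  ⋁D F d .fm e s = ⋁̇ F (λ k → d k .fm e s)
  ⋁D F d .sat i e s ρ Ξ c = ⋁̇-sat (M i) ρ Ξ F _ ⟩⇔⟨ Σ-⇔ λ k → d k .sat i e s ρ Ξ c

  -- A definable predicate is equivalent to satisfaction of a formula and hence decidable. This
  -- justifies universal quantifiers and finite conjunctions that are written with negations.
  stable : Def E S P → ∀ i η Θ → {n m : ℕ} {e : EltVars E S n} {s : LabVars E S m} {ρ : _} {Ξ : _} →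
           Coded i η Θ e s ρ Ξ → ¬ ¬ P i η Θ → P i η Θ
  stable d i η Θ {ρ = ρ} {Ξ} c nn =
    to (d .sat i _ _ ρ Ξ c) (decidable-stable (sat? (M i) ρ Ξ (d .fm _ _)) λ n →
      nn (n ∘ from (d .sat i _ _ ρ Ξ c)))

  ⋀D : {K : Set} → Finite K → {P : K → ∀ i → Elts E i → Labs S i → Set} → (∀ k → Def E S (P k)) →
       Def E S (λ i η Θ → ∀ k → P k i η Θ)
  ⋀D F d .fm e s = ¬̇ ⋁̇ F (λ k → ¬̇ d k .fm e s)
  ⋀D F {P} d .sat i {η} {Θ} e s ρ Ξ c =
    ¬-⇔ (⋁̇-sat (M i) ρ Ξ F _ ⟩⇔⟨ Σ-⇔ λ k → ¬-⇔ (d k .sat i e s ρ Ξ c)) ⟩⇔⟨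
    mk⇔ (λ h k → stable (d k) i η Θ c λ n → h (k , n)) (λ h (k , n) → n (h k))

  shift : EltVars E S n → ∀ κ → E κ → Fin (suc n) × Fin w
  shift e κ x = suc (proj₁ (e κ x)) , proj₂ (e κ x)

  module _ {E S} {i : I} {η : Elts E i} {Θ : Labs S i} {n m} {e : EltVars E S n} {s : LabVars E S m}
           {ρ : Vec (U (M i)) n} {Ξ : Vec (U (M i) → Bool) m} where

    Coded-▸ : Coded i η Θ e s ρ Ξ → ∀ {κ} (v : Car i κ) {a j} → code i κ v ≡ (a , j) →
              Coded i (v ▸ η) Θ ((zero , j) ▸ shift {E} {S} e) s (a ∷ ρ) Ξ
    Coded-▸ c v h .elts _ new     = h
    Coded-▸ c v h .elts _ (old x) = c .elts _ x
    Coded-▸ c v h .labs           = c .labs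

  inImage : Sort → Fin w → Formula σ L (suc n) m
  inImage κ j = rename (λ _ → zero) (λ ()) (image κ j)

  inImage-sat : ∀ i κ j a {ρ : Vec (U (M i)) n} {Ξ : Vec (U (M i) → Bool) m} →
                Sat (M i) (a ∷ ρ) Ξ (inImage κ j) ⇔ ∃ λ v → code i κ v ≡ (a , j)
  inImage-sat i κ j a = rename-sat (M i) (λ { zero → refl }) (λ ()) (image κ j) ⟩⇔⟨ image-sat i κ a j

  solution : {P : ∀ i → Elts (E ▹ κ) i → Labs S i → Set} → Def (E ▹ κ) S P → EltVars E S n →
    LabVars E S m → Fin w → Formula σ L (suc n) m
  solution {E} {κ} {S} d e s j = inImage κ j ∧̇ d .fm ((zero , j) ▸ shift {E} {S} e) s

  solution-sat : {P : ∀ i → Elts (E ▹ κ) i → Labs S i → Set} → (d : Def (E ▹ κ) S P) →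
    ∀ i {η Θ} (e : EltVars E S n) (s : LabVars E S m) ρ Ξ →
    Coded i η Θ e s ρ Ξ → ∀ j a →
    Sat (M i) (a ∷ ρ) Ξ (solution d e s j) ⇔ ∃ λ v → code i κ v ≡ (a , j) × P i (v ▸ η) Θ
  solution-sat {κ = κ} d i e s ρ Ξ c j a = mk⇔
    (λ (im , h) → let (v , cv) = to (inImage-sat i κ j a) im in
      v , cv , to (d .sat i _ s _ _ (Coded-▸ c v cv)) h)
    (λ (v , cv , p) → from (inImage-sat i κ j a) (v , cv) , from (d .sat i _ s _ _ (Coded-▸ c v cv)) p)

  ∃D : ∀ κ → {P : ∀ i → Elts (E ▹ κ) i → Labs S i → Set} → Def (E ▹ κ) S P →
    Def E S (λ i η Θ → Σ (Car i κ) λ v → P i (v ▸ η) Θ)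
  ∃D κ d .fm e s = ⋁̇ (Fin-finite w) λ j → ∃̇ (solution d e s j)
  ∃D κ d .sat i e s ρ Ξ c = ⋁̇-sat (M i) ρ Ξ (Fin-finite w) _ ⟩⇔⟨ mk⇔
    (λ (j , a , h) → let (v , _ , p) = to (solution-sat d i e s ρ Ξ c j a) h in v , p)
    (λ (v , p) → copy i κ v , elt i κ v , from (solution-sat d i e s ρ Ξ c _ _) (v , refl , p))

  ∀D : ∀ κ → {P : ∀ i → Elts (E ▹ κ) i → Labs S i → Set} → Def (E ▹ κ) S P →
    Def E S (λ i η Θ → (v : Car i κ) → P i (v ▸ η) Θ)
  ∀D κ d .fm = (¬D (∃D κ (¬D d))) .fm
  ∀D κ d .sat i {η} {Θ} e s ρ Ξ c = (¬D (∃D κ (¬D d))) .sat i e s ρ Ξ c ⟩⇔⟨ mk⇔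
    (λ h v → stable d i (v ▸ η) Θ (Coded-▸ c v refl) λ n → h (v , n))
    (λ h (v , n) → n (h v))

  labD : ∀ {κ} (X : S κ) (x : E (sortOf κ)) (k : Val κ) → Def E S (λ i η Θ → Θ κ X (η _ x) ≡ k)
  labD X x k .fm e s = proj₁ (e _ x) ∈̇ s _ X k (proj₂ (e _ x))
  labD {κ = κ} X x k .sat i {η} {Θ} e s ρ Ξ c =
    subst (λ (a , j) → T (lookup Ξ (s κ X k j) a) ⇔ (Θ κ X (η _ x) ≡ k)) (c .elts _ x)
      (c .labs κ X (η _ x) k)

  ≡D : ∀ {κ} (x y : E κ) → Def E S (λ i η Θ → η κ x ≡ η κ y)
  ≡D x y .fm e s = constF (proj₂ (e _ x) Fin.≟ proj₂ (e _ y)) ∧̇ (proj₁ (e _ x) ≐ proj₁ (e _ y))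
  ≡D x y .sat i e s ρ Ξ c =
    (constF-sat (M i) ρ Ξ (proj₂ (e _ x) Fin.≟ proj₂ (e _ y)) ×-⇔ ⇔-refl) ⟩⇔⟨ mk⇔
      (λ (j , a) → code-injective i _ (trans (c .elts _ x) (trans (cong₂ _,_ a j) (sym (c .elts _ y)))))
      (λ h → let p = trans (sym (c .elts _ x)) (trans (cong (code i _) h) (c .elts _ y)) in
        cong proj₂ p , cong proj₁ p)

  atomD : ∀ {r} (φ : Vec (Fin w) r → Formula σ L r 0) {Q : ∀ i → Vec (Σ Sort (Car i)) r → Set} →
    (∀ i vs → Sat (M i) (Vec.map (λ (κ , v) → elt i κ v) vs) []
      (φ (Vec.map (λ (κ , v) → copy i κ v) vs)) ⇔ Q i vs) →
    (xs : Vec (Σ Sort E) r) → Def E S (λ i η Θ → Q i (Vec.map (λ (κ , x) → κ , η κ x) xs))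
  atomD φ h xs .fm e s = rename (λ j → proj₁ (e _ (proj₂ (lookup xs j)))) (λ ())
    (φ (Vec.map (λ (κ , x) → proj₂ (e κ x)) xs))
  atomD {E} φ {Q} h xs .sat i {η} e s ρ Ξ c =
    rename-sat (M i) (λ j →
      trans (sym (cong proj₁ (c .elts _ _)))
      (sym (trans (lookup-map j elt′ vs) (cong elt′ (lookup-map j value xs)))))
      (λ ()) (φ (Vec.map (λ (κ , x) → proj₂ (e κ x)) xs)) ⟩⇔⟨
    subst (λ js → Sat (M i) (Vec.map elt′ vs) [] (φ js) ⇔ Q i vs)
      (trans (sym (map-∘ copy′ value xs)) (map-cong (λ (κ , x) → cong proj₂ (c .elts κ x)) xs)) (h i vs)
    where
    elt′ : Σ Sort (Car i) → U (M i)
    elt′ (κ , v) = elt i κ v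
    copy′ : Σ Sort (Car i) → Fin w
    copy′ (κ , v) = copy i κ v
    value : Σ Sort E → Σ Sort (Car i)
    value (κ , x) = κ , η κ x
    vs = Vec.map value xs

  module _ {E S} {κ : Kind} {P : ∀ i → Elts E i → Labs (S ▹ κ) i → Set} (d : Def E (S ▹ κ) P) where

    private
      F = Val-finite κ
      N = List.length (elements F)

      posn : Val κ → Fin w → Fin (N * w)
      posn k j = combine (index (complete F k)) j

      vars : LabVars E S m → ∀ κ′ → (S ▹ κ) κ′ → Val κ′ → Fin w → Fin (N * w + m)
      vars {m} s _ new     k j = posn k j ↑ˡ m
      vars     s _ (old X) k j = (N * w) ↑ʳ s _ X k j

      functional : ∀ n m → Formula σ L n (N * w + m)
      functional n m = ¬̇ ⋁̇ (Fin-finite w) λ j → ∃̇ (inImage (sortOf κ) j ∧̇ (¬̇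
        ⋁̇ F λ k → ¬̇ ⋁̇ F λ k′ → ¬̇ ((zero ∈̇ (posn k′ j ↑ˡ m)) ⇔̇ constF (finite-≟ F k k′))))

      module _ (i : I) (ρ : Vec (U (M i)) n) (Ξ : Vec (U (M i) → Bool) m) (Ys : Vec (U (M i) → Bool) (N * w)) where

        private
          labelled? : ∀ a j k k′ → Dec (T (lookup Ys (posn k′ j) a) ⇔ (k ≡ k′))
          labelled? a j k k′ = T? _ ⇔-dec finite-≟ F k k′

          Unlabelled : Set
          Unlabelled = Σ (Fin w) λ j → Σ (U (M i)) λ a → (∃ λ v → code i (sortOf κ) v ≡ (a , j)) ×
            ¬ (∃ λ k → ¬ (∃ λ k′ → ¬ (T (lookup Ys (posn k′ j) a) ⇔ (k ≡ k′))))

          functional-sat₀ : Sat (M i) ρ (Ys Vec.++ Ξ) (functional n m) ⇔ (¬ Unlabelled)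
          functional-sat₀ = ¬-⇔ (⋁̇-sat (M i) ρ _ (Fin-finite w) _ ⟩⇔⟨ Σ-⇔ λ j → Σ-⇔ λ a →
            inImage-sat i (sortOf κ) j a ×-⇔ ¬-⇔ (⋁̇-sat (M i) (a ∷ ρ) _ F _ ⟩⇔⟨ Σ-⇔ λ k → ¬-⇔ (
              ⋁̇-sat (M i) (a ∷ ρ) _ F _ ⟩⇔⟨ Σ-⇔ λ k′ → ¬-⇔ (cell a j k k′))))
            where
            cell : ∀ a j k k′ → Sat (M i) (a ∷ ρ) (Ys Vec.++ Ξ)
              ((zero ∈̇ (posn k′ j ↑ˡ m)) ⇔̇ constF (finite-≟ F k k′)) ⇔
                   (T (lookup Ys (posn k′ j) a) ⇔ (k ≡ k′))
            cell a j k k′ = (imp (zero ∈̇ (posn k′ j ↑ˡ m)) (constF (finite-≟ F k k′)) f g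
                             ×-⇔ imp (constF (finite-≟ F k k′)) (zero ∈̇ (posn k′ j ↑ˡ m)) g f) ⟩⇔⟨
                            mk⇔ (λ (p , q) → mk⇔ p q) (λ e → to e , from e)
              where
              f = T-≡ (cong (λ Y → Y a) (lookup-++ˡ Ys Ξ (posn k′ j)))
              g = constF-sat (M i) (a ∷ ρ) (Ys Vec.++ Ξ) (finite-≟ F k k′)

        functional-sat : Sat (M i) ρ (Ys Vec.++ Ξ) (functional n m) ⇔
          (∀ v → ∃ λ k → ∀ k′ → T (lookup Ys (posn k′ (copy i _ v)) (elt i (sortOf κ) v)) ⇔ (k ≡ k′))
        functional-sat = functional-sat₀ ⟩⇔⟨ mk⇔
          (λ h v → decidable-stable (finite-any? F λ k → finite-all? F (labelled? _ _ k)) λ n →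
             h (copy i _ v , elt i _ v , (v , refl) , λ (k , q) →
               n (k , λ k′ → decidable-stable (labelled? _ _ k k′) λ n′ → q (k′ , n′))))
          (λ { h (j , a , (v , refl) , n) → n (let (k , q) = h v in k , λ (k′ , n′) → n′ (q k′)) })

    -- A quantifier over labellings is a block of set quantifiers. Not every choice of sets codes a
    -- labelling; `functional` keeps those for which every element of the sort has exactly one
    -- value.
    ∃L : Def E S (λ i η Θ → Σ (Car i (sortOf κ) → Val κ) λ ℓ → P i η (ℓ ▸ Θ))
    ∃L .fm {n} {m} e s = ∃ₛ* (N * w) (functional n m ∧̇ d .fm e (vars s))
    ∃L .sat {n} {m} i {η} {Θ} e s ρ Ξ c = ∃ₛ*-sat (M i) (N * w) _ ⟩⇔⟨ mk⇔
      (λ (Ys , fn , h) → let l = to (functional-sat i ρ Ξ Ys) fn in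
        (proj₁ ∘ l) , to (d .sat i e (vars s) ρ _ (coded Ys _ λ v k → proj₂ (l v) k)) h)
      (λ (ℓ , p) → sets ℓ ,
        from (functional-sat i ρ Ξ (sets ℓ)) (λ v → ℓ v , sets-spec ℓ v) ,
        from (d .sat i e (vars s) ρ _ (coded (sets ℓ) ℓ (sets-spec ℓ))) p)
      where
      coded : ∀ Ys (ℓ : Car i (sortOf κ) → Val κ) →
        (∀ v k → T (lookup Ys (posn k (copy i _ v)) (elt i _ v)) ⇔ (ℓ v ≡ k)) →
        Coded i η (ℓ ▸ Θ) e (vars s) ρ (Ys Vec.++ Ξ)
      coded Ys ℓ h .elts = c .elts
      coded Ys ℓ h .labs _ new     v k = T-≡ (cong (λ Y → Y _) (lookup-++ˡ Ys Ξ _)) ⟩⇔⟨ h v k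
      coded Ys ℓ h .labs _ (old X) v k = T-≡ (cong (λ Y → Y _) (lookup-++ʳ Ys Ξ _)) ⟩⇔⟨ c .labs _ X v k
      label : (Car i (sortOf κ) → Val κ) → Fin N → Maybe (Car i (sortOf κ)) → Bool
      label ℓ q (just v) = does (finite-≟ F (ℓ v) (List.lookup (elements F) q))
      label ℓ q nothing  = false
      -- Membership of a base element is read off by decoding it. By `decode-code` this is right on
      -- codes, and membership is tested only there.
      sets : (Car i (sortOf κ) → Val κ) → Vec (U (M i) → Bool) (N * w)
      sets ℓ = tabulate λ p → let (q , j) = remQuot w p in λ a → label ℓ q (decode i (sortOf κ) (a , j))
      sets-spec : ∀ ℓ v k → T (lookup (sets ℓ) (posn k (copy i _ v)) (elt i _ v)) ⇔ (ℓ v ≡ k)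
      sets-spec ℓ v k = T-≡ (trans
          (cong (λ Y → Y (elt i _ v))
            (lookup∘tabulate (λ p a →
            label ℓ (proj₁ (remQuot {N} w p)) (decode i (sortOf κ) (a , proj₂ (remQuot {N} w p))))
              (posn k (copy i _ v))))
          (trans (cong (λ (q , j) → label ℓ q (decode i (sortOf κ) (elt i _ v , j)))
            (Fin.remQuot-combine {n = N} (index (complete F k)) (copy i _ v)))
                 (cong (label ℓ (index (complete F k))) (decode-code i _ v))))
        ⟩⇔⟨ T-does (finite-≟ F (ℓ v) _) ⟩⇔⟨ ≡-⇔ refl (sym (lookup-index (complete F k)))

-- Counting in coded structures

module Counting {ι σ} (𝒞 : Coding ι cmso σ) where

  open Coding 𝒞
  open Definability 𝒞

  module _ {E : Sort → Set} {S : Kind → Set} {κ : Sort} {p : ∀ i → Elts (E ▹ κ) i → Labs S i → Bool}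
           (d : Def (E ▹ κ) S (λ i η Θ → T (p i η Θ)))
           {X : Set} (F : Finite X) (f : X → X) where

    private
      chain : EltVars E S n → LabVars E S m → List (Fin w) → X → X → Formula σ cmso n m
      chain e s []       x z = constF (finite-≟ F x z)
      chain e s (j ∷ js) x z = ⋁̇ F λ y → iterate F f x y (solution d e s j) ∧̇ chain e s js y z

    -- The solutions in different copies are counted by different formulas. The iteration therefore
    -- proceeds copy by copy, with a disjunction over the value reached after each copy.
    countD : ∀ x z → Def E S (λ i η Θ → iter f (count (λ v → p i (v ▸ η) Θ) (elements (Car-finite i κ)))
      x ≡ z)
    countD x z .fm e s = chain e s (allFin w) x z
    countD x z .sat i {η} {Θ} e s ρ Ξ c = go (allFin w) (Unique.allFin⁺ w) x ⟩⇔⟨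
      ≡-⇔ (cong (λ a → iter f a x) (count-cong (λ v → T-does (inCopies? (allFin w) v) ⟩⇔⟨
             mk⇔ proj₁ (λ t → t , complete (Fin-finite w) _)) els)) refl
      where
      els = elements (Car-finite i κ)
      inCopies? : ∀ js v → Dec (T (p i (v ▸ η) Θ) × copy i κ v ∈ js)
      inCopies? js v = T? _ ×-dec ∈-finite? (Fin-finite w) (copy i κ v) js
      inCopy? : ∀ j v → Dec (T (p i (v ▸ η) Θ) × copy i κ v ≡ j)
      inCopy? j v = T? _ ×-dec (copy i κ v Fin.≟ j)
      go : ∀ js → Unique js → ∀ x → Sat (M i) ρ Ξ (chain e s js x z) ⇔
           (iter f (count (λ v → does (inCopies? js v)) els) x ≡ z)
      go [] _ x = constF-sat (M i) ρ Ξ (finite-≟ F x z) ⟩⇔⟨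
        ≡-⇔ (cong (λ a → iter f a x)
          (sym (count-none (λ v t → no∈ (proj₂ (to (T-does (inCopies? [] v)) t))) els))) refl
        where
        no∈ : ∀ {a : Fin w} → ¬ a ∈ []
        no∈ ()
      go (j ∷ js) (j∉ ∷ u) x =
        ⋁̇-sat (M i) ρ Ξ F _ ⟩⇔⟨
          Σ-⇔ (λ y → iterate-sat (M i) ρ Ξ F f x y (solution d e s j) ×-⇔ go js u y) ⟩⇔⟨
        mk⇔ (λ { (_ , refl , h) → trans total h }) (λ h → _ , refl , trans (sym total) h)
        where
        #j = count (λ a → does (sat? (M i) (a ∷ ρ) Ξ (solution d e s j))) (elements (U-finite (M i)))
        copy-count : count (λ v → does (inCopy? j v)) els ≡ #j
        copy-count = count-bijection (Car-finite i κ) (U-finite (M i)) (elt i κ)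
          (λ {v} {v′} t t′ h → code-injective i κ (cong₂ _,_ h
            (trans (proj₂ (to (T-does (inCopy? j v)) t)) (sym (proj₂ (to (T-does (inCopy? j v′)) t′))))))
          (λ a → T-does (sat? (M i) (a ∷ ρ) Ξ (solution d e s j)) ⟩⇔⟨ solution-sat d i e s ρ Ξ c j a ⟩⇔⟨ mk⇔
            (λ (v , h , t) → v , from (T-does (inCopy? j v)) (t , cong proj₂ h) , cong proj₁ h)
            (λ (v , t , h) → let (q , h′) = to (T-does (inCopy? j v)) t in v , cong₂ _,_ h h′ , q))
        total : iter f (count (λ v → does (inCopies? (j ∷ js) v)) els) x ≡
                iter f (count (λ v → does (inCopies? js v)) els) (iter f #j x)
        total = trans (cong (λ a → iter f a x) (trans
            (count-⊎ {p = λ v → does (inCopies? js v)} {λ v → does (inCopy? j v)}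
              (λ v → T-does (inCopies? (j ∷ js) v) ⟩⇔⟨ mk⇔
                (λ where (t , here h)  → inj₂ (from (T-does (inCopy? j v)) (t , h))
                         (t , there h) → inj₁ (from (T-does (inCopies? js v)) (t , h)))
                (λ where (inj₁ t) → let (q , h) = to (T-does (inCopies? js v)) t in q , there h
                         (inj₂ t) → let (q , h) = to (T-does (inCopy? j v)) t in q , here h))
              (λ v t t′ → All.lookup j∉ (proj₂ (to (T-does (inCopies? js v)) t))
                            (sym (proj₂ (to (T-does (inCopy? j v)) t′))))
              els)
            (cong (_ +_) copy-count)))
          (iter-+ f (count (λ v → does (inCopies? js v)) els) #j x)

-- From CMSO to order-invariant MSO

run : {K : Set} → (A → K → K) → K → List A → K
run step q []       = q
run step q (x ∷ xs) = run step (step x q) xs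

Minimal Maximal : List A → A → Set
Minimal xs x = x ∈ xs × (∀ z → ¬ Before xs z x)
Maximal xs x = x ∈ xs × (∀ z → ¬ Before xs x z)

Covers : List A → A → A → Set
Covers xs x y = Before xs x y × (∀ z → ¬ (Before xs x z × Before xs z y))

module _ {K : Set} (F : Finite A) (step : A → K → K) where

  -- The conditions are local to consecutive elements, so MSO with the order can state them. `empty`
  -- is separate because an empty list has no maximal element from which to read the final state.
  record Run (xs : List A) (q₀ q : K) (ℓ : A → K) : Set where
    field
      first : ∀ x → Minimal xs x → ℓ x ≡ step x q₀
      next  : ∀ x y → Covers xs x y → ℓ y ≡ step y (ℓ x)
      last  : ∀ x → Maximal xs x → ℓ x ≡ q
      empty : (∀ x → ¬ x ∈ xs) → q₀ ≡ q

  open Run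

  -- Dropping the head `x` leaves a run on the tail that starts from the label of `x`: the least
  -- element of the tail covers `x`, and if the tail is empty then `x` itself is maximal.
  Run⇒run : ∀ {xs q₀ q ℓ} → Unique xs → Run xs q₀ q ℓ → run step q₀ xs ≡ q
  Run⇒run {[]}     u        r = r .empty λ _ ()
  Run⇒run {x ∷ xs} {q₀} {q} {ℓ} (x∉ ∷ u) r =
    trans (cong (λ p → run step p xs) (sym (r .first x (here refl , λ _ → not-before)))) (Run⇒run u record
      { first = λ z (z∈ , min) → r .next x z (inj₁ (refl , z∈) , λ where
          w (b , inj₁ (refl , _)) → not-before b
          w (_ , inj₂ b)          → min w b)
      ; next  = λ y z (b , cov) → r .next y z (inj₂ b , λ where
          w (inj₁ (refl , _) , _) → All.lookup x∉ (Before-∈ˡ b) refl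
          w (inj₂ b′ , inj₁ (refl , _)) → All.lookup x∉ (Before-∈ʳ b′) refl
          w (inj₂ b′ , inj₂ b″)   → cov w (b′ , b″))
      ; last  = λ z (z∈ , max) → r .last z (there z∈ , λ where
          w (inj₁ (refl , _)) → All.lookup x∉ z∈ refl
          w (inj₂ b)          → max w b)
      ; empty = λ none → r .last x (here refl , λ where
          w (inj₁ (_ , m)) → none w m
          w (inj₂ b)       → none w (Before-∈ʳ b))
      })
    where
    not-before : ∀ {z} → ¬ Before (x ∷ xs) z x
    not-before (inj₁ (_ , m)) = All.lookup x∉ m refl
    not-before (inj₂ b)       = All.lookup x∉ (Before-∈ʳ b) refl

  run⇒Run : ∀ {xs q₀} → Unique xs → ∃ (Run xs q₀ (run step q₀ xs))
  run⇒Run {[]} {q₀} u = (λ _ → q₀) , record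
    { first = λ { _ (() , _) } ; next = λ { _ _ (() , _) } ; last = λ { _ (() , _) } ; empty = λ _ → refl }
  run⇒Run {x ∷ xs} {q₀} (x∉ ∷ u) = ℓ , record
    { first = first′
    ; next  = next′
    ; last  = λ where
        z (here refl , max) → trans ℓ-here (r .empty λ w w∈ → max w (inj₁ (refl , w∈)))
        z (there z∈ , max)  → trans (ℓ-there z∈) (r .last z (z∈ , λ w b → max w (inj₂ b)))
    ; empty = λ none → ⊥-elim (none x (here refl))
    }
    where
    ℓ′ = proj₁ (run⇒Run {xs} {step x q₀} u)
    r  = proj₂ (run⇒Run {xs} {step x q₀} u)
    override : ∀ z → Dec (z ≡ x) → K
    override z (yes _) = step x q₀
    override z (no _)  = ℓ′ z
    ℓ : A → K
    ℓ z = override z (finite-≟ F z x)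
    ℓ-here : ℓ x ≡ step x q₀
    ℓ-here with finite-≟ F x x
    ... | yes _ = refl
    ... | no ≢  = ⊥-elim (≢ refl)
    ℓ-there : ∀ {z} → z ∈ xs → ℓ z ≡ ℓ′ z
    ℓ-there {z} z∈ with finite-≟ F z x
    ... | yes refl = ⊥-elim (All.lookup x∉ z∈ refl)
    ... | no _     = refl
    first′ : ∀ z → Minimal (x ∷ xs) z → ℓ z ≡ step z q₀
    first′ z (here refl , _)  = ℓ-here
    first′ z (there z∈ , min) = ⊥-elim (min x (inj₁ (refl , z∈)))
    next′ : ∀ y z → Covers (x ∷ xs) y z → ℓ z ≡ step z (ℓ y)
    next′ y z (inj₁ (refl , z∈) , cov) = trans (ℓ-there z∈) (trans
      (r .first z (z∈ , λ w b → cov w (inj₁ (refl , Before-∈ˡ b) , inj₂ b))) (cong (step z) (sym ℓ-here)))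
    next′ y z (inj₂ b , cov) = trans (ℓ-there (Before-∈ʳ b)) (trans
      (r .next y z (b , λ w (b′ , b″) → cov w (inj₂ b′ , inj₂ b″)))
      (cong (step z) (sym (ℓ-there (Before-∈ˡ b)))))

-- A finite quotient of addition that still decides divisibility by `d`; `⌊⌋-+` says that a running
-- sum may be reduced at every step. Its classes are the states of the counting automaton.
record Residues (d : ℕ) : Set where
  field
    size : ℕ
    ⌊_⌋  : ℕ → Fin (suc size)
    ⌊⌋-+ : ∀ a b → ⌊ toℕ ⌊ a ⌋ + b ⌋ ≡ ⌊ a + b ⌋
    ⌊⌋-∣ : ∀ a → (⌊ a ⌋ ≡ ⌊ 0 ⌋) ⇔ (d ∣ a)

-- Since 0 ∣ a only for a ≡ 0, the quotient for d = 0 separates 0 from the rest.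
residues : ∀ d → Residues d
residues zero = record
  { size = 1 ; ⌊_⌋ = λ { zero → zero ; (suc _) → suc zero }
  ; ⌊⌋-+ = λ { zero b → refl ; (suc a) b → refl }
  ; ⌊⌋-∣ = λ { zero → mk⇔ (λ _ → 0 ∣0) (λ _ → refl) ; (suc a) →
    mk⇔ (λ ()) (λ h → ⊥-elim (nonzero (0∣⇒≡0 h))) }
  }
  where
  nonzero : ∀ {a} → suc a ≢ 0
  nonzero ()
residues (suc d) = record
  { size = d ; ⌊_⌋ = _mod suc d
  ; ⌊⌋-+ = λ a b → Fin.toℕ-injective (trans (toℕ-mod (toℕ (a mod suc d) + b)) (trans
      (cong (λ c → (c + b) % suc d) (toℕ-mod a)) (trans (absorb a b) (sym (toℕ-mod (a + b))))))
  ; ⌊⌋-∣ = λ a → mk⇔ (λ e → trans (sym (toℕ-mod a)) (cong toℕ e))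
                     (λ e → Fin.toℕ-injective (trans (toℕ-mod a) e)) ⟩⇔⟨ m%n≡0⇔n∣m a (suc d)
  }
  where
  toℕ-mod : ∀ a → toℕ (a mod suc d) ≡ a % suc d
  toℕ-mod a = Fin.toℕ-fromℕ< (m%n<n a (suc d))
  absorb : ∀ a b → (a % suc d + b) % suc d ≡ (a + b) % suc d
  absorb a b = trans (%-distribˡ-+ (a % suc d) b (suc d)) (trans
    (cong (λ c → (c + b % suc d) % suc d) (m%n%n≡m%n a (suc d))) (sym (%-distribˡ-+ a b (suc d))))

count-++ : (p : A → Bool) (xs ys : List A) → count p (xs List.++ ys) ≡ count p xs + count p ys
count-++ p xs ys = trans (cong length (filter-++ (T? ∘ p) xs ys)) (length-++ (filterᵇ p xs))

count-map : {B : Set} (p : B → Bool) (f : A → B) (xs : List A) → count p (List.map f xs) ≡ count (p ∘ f) xs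
count-map p f []       = refl
count-map p f (x ∷ xs) with p (f x)
... | true  = cong suc (count-map p f xs)
... | false = count-map p f xs

count-tuples : {r : ℕ} (p : Vec A (suc r) → Bool) (xs : List A) →
  count p (tuples xs (suc r)) ≡ sum (List.map (λ x → count (p ∘ (x ∷_)) (tuples xs r)) xs)
count-tuples {A} {r} p xs = go xs
  where
  go : ∀ ys → count p (List.cartesianProductWith _∷_ ys (tuples xs r)) ≡
              sum (List.map (λ x → count (p ∘ (x ∷_)) (tuples xs r)) ys)
  go []       = refl
  go (y ∷ ys) = trans (count-++ p (List.map (y ∷_) (tuples xs r)) _)
                      (cong₂ _+_ (count-map p (y ∷_) (tuples xs r)) (go ys))

count-list-cong : (F : Finite A) {xs : List A} → Unique xs → (∀ x → x ∈ xs) →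
  ∀ {r} (p : Vec A r → Bool) → count p (tuples (elements F) r) ≡ count p (tuples xs r)
count-list-cong F u c {r} p = count-bijection (Vec-finite F r)
  (Vec-finite record { elements = _ ; complete = c ; unique = u } r)
  id (λ _ _ e → e) (λ v → mk⇔ (λ t → v , t , refl) λ { (_ , t , refl) → t })

data OrderKind : Set where
  set     : OrderKind
  residue : ℕ → OrderKind

-- A trivial coding, with one sort and one copy, that makes the definability combinators available
-- for ordered structures.
orderedCoding : (τ : Vocabulary) → Coding (lsuc lzero) mso (τ ⊕ orderVoc)
orderedCoding τ = record
  { I = Σ (Structure τ) (LinearOrder ∘ U) ; M = λ (A , o) → A ◃ o ; w = 1
  ; Sort = ⊤ ; Car = λ (A , _) _ → U A ; Car-finite = λ (A , _) _ → U-finite A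
  ; code = λ _ _ a → a , zero ; decode = λ _ _ (a , _) → just a ; decode-code = λ _ _ _ → refl
  ; image = λ _ _ → zero ≐ zero
  ; image-sat = λ { _ _ a zero → mk⇔ (λ _ → a , refl) (λ _ → refl) }
  ; Kind = OrderKind ; sortOf = λ _ → tt
  ; Val = λ { set → Bool ; (residue k) → Fin (suc k) }
  ; Val-finite = λ { set → Bool-finite ; (residue k) → Fin-finite (suc k) }
  }

module OrderedCounting (τ : Vocabulary) where

  open Coding (orderedCoding τ)
  open Definability (orderedCoding τ)

  private variable
    E : ⊤ → Set
    S : OrderKind → Set

  list : (i : I) → List (U (proj₁ i))
  list (A , o) = linearize (U-finite A) o

  list-complete : ∀ i x → x ∈ list i
  list-complete (A , o) = linearize-complete (U-finite A) o

  list-unique : ∀ i → Unique (list i)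
  list-unique (A , o) = linearize-unique (U-finite A) o

  relD : (R : Symbol τ) (xs : Vec (E tt) (arity τ R)) →
         Def E S (λ (A , _) η Θ → T (rel A R (Vec.map (η tt) xs)))
  relD R xs = resp (λ (A , _) η Θ →
    T-≡ (cong (rel A R) (trans (sym (Vec.map-∘ _ _ _)) (sym (Vec.map-∘ _ _ xs)))))
    (atomD (λ _ → atom (inj₁ R) (Vec.allFin _)) {λ (A , _) vs → T (rel A R (Vec.map proj₂ vs))}
      (λ (A , _) vs → T-≡ (cong (rel A R) (Vec.map-lookup-allFin _))) (Vec.map (tt ,_) xs))

  leD : (x y : E tt) → Def E S (λ (A , o) η Θ → T (le o (η tt x) (η tt y)))
  leD x y = atomD (λ _ → atom (inj₂ tt) (zero ∷ suc zero ∷ []))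
    {λ { (A , o) ((_ , a) ∷ (_ , b) ∷ []) → T (le o a b) }}
    (λ { (A , o) ((_ , a) ∷ (_ , b) ∷ []) → ⇔-refl }) ((tt , x) ∷ (tt , y) ∷ [])

  beforeD : (x y : E tt) → Def E S (λ i η Θ → Before (list i) (η tt x) (η tt y))
  beforeD x y = resp (λ (A , o) η Θ → ⇔-sym (Before-linearize (U-finite A) o)) (leD x y ∧D ¬D (≡D x y))

  minimalD : (x : E tt) → Def E S (λ i η Θ → Minimal (list i) (η tt x))
  minimalD x = resp (λ i η Θ → mk⇔ (λ h → list-complete i _ , h) proj₂) (∀D tt (¬D (beforeD new (old x))))

  maximalD : (x : E tt) → Def E S (λ i η Θ → Maximal (list i) (η tt x))
  maximalD x = resp (λ i η Θ → mk⇔ (λ h → list-complete i _ , h) proj₂) (∀D tt (¬D (beforeD (old x) new)))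

  coversD : (x y : E tt) → Def E S (λ i η Θ → Covers (list i) (η tt x) (η tt y))
  coversD x y = beforeD x y ∧D ∀D tt (¬D (beforeD (old x) new ∧D beforeD new (old y)))

  module _ {E : ⊤ → Set} {S : OrderKind → Set} {k : ℕ} {step : ∀ i → Elts E i → Labs S i → U (proj₁ i) →
    Fin (suc k) → Fin (suc k)}
           (d : ∀ q q′ → Def (E ▹ tt) S (λ i η Θ → step i (λ _ x → η _ (old x)) Θ (η tt new) q ≡ q′)) where

    private
      K-finite = Fin-finite (suc k)

      label : {E′ : ⊤ → Set} (x : E′ tt) (q : Fin (suc k)) →
        Def E′ (S ▹ residue k) (λ i η Θ → Θ _ new (η tt x) ≡ q)
      label = labD new

    runD : ∀ q₀ q → Def E S (λ i η Θ → run (step i η Θ) q₀ (list i) ≡ q)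
    runD q₀ q = resp
      (λ i@(A , _) η Θ → mk⇔
        (λ (ℓ , f , n , l , e) → Run⇒run (U-finite A) (step i η Θ) (list-unique i) record
          { first = λ x min → sym (f x min _ refl) ; next = λ x y cov →
            sym (n x y cov _ refl _ refl) ; last = l
          ; empty = λ none → e λ x → none x (list-complete i x) })
        (λ { refl → let (ℓ , r) = run⇒Run (U-finite A) (step i η Θ) (list-unique i) in
           ℓ , (λ { x min _ refl → sym (Run.first r x min) }) ,
           (λ { x y cov _ refl _ refl → sym (Run.next r x y cov) }) , Run.last r ,
           λ none → Run.empty r λ x _ → none x }))
      (∃L (∀D tt (minimalD new ⇒D ⋀D K-finite λ p → label new p ⇒D along (λ _ → id) (λ _ → old) (d q₀ p))
        ∧D ∀D tt (∀D tt (coversD (old new) new ⇒D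
             ⋀D K-finite λ p → label (old new) p ⇒D ⋀D K-finite λ p′ → label new p′ ⇒D
               along (λ _ → λ { new → new ; (old x) → old (old x) }) (λ _ → old) (d p p′)))
        ∧D ∀D tt (maximalD new ⇒D label new q)
        -- Universally quantified falsity holds exactly on the empty universe, where the initial
        -- state has to be the final one.
        ∧D (∀D tt (constD (no id)) ⇒D constD (q₀ Fin.≟ q))))

  module _ {d : ℕ} (ρ : Residues d) where

    open Residues ρ

    run-sum : {A : Set} (f : A → ℕ) (a : ℕ) (xs : List A) →
              run (λ x q → ⌊ toℕ q + f x ⌋) ⌊ a ⌋ xs ≡ ⌊ a + sum (List.map f xs) ⌋
    run-sum f a []       = cong ⌊_⌋ (sym (ℕ.+-identityʳ a))
    run-sum f a (x ∷ xs) = trans (cong (λ q → run (λ x q → ⌊ toℕ q + f x ⌋) q xs) (⌊⌋-+ a (f x)))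
      (trans (run-sum f (a + f x) xs) (cong ⌊_⌋ (ℕ.+-assoc a (f x) _)))

    -- The automaton adds up the summands along the order in the quotient; of each summand only the
    -- class is needed, so it suffices that the class is definable.
    sumD : {f : ∀ i → Elts E i → Labs S i → U (proj₁ i) → ℕ} →
           (∀ r → Def (E ▹ tt) S (λ i η Θ → ⌊ f i (λ _ x → η _ (old x)) Θ (η tt new) ⌋ ≡ r)) →
           ∀ r → Def E S (λ i η Θ → ⌊ sum (List.map (f i η Θ) (list i)) ⌋ ≡ r)
    sumD {f = f} d r = resp (λ i η Θ → ≡-⇔ (run-sum (f i η Θ) 0 (list i)) refl)
      (runD {step = λ i η Θ x q → ⌊ toℕ q + f i η Θ x ⌋}
        (λ q q′ → resp (λ i η Θ → mk⇔
            (λ { (p , refl , e) → trans (sym (⌊+⌋ (toℕ q) _)) e })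
            (λ e → _ , refl , trans (⌊+⌋ (toℕ q) _) e))
          (⋁D (Fin-finite _) λ p → d p ∧D constD (⌊ toℕ q + toℕ p ⌋ Fin.≟ q′)))
        ⌊ 0 ⌋ r)
      where
      ⌊+⌋ : ∀ a b → ⌊ a + toℕ ⌊ b ⌋ ⌋ ≡ ⌊ a + b ⌋
      ⌊+⌋ a b = trans (cong ⌊_⌋ (ℕ.+-comm a _)) (trans (⌊⌋-+ b a) (cong ⌊_⌋ (ℕ.+-comm b a)))

    -- A run reads elements, not tuples. The residue of the number of completions of a fixed first
    -- entry is definable by recursion on the arity, and these residues are summed along the order,
    -- which nests one run for each position.
    countTuplesD : ∀ r {p : ∀ i → Elts E i → Labs S i → Vec (U (proj₁ i)) r → Bool} →
      (∀ {E′} (f : ∀ κ → E κ → E′ κ) (xs : Vec (E′ tt) r) →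
        Def E′ S (λ i η Θ → T (p i (λ κ x → η κ (f κ x)) Θ (Vec.map (η tt) xs)))) →
      ∀ q → Def E S (λ i η Θ → ⌊ count (p i η Θ) (tuples (list i) r) ⌋ ≡ q)
    countTuplesD zero {p} d q = resp
      (λ i η Θ → indicator (p i η Θ))
      ((d (λ _ → id) [] ∧D constD (⌊ 1 ⌋ Fin.≟ q)) ∨D (¬D (d (λ _ → id) []) ∧D constD (⌊ 0 ⌋ Fin.≟ q)))
      where
      indicator : {A : Set} (p : Vec A 0 → Bool) → ((T (p []) × ⌊ 1 ⌋ ≡ q) ⊎ (¬ T (p []) × ⌊ 0 ⌋ ≡ q)) ⇔
                                                   (⌊ count p ([] ∷ []) ⌋ ≡ q)
      indicator p with p []
      ... | true  = mk⇔ (λ { (inj₁ (_ , e)) → e ; (inj₂ (n , _)) → ⊥-elim (n tt) }) (λ e → inj₁ (tt , e))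
      ... | false = mk⇔ (λ { (inj₁ (() , _)) ; (inj₂ (_ , e)) → e }) (λ e → inj₂ (id , e))
    countTuplesD (suc r) {p} d q = resp
      (λ i η Θ → ≡-⇔ (cong ⌊_⌋ (sym (count-tuples (p i η Θ) (list i)))) refl)
      (sumD {f = λ i η Θ x → count (λ v → p i η Θ (x ∷ v)) (tuples (list i) r)}
        (countTuplesD r {λ i η Θ v → p i (λ _ x → η _ (old x)) Θ (η tt new ∷ v)}
          (λ f xs → d (λ κ x → f κ (old x)) (f tt new ∷ xs))) q)

  divD : ∀ k r {p : ∀ i → Elts E i → Labs S i → Vec (U (proj₁ i)) r → Bool} →
    (∀ {E′} (f : ∀ κ → E κ → E′ κ) (xs : Vec (E′ tt) r) →
      Def E′ S (λ i η Θ → T (p i (λ κ x → η κ (f κ x)) Θ (Vec.map (η tt) xs)))) →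
    Def E S (λ i@(A , _) η Θ → k ∣ count (p i η Θ) (tuples (elements (U-finite A)) r))
  divD k r {p} d = resp
    (λ i@(A , _) η Θ → ⌊⌋-∣ _ ⟩⇔⟨ mk⇔
      (subst (k ∣_) (sym (count-list-cong (U-finite A) (list-unique i) (list-complete i) (p i η Θ))))
      (subst (k ∣_) (count-list-cong (U-finite A) (list-unique i) (list-complete i) (p i η Θ))))
    (countTuplesD (residues k) r d ⌊ 0 ⌋)
    where
    open Residues (residues k)

  formulaD : (φ : Formula τ cmso n m) (xs : Vec (E tt) n) (Xs : Vec (S set) m) →
             Def E S (λ (A , _) η Θ → Sat A (Vec.map (η tt) xs) (Vec.map (Θ set) Xs) φ)
  formulaD (atom R ys) xs Xs = resp
    (λ (A , _) η Θ → T-≡ (cong (rel A R)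
      (trans (sym (Vec.map-∘ _ _ ys)) (Vec.map-cong (λ y → sym (Vec.lookup-map y (η tt) xs)) ys))))
    (relD R (Vec.map (lookup xs) ys))
  formulaD (x ≐ y) xs Xs = resp
    (λ _ η Θ → ≡-⇔ (sym (Vec.lookup-map x (η tt) xs)) (sym (Vec.lookup-map y (η tt) xs)))
    (≡D (lookup xs x) (lookup xs y))
  formulaD (x ∈̇ X) xs Xs = resp
    (λ _ η Θ → ⇔-sym T-true ⟩⇔⟨
      T-≡ (sym (trans (cong (λ Y → Y _) (Vec.lookup-map X (Θ set) Xs))
      (cong (Θ set (lookup Xs X)) (Vec.lookup-map x (η tt) xs)))))
    (labD (lookup Xs X) (lookup xs x) true)
  formulaD (¬̇ φ) xs Xs = ¬D (formulaD φ xs Xs)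
  formulaD (φ ∧̇ ψ) xs Xs = formulaD φ xs Xs ∧D formulaD ψ xs Xs
  formulaD (∃̇ φ) xs Xs = resp
    (λ (A , _) η Θ → Σ-⇔ λ a → mk⇔ (subst (λ ρ → Sat A (a ∷ ρ) _ φ) (sym (Vec.map-∘ _ _ xs)))
                                   (subst (λ ρ → Sat A (a ∷ ρ) _ φ) (Vec.map-∘ _ _ xs)))
    (∃D tt (formulaD φ (new ∷ Vec.map old xs) Xs))
  formulaD (∃̇ₛ φ) xs Xs = resp
    (λ (A , _) η Θ → Σ-⇔ λ a → mk⇔ (subst (λ ρ → Sat A _ (a ∷ ρ) φ) (sym (Vec.map-∘ _ _ Xs)))
                                   (subst (λ ρ → Sat A _ (a ∷ ρ) φ) (Vec.map-∘ _ _ Xs)))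
    (∃L (formulaD φ xs (new ∷ Vec.map old Xs)))
  formulaD (modRel k R) xs Xs = divD k (arity τ R) (λ f ys → relD R ys)
  formulaD (modSet k X) xs Xs = resp
    (λ i@(A , _) η Θ → mk⇔ (subst (k ∣_) (e i η Θ)) (subst (k ∣_) (sym (e i η Θ))))
    (divD k 1 {λ _ η Θ v → Θ set (lookup Xs X) (Vec.head v)}
      (λ { f (y ∷ []) → resp (λ _ _ _ → ⇔-sym T-true) (labD (lookup Xs X) y true) }))
    where
    e : ∀ (i : I) η Θ → _
    e i@(A , _) η Θ = trans (count-tuples₁ _ (elements (U-finite A)))
      (count-cong (λ x → T-≡ (cong (λ Y → Y x) (sym (Vec.lookup-map X (Θ set) Xs))))
        (elements (U-finite A)))

trivialOrder : (F : Finite A) → LinearOrder A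
trivialOrder F = listOrder F (unique F) (complete F)

-- With every order the sentence says of `A` just what `ψ` says, in which no order occurs; this
-- gives the invariance. For the converse some order must exist, and the enumeration of the universe
-- provides one.
cmso⇒order-invariant : (ψ : Sentence τ cmso) → Σ (Sentence (τ ⊕ orderVoc) mso) λ φ →
  OrderInvariant φ × ((A : Structure τ) → (A ⊨≤ φ) ⇔ (A ⊨ ψ))
cmso⇒order-invariant {τ} ψ =
  φ , (λ A o₁ o₂ → correct A o₁ ⟩⇔⟨ ⇔-sym (correct A o₂)) , λ A → mk⇔
    (λ (o , s) → to (correct A o) s)
    (λ s → trivialOrder (U-finite A) , from (correct A (trivialOrder (U-finite A))) s)
  where
  open OrderedCounting τ
  open Definability (orderedCoding τ)
  d : Def (λ _ → ⊥) (λ _ → ⊥) _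
  d = formulaD ψ [] []
  φ : Sentence (τ ⊕ orderVoc) mso
  φ = fm d (λ _ ()) (λ _ ())
  correct : (A : Structure τ) (o : LinearOrder (U A)) → (A ◃ o ⊨ φ) ⇔ (A ⊨ ψ)
  correct A o = sat d (A , o) {λ _ ()} {λ _ ()} (λ _ ()) (λ _ ()) [] [] record { elts = λ _ () ; labs =
    λ _ () }

-- States of pieces of a structure

-- Element variables are replaced by set variables for singletons: relₛ R Xs and
-- beforeₛ X Y say that some elements of the given sets are related (by R, by the
-- strict order), meetsₛ X Y that X and Y intersect.
data SetFormula (τ : Vocabulary) : ℕ → Set where
  relₛ            : (R : Symbol τ) → Vec (Fin m) (arity τ R) → SetFormula τ m
  beforeₛ meetsₛ  : Fin m → Fin m → SetFormula τ m
  ¬ₛ_             : SetFormula τ m → SetFormula τ m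
  _∧ₛ_            : SetFormula τ m → SetFormula τ m → SetFormula τ m
  ∃ₛ_             : SetFormula τ (suc m) → SetFormula τ m

-- A set meets itself iff it is nonempty, and it has two elements iff some element of it is before
-- another.
singletonₛ : Fin m → SetFormula τ m
singletonₛ X = meetsₛ X X ∧ₛ (¬ₛ beforeₛ X X)

toSetFormula : (Fin n → Fin j) → (Fin m → Fin j) → Formula (τ ⊕ orderVoc) mso n m → SetFormula τ j
toSetFormula e s (atom (inj₁ R) xs)            = relₛ R (Vec.map e xs)
toSetFormula e s (atom (inj₂ _) (x ∷ y ∷ []))  = ¬ₛ beforeₛ (e y) (e x)
toSetFormula e s (x ≐ y)                       = meetsₛ (e x) (e y)
toSetFormula e s (x ∈̇ X)                       = meetsₛ (e x) (s X)
toSetFormula e s (¬̇ φ)                         = ¬ₛ toSetFormula e s φ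
toSetFormula e s (φ ∧̇ ψ)                       = toSetFormula e s φ ∧ₛ toSetFormula e s ψ
toSetFormula e s (∃̇ φ)                         = ∃ₛ (singletonₛ zero ∧ₛ toSetFormula (ext e) (suc ∘ s) φ)
toSetFormula e s (∃̇ₛ φ)                        = ∃ₛ toSetFormula (suc ∘ e) (ext s) φ

T-comprehend : {A : Set} (F : Finite A) {P : A → Set} (P? : ∀ a → Dec (P a)) → ∀ a →
               T (mem F (comprehend F (λ a → does (P? a))) a) ⇔ P a
T-comprehend F P? a = T-≡ (mem-comprehend F _ a) ⟩⇔⟨ T-does (P? a)

Pow-≡ : {A : Set} (F : Finite A) {p q : Pow F} → (∀ a → T (mem F p a) ⇔ T (mem F q a)) → p ≡ q
Pow-≡ F h = Pow-ext F (λ a → T-ext (h a))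

module States (τ : Vocabulary) (k : ℕ) where

  Bits : Set
  Bits = Vec Bool k

  Bits-finite : Finite Bits
  Bits-finite = Vec-finite Bool-finite k

  -- A type in the sense of Hintikka, relative to the formula: for `∃ₛ` it is the set of all pairs
  -- of a trace on the sources and a state that some choice of a set realizes. The two further bits
  -- of `beforeₛ` tell whether the sets are nonempty on the piece, which is needed when pieces are
  -- put one after the other.
  State        : SetFormula τ m → Set
  State-finite : (φ : SetFormula τ m) → Finite (State φ)

  State (relₛ R Xs)   = Bool
  State (beforeₛ X Y) = Bool × Bool × Bool
  State (meetsₛ X Y)  = Bool
  State (¬ₛ φ)        = State φ
  State (φ ∧ₛ ψ)      = State φ × State ψ
  State (∃ₛ φ)        = Pow (×-finite Bits-finite (State-finite φ))

  State-finite (relₛ R Xs)   = Bool-finite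
  State-finite (beforeₛ X Y) = ×-finite Bool-finite (×-finite Bool-finite Bool-finite)
  State-finite (meetsₛ X Y)  = Bool-finite
  State-finite (¬ₛ φ)        = State-finite φ
  State-finite (φ ∧ₛ ψ)      = ×-finite (State-finite φ) (State-finite ψ)
  State-finite (∃ₛ φ)        = Pow-finite (×-finite Bits-finite (State-finite φ))

  Choices-finite : (φ : SetFormula τ m) → Finite (Bits × State φ)
  Choices-finite φ = ×-finite Bits-finite (State-finite φ)

  -- States do not see relations of arity 0, since no piece owns their tuples.
  Nullary : (A : Structure τ) → Symbol τ → Set
  Nullary A R = Σ (Vec (U A) (arity τ R)) λ xs → T (rel A R xs) × arity τ R ≡ 0

  accept : Structure τ → (φ : SetFormula τ m) → State φ → Set
  accept A (relₛ R Xs)   b = T b ⊎ Nullary A R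
  accept A (beforeₛ X Y) b = T (proj₁ b)
  accept A (meetsₛ X Y)  b = T b
  accept A (¬ₛ φ)        σ = ¬ accept A φ σ
  accept A (φ ∧ₛ ψ)      σ = accept A φ (proj₁ σ) × accept A ψ (proj₂ σ)
  -- The whole structure has no sources, so the trace of a set on them is immaterial and all `false`
  -- represents every choice.
  accept A (∃ₛ φ)        p = Σ (State φ) λ σ → T (mem (Choices-finite φ) p (replicate k false , σ)) ×
    accept A φ σ

  unit : (φ : SetFormula τ m) → State φ
  unit (relₛ R Xs)   = false
  unit (beforeₛ X Y) = false , false , false
  unit (meetsₛ X Y)  = false
  unit (¬ₛ φ)        = unit φ
  unit (φ ∧ₛ ψ)      = unit φ , unit ψ
  -- The empty piece may still have sources, so every trace `z` occurs.
  unit (∃ₛ φ)        = comprehend (Choices-finite φ) λ (z , σ) → does (finite-≟ (State-finite φ) σ (unit φ))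

  compose : (φ : SetFormula τ m) → State φ → State φ → State φ
  compose (relₛ R Xs)   b b′ = b ∨ b′
  compose (beforeₛ X Y) (b , x , y) (b′ , x′ , y′) = b ∨ b′ ∨ (x ∧ y′) , x ∨ x′ , y ∨ y′
  compose (meetsₛ X Y)  b b′ = b ∨ b′
  compose (¬ₛ φ)        σ σ′ = compose φ σ σ′
  compose (φ ∧ₛ ψ)      σ σ′ = compose φ (proj₁ σ) (proj₁ σ′) , compose ψ (proj₂ σ) (proj₂ σ′)
  -- The two pieces share their sources, hence the common trace `z`; on the owned elements, which
  -- are disjoint, the choices are independent.
  compose (∃ₛ φ)        p q  = comprehend (Choices-finite φ) λ (z , σ) → does (compose? z σ)
    where
    F = State-finite φ
    compose? : ∀ z σ → Dec (∃ λ σ₁ → ∃ λ σ₂ →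
      T (mem (Choices-finite φ) p (z , σ₁)) × T (mem (Choices-finite φ) q (z , σ₂)) × compose φ σ₁ σ₂ ≡ σ)
    compose? z σ = finite-any? F λ σ₁ → finite-any? F λ σ₂ → T? _ ×-dec T? _ ×-dec finite-≟ F _ _

  -- A piece of a structure: the elements that it owns, in order, and at most k
  -- sources through which it is attached to the rest. A set variable is
  -- assigned a set, of which only the owned elements matter, and, separately,
  -- the sources that it contains.
  module _ (A : Structure τ) where

    Sources Assignment : Set
    Sources    = Vec (Maybe (U A)) k
    Assignment = (U A → Bool) × Bits

    noSources : Sources
    noSources = replicate k nothing

    data Held (L : List (U A)) (s : Sources) (a : Assignment) (v : U A) : Set where
      owned   : v ∈ L → T (proj₁ a v) → Held L s a v
      sourced : ∀ i → lookup s i ≡ just v → T (lookup (proj₂ a) i) → Held L s a v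

    -- Only tuples with an owned entry count, so that the empty piece relates nothing. In the tree,
    -- a tuple inside the sources is counted higher up, where one of its entries is owned.
    Related : ∀ {r} → (Vec (U A) r → Bool) → List (U A) → Sources → Vec Assignment m → Vec (Fin m) r → Set
    Related {r = r} R L s Ξ Xs = Σ (Vec (U A) r) λ xs → T (R xs) ×
      (∀ i → Held L s (lookup Ξ (lookup Xs i)) (lookup xs i)) × ∃ λ i → lookup xs i ∈ L

    Meets : List (U A) → (U A → Bool) → (U A → Bool) → Set
    Meets L S S′ = ∃ λ v → v ∈ L × T (S v) × T (S′ v)

    Precedes : List (U A) → (U A → Bool) → (U A → Bool) → Set
    Precedes L S S′ = ∃ λ v → ∃ λ v′ → Before L v v′ × T (S v) × T (S′ v′)

    private
      F = U-finite A

    held? : ∀ L s a v → Dec (Held L s a v)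
    held? L s a v = map′ [ (λ (m , t) → owned m t) , (λ (i , e , t) → sourced i e t) ]′
      (λ { (owned m t) → inj₁ (m , t) ; (sourced i e t) → inj₂ (i , e , t) })
      ((∈-finite? F _ L ×-dec T? _) ⊎-dec finite-any? (Fin-finite k) λ i →
        Maybe.≡-dec (finite-≟ F) _ _ ×-dec T? _)

    abstract
      related? : ∀ {r} (R : Vec (U A) r → Bool) L s (Ξ : Vec Assignment m) (Xs : Vec (Fin m) r) →
        Dec (Related R L s Ξ Xs)
      related? {r = r} R L s Ξ Xs = finite-any? (Vec-finite F r) λ xs → T? _ ×-dec
        finite-all? (Fin-finite r) (λ i → held? L s (lookup Ξ (lookup Xs i)) (lookup xs i)) ×-dec
        finite-any? (Fin-finite r) λ i → ∈-finite? F _ L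

      meets? : ∀ L S S′ → Dec (Meets L S S′)
      meets? L S S′ = finite-any? F λ v → ∈-finite? F v L ×-dec T? _ ×-dec T? _

      precedes? : ∀ L S S′ → Dec (Precedes L S S′)
      precedes? L S S′ = finite-any? F λ v → finite-any? F λ v′ → before? F L v v′ ×-dec T? _ ×-dec T? _

    state : (φ : SetFormula τ m) → List (U A) → Sources → Vec Assignment m → State φ
    state (relₛ R Xs)   L s Ξ = does (related? (rel A R) L s Ξ Xs)
    state (beforeₛ X Y) L s Ξ = does (precedes? L (proj₁ (lookup Ξ X)) (proj₁ (lookup Ξ Y))) ,
      does (meets? L (proj₁ (lookup Ξ X)) (proj₁ (lookup Ξ X))) ,
        does (meets? L (proj₁ (lookup Ξ Y)) (proj₁ (lookup Ξ Y)))
    state (meetsₛ X Y)  L s Ξ = does (meets? L (proj₁ (lookup Ξ X)) (proj₁ (lookup Ξ Y)))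
    state (¬ₛ φ)        L s Ξ = state φ L s Ξ
    state (φ ∧ₛ ψ)      L s Ξ = state φ L s Ξ , state ψ L s Ξ
    state (∃ₛ φ)        L s Ξ = comprehend (Choices-finite φ) λ (z , σ) →
      does (finite-any? (Pow-finite F) λ S → finite-≟ (State-finite φ) (state φ L s ((mem F S , z) ∷ Ξ)) σ)

    record Same (L : List (U A)) (s : Sources) (a b : Assignment) : Set where
      constructor same
      field
        inside  : ∀ v → v ∈ L → proj₁ a v ≡ proj₁ b v
        through : ∀ i v → lookup s i ≡ just v → lookup (proj₂ a) i ≡ lookup (proj₂ b) i

    Same-sym : ∀ {L s a b} → Same L s a b → Same L s b a
    Same-sym (same f g) = same (λ v h → sym (f v h)) (λ i v h → sym (g i v h))

    Same-refl : ∀ {L s a} → Same L s a a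
    Same-refl = same (λ _ _ → refl) (λ _ _ _ → refl)

    SameAll : List (U A) → Sources → Vec Assignment m → Vec Assignment m → Set
    SameAll L s Ξ Ξ′ = ∀ X → Same L s (lookup Ξ X) (lookup Ξ′ X)

    SameAll-∷ : ∀ {L s a b} {Ξ Ξ′ : Vec Assignment m} → Same L s a b → SameAll L s Ξ Ξ′ →
      SameAll L s (a ∷ Ξ) (b ∷ Ξ′)
    SameAll-∷ h hs zero    = h
    SameAll-∷ h hs (suc X) = hs X

    module _ {L : List (U A)} {s : Sources} where

      Held-local : ∀ {a b} → Same L s a b → ∀ {v} → Held L s a v → Held L s b v
      Held-local (same f g) (owned m t)     = owned m (subst T (f _ m) t)
      Held-local (same f g) (sourced i e t) = sourced i e (subst T (g i _ e) t)

      Meets-local : ∀ {a a′ b b′} → Same L s a b → Same L s a′ b′ →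
                    Meets L (proj₁ a) (proj₁ a′) → Meets L (proj₁ b) (proj₁ b′)
      Meets-local (same f _) (same f′ _) (v , m , t , t′) = v , m , subst T (f v m) t , subst T (f′ v m) t′

      Precedes-local : ∀ {a a′ b b′} → Same L s a b → Same L s a′ b′ →
                       Precedes L (proj₁ a) (proj₁ a′) → Precedes L (proj₁ b) (proj₁ b′)
      Precedes-local (same f _) (same f′ _) (v , v′ , b , t , t′) =
        v , v′ , b , subst T (f v (Before-∈ˡ b)) t , subst T (f′ v′ (Before-∈ʳ b)) t′

    private
      rev : ∀ {L s} {Ξ Ξ′ : Vec Assignment m} → SameAll L s Ξ Ξ′ → SameAll L s Ξ′ Ξ
      rev {s = s} h X = Same-sym (h X)

    -- Assignments matter only on owned elements and at positions that hold a source. Sets may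
    -- therefore be altered elsewhere, which is how witnesses for different pieces are glued
    -- together.
    state-local : (φ : SetFormula τ m) → ∀ {L s Ξ Ξ′} → SameAll L s Ξ Ξ′ → state φ L s Ξ ≡ state φ L s Ξ′
    state-local (relₛ R Xs) {L} {s} {Ξ} {Ξ′} h = does-⇔ (mk⇔
        (λ (xs , r , held , o) → xs , r , (λ i → Held-local (h _) (held i)) , o)
        (λ (xs , r , held , o) → xs , r , (λ i → Held-local (rev {Ξ = Ξ} {Ξ′} h _) (held i)) , o))
      (related? (rel A R) L s Ξ Xs) (related? (rel A R) L s Ξ′ Xs)
    state-local (beforeₛ X Y) {L} {s} {Ξ} {Ξ′} h = cong₂ _,_
        (does-⇔ (mk⇔ (Precedes-local (h X) (h Y)) (Precedes-local (h′ X) (h′ Y))) (precedes? L _ _)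
          (precedes? L _ _))
        (cong₂ _,_ (meet X) (meet Y))
      where
      h′ = rev {Ξ = Ξ} {Ξ′} h
      meet : ∀ X → _
      meet X = does-⇔ (mk⇔ (Meets-local (h X) (h X)) (Meets-local (h′ X) (h′ X)))
        (meets? L (proj₁ (lookup Ξ X)) (proj₁ (lookup Ξ X)))
          (meets? L (proj₁ (lookup Ξ′ X)) (proj₁ (lookup Ξ′ X)))
    state-local (meetsₛ X Y) {L} {s} {Ξ} {Ξ′} h =
      does-⇔ (mk⇔ (Meets-local (h X) (h Y)) (Meets-local (h′ X) (h′ Y))) (meets? L _ _) (meets? L _ _)
      where h′ = rev {Ξ = Ξ} {Ξ′} h
    state-local (¬ₛ φ)   h = state-local φ h
    state-local (φ ∧ₛ ψ) h = cong₂ _,_ (state-local φ h) (state-local ψ h)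
    state-local (∃ₛ φ) {L} {s} {Ξ} {Ξ′} h = Pow-≡ (Choices-finite φ) λ (z , σ) →
      T-comprehend (Choices-finite φ) (λ (z , σ) → finite-any? (Pow-finite F) λ S →
        finite-≟ (State-finite φ) (state φ L s ((mem F S , z) ∷ Ξ)) σ) (z , σ)
      ⟩⇔⟨ Σ-⇔ (λ S → ≡-⇔ (state-local φ (SameAll-∷ Same-refl h)) refl) ⟩⇔⟨
      ⇔-sym (T-comprehend (Choices-finite φ) (λ (z , σ) → finite-any? (Pow-finite F) λ S →
        finite-≟ (State-finite φ) (state φ L s ((mem F S , z) ∷ Ξ′)) σ) (z , σ))

    ∈-state-∃ : (φ : SetFormula τ (suc m)) → ∀ L s Ξ z σ →
      T (mem (Choices-finite φ) (state (∃ₛ φ) L s Ξ) (z , σ)) ⇔ ∃ λ S → state φ L s ((S , z) ∷ Ξ) ≡ σ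
    ∈-state-∃ φ L s Ξ z σ = T-comprehend (Choices-finite φ)
      (λ (z , σ) → finite-any? (Pow-finite F) λ S →
        finite-≟ (State-finite φ) (state φ L s ((mem F S , z) ∷ Ξ)) σ) (z , σ)
      ⟩⇔⟨ mk⇔
      (λ (S , e) → mem F S , e)
      (λ (S , e) → comprehend F S ,
        trans (state-local φ (SameAll-∷ (same (λ v _ → mem-comprehend F S v) λ _ _ _ → refl)
        (λ X → Same-refl))) e)

    -- The separation property of a tree decomposition as seen from one piece: relations leave the
    -- piece only through its sources, and these are not owned by it.
    Closed Fresh : List (U A) → Sources → Set
    Closed L s = ∀ R xs → T (rel A R xs) → (∃ λ i → lookup xs i ∈ L) →
                 ∀ i → lookup xs i ∈ L ⊎ ∃ λ i′ → lookup s i′ ≡ just (lookup xs i)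
    Fresh L s = ∀ v i → v ∈ L → lookup s i ≢ just v

    unit-state : (φ : SetFormula τ m) → ∀ s Ξ → state φ [] s Ξ ≡ unit φ
    unit-state (relₛ R Xs) s Ξ = does-⇔ (mk⇔ (λ { (_ , _ , _ , _ , ()) }) (λ ()))
      (related? (rel A R) [] s Ξ Xs) (no id)
    unit-state (beforeₛ X Y) s Ξ = cong₂ _,_
      (does-⇔ (mk⇔ (λ { (_ , _ , () , _) }) (λ ()))
        (precedes? [] (proj₁ (lookup Ξ X)) (proj₁ (lookup Ξ Y))) (no id))
      (cong₂ _,_ (meet X) (meet Y))
      where
      meet : ∀ X → _
      meet X = does-⇔ (mk⇔ (λ { (_ , () , _) }) (λ ()))
        (meets? [] (proj₁ (lookup Ξ X)) (proj₁ (lookup Ξ X))) (no id)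
    unit-state (meetsₛ X Y) s Ξ =
      does-⇔ (mk⇔ (λ { (_ , () , _) }) (λ ())) (meets? [] (proj₁ (lookup Ξ X)) (proj₁ (lookup Ξ Y))) (no id)
    unit-state (¬ₛ φ)   s Ξ = unit-state φ s Ξ
    unit-state (φ ∧ₛ ψ) s Ξ = cong₂ _,_ (unit-state φ s Ξ) (unit-state ψ s Ξ)
    unit-state (∃ₛ φ)   s Ξ = Pow-≡ (Choices-finite φ) λ (z , σ) →
      ∈-state-∃ φ [] s Ξ z σ ⟩⇔⟨
      mk⇔ (λ (S , e) → trans (sym e) (unit-state φ s _)) (λ e → (λ _ → false) ,
        trans (unit-state φ s _) (sym e)) ⟩⇔⟨
      ⇔-sym (T-comprehend (Choices-finite φ) (λ (z , σ) → finite-≟ (State-finite φ) σ (unit φ)) (z , σ))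

    module _ {L₁ L₂ : List (U A)} {s : Sources}
             (c₁ : Closed L₁ s) (c₂ : Closed L₂ s) (f₁ : Fresh L₁ s) (f₂ : Fresh L₂ s)
             (disjoint : ∀ {v} → v ∈ L₁ → ¬ v ∈ L₂) where

      private
        Held-++ˡ : ∀ {a v} → Held L₁ s a v → Held (L₁ ++ L₂) s a v
        Held-++ˡ (owned m t)     = owned (∈-++⁺ˡ m) t
        Held-++ˡ (sourced i e t) = sourced i e t

        Held-++ʳ : ∀ {a v} → Held L₂ s a v → Held (L₁ ++ L₂) s a v
        Held-++ʳ (owned m t)     = owned (∈-++⁺ʳ L₁ m) t
        Held-++ʳ (sourced i e t) = sourced i e t

        Held-L₁ : ∀ {a v} → v ∈ L₁ ⊎ (∃ λ i → lookup s i ≡ just v) → Held (L₁ ++ L₂) s a v → Held L₁ s a v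
        Held-L₁ p                (sourced i e t) = sourced i e t
        Held-L₁ (inj₁ m₁)        (owned m t)     = owned m₁ t
        Held-L₁ (inj₂ (i , e))   (owned m t)     =
          [ (λ m₁ → owned m₁ t) , (λ m₂ → ⊥-elim (f₂ _ i m₂ e)) ]′ (∈-++⁻ L₁ m)

        Held-L₂ : ∀ {a v} → v ∈ L₂ ⊎ (∃ λ i → lookup s i ≡ just v) → Held (L₁ ++ L₂) s a v → Held L₂ s a v
        Held-L₂ p                (sourced i e t) = sourced i e t
        Held-L₂ (inj₁ m₂)        (owned m t)     = owned m₂ t
        Held-L₂ (inj₂ (i , e))   (owned m t)     =
          [ (λ m₁ → ⊥-elim (f₁ _ i m₁ e)) , (λ m₂ → owned m₂ t) ]′ (∈-++⁻ L₁ m)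

        Meets-++ : ∀ {S S′} → Meets (L₁ ++ L₂) S S′ ⇔ (Meets L₁ S S′ ⊎ Meets L₂ S S′)
        Meets-++ = mk⇔
          (λ (v , m , q) → [ (λ m₁ → inj₁ (v , m₁ , q)) , (λ m₂ → inj₂ (v , m₂ , q)) ]′ (∈-++⁻ L₁ m))
          (λ where (inj₁ (v , m , q)) → v , ∈-++⁺ˡ m , q
                   (inj₂ (v , m , q)) → v , ∈-++⁺ʳ L₁ m , q)

        meets-++ : ∀ S S′ → does (meets? (L₁ ++ L₂) S S′) ≡ does (meets? L₁ S S′) ∨ does (meets? L₂ S S′)
        meets-++ S S′ = does-⇔ Meets-++ (meets? (L₁ ++ L₂) S S′) (meets? L₁ S S′ ⊎-dec meets? L₂ S S′)

      -- By closedness a tuple that touches one piece lies in that piece and the sources, so no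
      -- relation links the two. Only the order does, and there every element of `L₁` precedes every
      -- element of `L₂`. Sets chosen for the two pieces are glued, which disjointness permits.
      compose-state : (φ : SetFormula τ m) → ∀ Ξ → state φ (L₁ ++ L₂) s Ξ ≡ compose φ (state φ L₁ s Ξ)
        (state φ L₂ s Ξ)
      compose-state (relₛ R Xs) Ξ = does-⇔ (mk⇔
          (λ (xs , r , held , i , m) → [
            (λ m₁ → inj₁ (xs , r , (λ j → Held-L₁ (c₁ R xs r (i , m₁) j) (held j)) , i , m₁)) ,
            (λ m₂ → inj₂ (xs , r , (λ j → Held-L₂ (c₂ R xs r (i , m₂) j) (held j)) , i , m₂)) ]′
              (∈-++⁻ L₁ m))
          (λ where
            (inj₁ (xs , r , held , i , m)) → xs , r , (λ j → Held-++ˡ (held j)) , i , ∈-++⁺ˡ m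
            (inj₂ (xs , r , held , i , m)) → xs , r , (λ j → Held-++ʳ (held j)) , i , ∈-++⁺ʳ L₁ m))
        (related? (rel A R) (L₁ ++ L₂) s Ξ Xs) (related? (rel A R) L₁ s Ξ Xs ⊎-dec related? (rel A R) L₂
          s Ξ Xs)
      compose-state (beforeₛ X Y) Ξ = cong₂ _,_
        (does-⇔ (mk⇔
            (λ (v , v′ , b , t , t′) → [ (λ b₁ → inj₁ (v , v′ , b₁ , t , t′)) ,
              [ (λ b₂ → inj₂ (inj₁ (v , v′ , b₂ , t , t′))) ,
              (λ (m , m′) → inj₂ (inj₂ ((v , m , t , t) , (v′ , m′ , t′ , t′)))) ]′ ]′
                (to (Before-++ L₁) b))
            (λ where
              (inj₁ (v , v′ , b , q)) → v , v′ , from (Before-++ L₁) (inj₁ b) , q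
              (inj₂ (inj₁ (v , v′ , b , q))) → v , v′ , from (Before-++ L₁) (inj₂ (inj₁ b)) , q
              (inj₂ (inj₂ ((v , m , t , _) , (v′ , m′ , t′ , _)))) → v , v′ ,
                from (Before-++ L₁) (inj₂ (inj₂ (m , m′))) , t , t′))
          (precedes? (L₁ ++ L₂) S S′)
          (precedes? L₁ S S′ ⊎-dec (precedes? L₂ S S′ ⊎-dec (meets? L₁ S S ×-dec meets? L₂ S′ S′))))
        (cong₂ _,_ (meets-++ S S) (meets-++ S′ S′))
        where
        S  = proj₁ (lookup Ξ X)
        S′ = proj₁ (lookup Ξ Y)
      compose-state (meetsₛ X Y) Ξ = meets-++ (proj₁ (lookup Ξ X)) (proj₁ (lookup Ξ Y))
      compose-state (¬ₛ φ)   Ξ = compose-state φ Ξ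
      compose-state (φ ∧ₛ ψ) Ξ = cong₂ _,_ (compose-state φ Ξ) (compose-state ψ Ξ)
      compose-state (∃ₛ φ)   Ξ = Pow-≡ (Choices-finite φ) λ (z , σ) →
        ∈-state-∃ φ (L₁ ++ L₂) s Ξ z σ ⟩⇔⟨ mk⇔
          (λ (S , e) → _ , _ , from (∈-state-∃ φ L₁ s Ξ z _) (S , refl) ,
            from (∈-state-∃ φ L₂ s Ξ z _) (S , refl) ,
            trans (sym (compose-state φ ((S , z) ∷ Ξ))) e)
          (λ (σ₁ , σ₂ , m₁ , m₂ , e) →
            let (S₁ , e₁) = to (∈-state-∃ φ L₁ s Ξ z σ₁) m₁
                (S₂ , e₂) = to (∈-state-∃ φ L₂ s Ξ z σ₂) m₂
            in glue S₁ S₂ , trans (compose-state φ ((glue S₁ S₂ , z) ∷ Ξ)) (trans (cong₂ (compose φ)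
                 (trans (state-local φ (SameAll-∷ (same (glue-L₁ S₁ S₂) λ _ _ _ → refl)
                   (λ X → Same-refl))) e₁)
                 (trans (state-local φ (SameAll-∷ (same (glue-L₂ S₁ S₂) λ _ _ _ → refl)
                   (λ X → Same-refl))) e₂)) e))
        ⟩⇔⟨ ⇔-sym (T-comprehend (Choices-finite φ) (λ (z , σ) →
          finite-any? (State-finite φ) λ σ₁ → finite-any? (State-finite φ) λ σ₂ →
          T? (mem (Choices-finite φ) (state (∃ₛ φ) L₁ s Ξ) (z , σ₁)) ×-dec T?
            (mem (Choices-finite φ) (state (∃ₛ φ) L₂ s Ξ) (z , σ₂)) ×-dec
          finite-≟ (State-finite φ) (compose φ σ₁ σ₂) σ) (z , σ))
        where
        pick : ∀ {v} → Dec (v ∈ L₁) → Bool → Bool → Bool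
        pick (yes _) b b′ = b
        pick (no _)  b b′ = b′
        glue : (U A → Bool) → (U A → Bool) → U A → Bool
        glue S₁ S₂ v = pick (∈-finite? F v L₁) (S₁ v) (S₂ v)
        glue-L₁ : ∀ S₁ S₂ v → v ∈ L₁ → glue S₁ S₂ v ≡ S₁ v
        glue-L₁ S₁ S₂ v m with ∈-finite? F v L₁
        ... | yes _ = refl
        ... | no ∉  = ⊥-elim (∉ m)
        glue-L₂ : ∀ S₁ S₂ v → v ∈ L₂ → glue S₁ S₂ v ≡ S₂ v
        glue-L₂ S₁ S₂ v m with ∈-finite? F v L₁
        ... | yes m₁ = ⊥-elim (disjoint m₁ m)
        ... | no _   = refl

    module _ {C : Set} (f : C → List (U A)) {s : Sources} where

      Closed-concatMap : ∀ {cs} → (∀ c → c ∈ cs → Closed (f c) s) → Closed (concatMap f cs) s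
      Closed-concatMap h R xs r (i , m) j =
        let (c , c∈ , m′) = to (∈-concatMap {f = f}) m in
        [ (λ m″ → inj₁ (from ∈-concatMap (c , c∈ , m″))) , inj₂ ]′ (h c c∈ R xs r (i , m′) j)

      Fresh-concatMap : ∀ {cs} → (∀ c → c ∈ cs → Fresh (f c) s) → Fresh (concatMap f cs) s
      Fresh-concatMap h v i m = let (c , c∈ , m′) = to (∈-concatMap {f = f}) m in h c c∈ v i m′

      state-concatMap : (φ : SetFormula τ m) → ∀ Ξ {cs} → Unique cs →
        (∀ c → c ∈ cs → Closed (f c) s) → (∀ c → c ∈ cs → Fresh (f c) s) →
        (∀ {c c′ v} → c ∈ cs → c′ ∈ cs → v ∈ f c → v ∈ f c′ → c ≡ c′) →
        state φ (concatMap f cs) s Ξ ≡ foldr (λ c → compose φ (state φ (f c) s Ξ)) (unit φ) cs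
      state-concatMap φ Ξ {[]}     u        hc hf hd = unit-state φ s Ξ
      state-concatMap φ Ξ {c ∷ cs} (c∉ ∷ u) hc hf hd = trans
        (compose-state (hc c (here refl)) (Closed-concatMap (λ c m → hc c (there m)))
          (hf c (here refl)) (Fresh-concatMap (λ c m → hf c (there m)))
          (λ m m′ → let (c′ , c′∈ , m″) = to (∈-concatMap {f = f}) m′ in
            All.lookup c∉ c′∈ (hd (here refl) (there c′∈) m m″))
          φ Ξ)
        (cong (compose φ (state φ (f c) s Ξ)) (state-concatMap φ Ξ u (λ c m → hc c (there m)) (λ c m →
          hf c (there m))
          (λ m m′ → hd (there m) (there m′))))

  fold-const : {C : Set} (φ : SetFormula τ m) (σ : State φ) (g : C → State φ) (cs : List C) →
    (∀ c → c ∈ cs → g c ≡ σ) → ∀ x → foldr (λ c → compose φ (g c)) x cs ≡ iter (compose φ σ) (length cs) x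
  fold-const φ σ g []       h x = refl
  fold-const φ σ g (c ∷ cs) h x =
    cong₂ (compose φ) (h c (here refl)) (fold-const φ σ g cs (λ c m → h c (there m)) x)

  -- The state of a union of pieces of which n σ have state σ, sorted by state.
  sortedState : (φ : SetFormula τ m) → (State φ → ℕ) → List (State φ) → State φ
  sortedState φ n = foldr (λ σ → iter (compose φ σ) (n σ)) (unit φ)

  -- Within a class all factors coincide and the fold is an iterate. What remains of the pieces is
  -- the size of each class, a number that CMSO can examine.
  fold-sorted : {C : Set} (φ : SetFormula τ m) (g : C → State φ) (cls : State φ → List C) →
    (∀ σ c → c ∈ cls σ → g c ≡ σ) → ∀ σs →
    foldr (λ c → compose φ (g c)) (unit φ) (concatMap cls σs) ≡ sortedState φ (length ∘ cls) σs
  fold-sorted φ g cls h []       = refl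
  fold-sorted φ g cls h (σ ∷ σs) = trans (foldr-++ _ _ (cls σ) _)
    (trans (fold-const φ σ g (cls σ) (h σ) _)
      (cong (iter (compose φ σ) (length (cls σ))) (fold-sorted φ g cls h σs)))

  module _ (A : Structure τ) {L : List (U A)} (u : Unique L) (c : ∀ x → x ∈ L) where

    private
      o = listOrder (U-finite A) u c

    Represents : Vec (U A) n → Vec (U A → Bool) m → Vec (Assignment A) j → (Fin n → Fin j) →
      (Fin m → Fin j) → Set
    Represents ρ Ξ Ψ e s = (∀ x v → T (proj₁ (lookup Ψ (e x)) v) ⇔ (v ≡ lookup ρ x)) ×
                           (∀ X v → proj₁ (lookup Ψ (s X)) v ≡ lookup Ξ X v)

    private
      nothing≢just : ∀ {i v} → lookup (noSources A) i ≢ just v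
      nothing≢just {i} e with trans (sym (Vec.lookup-replicate i nothing)) e
      ... | ()

      Meets-singleton : ∀ {S S′ a} → (∀ v → T (S v) ⇔ (v ≡ a)) → Meets A L S S′ ⇔ T (S′ a)
      Meets-singleton h = mk⇔ (λ (v , _ , t , t′) → subst _ (to (h v) t) t′)
                              (λ t → _ , c _ , from (h _) refl , t)

      Held⇔ : ∀ {a v} → Held A L (noSources A) a v ⇔ T (proj₁ a v)
      Held⇔ = mk⇔ (λ { (owned _ t) → t ; (sourced i e _) → ⊥-elim (nothing≢just e) }) (λ t → owned (c _) t)

      singleton⇔ : ∀ {S} → (Meets A L S S × ¬ Precedes A L S S) ⇔ (∃ λ a → ∀ v → T (S v) ⇔ (v ≡ a))
      singleton⇔ = mk⇔
        (λ ((a , _ , t , _) , ¬b) → a , λ v → mk⇔ (λ t′ → single ¬b t t′ (Before-connex (c v) (c a)))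
          (λ { refl → t }))
        (λ (a , h) → (a , c a , from (h a) refl , from (h a) refl) , λ (v , v′ , b , t , t′) →
          Before-irrefl u (subst (Before L v) (trans (to (h v′) t′) (sym (to (h v) t))) b))
        where
        single : ∀ {S v a} → ¬ Precedes A L S S → T (S a) → T (S v) → v ≡ a ⊎ Before L v a ⊎
          Before L a v → v ≡ a
        single ¬b t t′ (inj₁ e)        = e
        single ¬b t t′ (inj₂ (inj₁ b)) = ⊥-elim (¬b (_ , _ , b , t′ , t))
        single ¬b t t′ (inj₂ (inj₂ b)) = ⊥-elim (¬b (_ , _ , b , t , t′))

    singleton-state⇔ : ∀ (Ψ : Vec (Assignment A) m) X →
      accept A (singletonₛ X) (state A (singletonₛ X) L (noSources A) Ψ) ⇔
      (∃ λ a → ∀ v → T (proj₁ (lookup Ψ X) v) ⇔ (v ≡ a))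
    singleton-state⇔ Ψ X =
      (T-does (meets? A L S S) ×-⇔ ¬-⇔ (T-does (precedes? A L S S))) ⟩⇔⟨ singleton⇔
      where S = proj₁ (lookup Ψ X)

    -- The whole structure is treated as a single piece that owns every element and has no sources.
    -- Element variables are represented by singletons, and only sets passing `singletonₛ` stand for
    -- elements.
    toSetFormula-correct : (φ : Formula (τ ⊕ orderVoc) mso n m) (e : Fin n → Fin j) (s : Fin m → Fin j) →
      ∀ ρ Ξ Ψ → Represents ρ Ξ Ψ e s →
      Sat (A ◃ o) ρ Ξ φ ⇔ accept A (toSetFormula e s φ) (state A (toSetFormula e s φ) L (noSources A) Ψ)
    toSetFormula-correct (atom (inj₁ R) xs) e s ρ Ξ Ψ (he , hs) = mk⇔
        (λ t → [ (λ o → inj₁ (from rel⇔ (Vec.map (lookup ρ) xs , t ,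
            (λ i → from Held⇔ (subst (λ X → T (proj₁ (lookup Ψ X) _)) (sym (Vec.lookup-map i e xs))
              (from (he _ _) (Vec.lookup-map i (lookup ρ) xs)))) , o))) ,
          (λ z → inj₂ (_ , t , z)) ]′ (inhabited? (Vec.map (lookup ρ) xs)))
        [ (λ b → let (ys , t , held , _) = to rel⇔ b in subst (T ∘ rel A R) (vec-ext {v = ys} λ i →
            trans (to (he _ _) (subst (λ X → T (proj₁ (lookup Ψ X) (lookup ys i)))
              (Vec.lookup-map i e xs) (to Held⇔ (held i))))
                  (sym (Vec.lookup-map i (lookup ρ) xs))) t) ,
          (λ (ys , t , z) → subst (T ∘ rel A R) (vec-ext λ i → ⊥-elim (no-index (subst Fin z i))) t) ]′
      where
      rel⇔ = T-does (related? A (rel A R) L (noSources A) Ψ (Vec.map e xs))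
      -- A tuple with at least one entry has an owned entry because `L` contains everything; only
      -- the empty tuple is left to `Nullary`.
      inhabited? : ∀ {r} (xs : Vec (U A) r) → (∃ λ i → lookup xs i ∈ L) ⊎ r ≡ 0
      inhabited? []      = inj₂ refl
      inhabited? (x ∷ _) = inj₁ (zero , c x)
      no-index : ¬ Fin 0
      no-index ()
    toSetFormula-correct (atom (inj₂ _) (x ∷ y ∷ [])) e s ρ Ξ Ψ (he , hs) =
      le-listOrder (U-finite A) u c ⟩⇔⟨
      ¬-⇔ (mk⇔ (λ b → _ , _ , b , from (he y _) refl , from (he x _) refl)
               (λ { (v , v′ , b , t , t′) → subst₂′ (to (he y v) t) (to (he x v′) t′) b })) ⟩⇔⟨
      ¬-⇔ (⇔-sym (T-does (precedes? A L (proj₁ (lookup Ψ (e y))) (proj₁ (lookup Ψ (e x))))))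
      where
      subst₂′ : ∀ {v v′ a a′} → v ≡ a → v′ ≡ a′ → Before L v v′ → Before L a a′
      subst₂′ refl refl b = b
    toSetFormula-correct (x ≐ y) e s ρ Ξ Ψ (he , hs) =
      ⇔-sym (T-does (meets? A L (proj₁ (lookup Ψ (e x))) (proj₁ (lookup Ψ (e y)))) ⟩⇔⟨
        Meets-singleton (he x) ⟩⇔⟨ he y _)
    toSetFormula-correct (x ∈̇ X) e s ρ Ξ Ψ (he , hs) =
      ⇔-sym (T-does (meets? A L (proj₁ (lookup Ψ (e x))) (proj₁ (lookup Ψ (s X)))) ⟩⇔⟨
        Meets-singleton (he x) ⟩⇔⟨ T-≡ (hs X _))
    toSetFormula-correct (¬̇ φ) e s ρ Ξ Ψ h = ¬-⇔ (toSetFormula-correct φ e s ρ Ξ Ψ h)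
    toSetFormula-correct (φ ∧̇ ψ) e s ρ Ξ Ψ h =
      toSetFormula-correct φ e s ρ Ξ Ψ h ×-⇔ toSetFormula-correct ψ e s ρ Ξ Ψ h
    toSetFormula-correct {j = j} (∃̇ φ) e s ρ Ξ Ψ (he , hs) = mk⇔
      (λ (a , h) →
        let S = λ v → does (finite-≟ (U-finite A) v a)
            Ψ′ = (S , replicate k false) ∷ Ψ
            hS = λ v → T-does (finite-≟ (U-finite A) v a)
        in _ , from (∈-state-∃ A φ′ L (noSources A) Ψ (replicate k false) _) (S , refl) ,
           (from (singleton-state⇔ Ψ′ zero) (a , hS) ,
           to (toSetFormula-correct φ (ext e) (suc ∘ s) (a ∷ ρ) Ξ Ψ′
             ((λ { zero → hS ; (suc x) → he x }) , hs)) h))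
      (λ (σ , m , (acc , acc′)) → go σ (to (∈-state-∃ A φ′ L (noSources A) Ψ (replicate k false) σ) m)
        acc acc′)
      where
      φ′ = singletonₛ zero ∧ₛ toSetFormula (ext e) (suc ∘ s) φ
      go : ∀ σ → (∃ λ S → state A φ′ L (noSources A) ((S , replicate k false) ∷ Ψ) ≡ σ) →
           accept A (singletonₛ {suc j} zero) (proj₁ σ) → accept A (toSetFormula (ext e) (suc ∘ s) φ)
             (proj₂ σ) →
           Σ (U A) λ a → Sat (A ◃ o) (a ∷ ρ) Ξ φ
      go σ (S , refl) acc acc′ =
        let Ψ′ = (S , replicate k false) ∷ Ψ
            (a , hS) = to (singleton-state⇔ Ψ′ zero) acc
        in a , from (toSetFormula-correct φ (ext e) (suc ∘ s) (a ∷ ρ) Ξ Ψ′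
          ((λ { zero → hS ; (suc x) → he x }) , hs)) acc′
    toSetFormula-correct (∃̇ₛ φ) e s ρ Ξ Ψ (he , hs) = mk⇔
      (λ (S , h) → _ , from (∈-state-∃ A φ′ L (noSources A) Ψ (replicate k false) _) (S , refl) ,
         to (toSetFormula-correct φ (suc ∘ e) (ext s) ρ (S ∷ Ξ) ((S , replicate k false) ∷ Ψ)
           (he , hs′ S)) h)
      (λ (σ , m , acc) → go σ (to (∈-state-∃ A φ′ L (noSources A) Ψ (replicate k false) σ) m) acc)
      where
      φ′ = toSetFormula (suc ∘ e) (ext s) φ
      hs′ : ∀ S X v → proj₁ (lookup ((S , replicate k false) ∷ Ψ) (ext s X)) v ≡ lookup (S ∷ Ξ) X v
      hs′ S zero    v = refl
      hs′ S (suc X) v = hs X v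
      go : ∀ σ → (∃ λ S → state A φ′ L (noSources A) ((S , replicate k false) ∷ Ψ) ≡ σ) → accept A φ′ σ →
           Σ (U A → Bool) λ S → Sat (A ◃ o) ρ (S ∷ Ξ) φ
      go σ (S , refl) acc =
        S , from (toSetFormula-correct φ (suc ∘ e) (ext s) ρ (S ∷ Ξ) ((S , replicate k false) ∷ Ψ)
          (he , hs′ S)) acc

-- Trees and ordered tree extensions

pad : ∀ k → List A → Vec (Maybe A) k
pad zero    xs       = []
pad (suc k) []       = nothing ∷ pad k []
pad (suc k) (x ∷ xs) = just x ∷ pad k xs

-- If xs has no repetitions, From xs n v says that v is at position n or later.
At From : List A → ℕ → A → Set
At []       n       v = ⊥
At (x ∷ xs) zero    v = x ≡ v
At (x ∷ xs) (suc n) v = At xs n v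

From xs zero    v = v ∈ xs
From xs (suc n) v = ∃ λ u → Before xs u v × From xs n u

At-∈ : ∀ {xs : List A} {n v} → At xs n v → v ∈ xs
At-∈ {xs = x ∷ xs} {zero}  e = here (sym e)
At-∈ {xs = x ∷ xs} {suc n} h = there (At-∈ {xs = xs} h)

∈-At : ∀ {xs : List A} {v} → v ∈ xs → ∃ λ n → n < length xs × At xs n v
∈-At (here refl) = 0 , s≤s z≤n , refl
∈-At (there m)   = let (n , n< , h) = ∈-At m in suc n , s≤s n< , h

At-injective : ∀ {xs : List A} → Unique xs → ∀ {n n′ v} → At xs n v → At xs n′ v → n ≡ n′
At-injective (x∉ ∷ u) {zero}  {zero}   e h = refl
At-injective {xs = x ∷ xs} (x∉ ∷ u) {zero}  {suc n′} e h = ⊥-elim (All.lookup x∉ (At-∈ {xs = xs} h) e)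
At-injective {xs = x ∷ xs} (x∉ ∷ u) {suc n} {zero}   h e = ⊥-elim (All.lookup x∉ (At-∈ {xs = xs} h) e)
At-injective (x∉ ∷ u) {suc n} {suc n′} h h′ = cong suc (At-injective u h h′)

From-∈ : ∀ {xs : List A} n {v} → From xs n v → v ∈ xs
From-∈ zero    m           = m
From-∈ (suc n) (u , b , _) = Before-∈ʳ b

From-∷⁺ : ∀ {x : A} {xs} n {v} → From xs n v → From (x ∷ xs) (suc n) v
From-∷⁺ zero    m           = _ , inj₁ (refl , m) , here refl
From-∷⁺ (suc n) (u , b , h) = u , inj₂ b , From-∷⁺ n h

From-∷⁻ : ∀ {x : A} {xs} → Unique (x ∷ xs) → ∀ n {v} → From (x ∷ xs) (suc n) v → From xs n v
From-∷⁻ u zero    (_ , inj₁ (_ , m) , _) = m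
From-∷⁻ u zero    (_ , inj₂ b , _)       = Before-∈ʳ b
From-∷⁻ (x∉ ∷ u) (suc n) (_ , inj₁ (refl , _) , h) =
  ⊥-elim (All.lookup x∉ (From-∈ n (From-∷⁻ (x∉ ∷ u) n h)) refl)
From-∷⁻ u (suc n) (w , inj₂ b , h)       = w , b , From-∷⁻ u n h

-- `From` unfolds to nested existential quantifiers over the strict order and is thus definable;
-- exact positions are obtained as differences of two such conditions.
At⇔From : ∀ {xs : List A} → Unique xs → ∀ n {v} → At xs n v ⇔ (From xs n v × ¬ From xs (suc n) v)
At⇔From u n = mk⇔ (λ h → at-from n h , at-¬from u n h) (λ (h , ¬h) → from-at u n h ¬h)
  where
  at-from : ∀ {xs : List A} n {v} → At xs n v → From xs n v
  at-from {xs = x ∷ xs} zero    e = here (sym e)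
  at-from {xs = x ∷ xs} (suc n) h = From-∷⁺ n (at-from n h)
  at-¬from : ∀ {xs : List A} → Unique xs → ∀ n {v} → At xs n v → ¬ From xs (suc n) v
  at-¬from (x∉ ∷ u) zero    refl h = All.lookup x∉ (From-∷⁻ (x∉ ∷ u) 0 h) refl
  at-¬from (x∉ ∷ u) (suc n) h h′   = at-¬from u n h (From-∷⁻ (x∉ ∷ u) (suc n) h′)
  from-at : ∀ {xs : List A} → Unique xs → ∀ n {v} → From xs n v → ¬ From xs (suc n) v → At xs n v
  from-at u        zero    (here refl) ¬h = refl
  from-at u        zero    (there m)   ¬h = ⊥-elim (¬h (_ , inj₁ (refl , m) , here refl))
  from-at {xs = []} u (suc n) (_ , () , _)
  from-at {xs = x ∷ xs} (x∉ ∷ u) (suc n) h ¬h = from-at u n (From-∷⁻ (x∉ ∷ u) n h) (¬h ∘ From-∷⁺ (suc n))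

lookup-pad : ∀ k (xs : List A) i {v} → (lookup (pad k xs) i ≡ just v) ⇔ At xs (toℕ i) v
lookup-pad (suc k) []       zero    = mk⇔ (λ ()) (λ ())
lookup-pad (suc k) []       (suc i) = lookup-pad k [] i
lookup-pad (suc k) (x ∷ xs) zero    = mk⇔ (λ { refl → refl }) (cong just)
lookup-pad (suc k) (x ∷ xs) (suc i) = lookup-pad k xs i

∈-pad : ∀ {k} {xs : List A} → length xs ≤ k → ∀ {v} → (∃ λ i → lookup (pad k xs) i ≡ just v) ⇔ v ∈ xs
∈-pad {k = k} {xs} l = mk⇔
  (λ (i , e) → At-∈ (to (lookup-pad k xs i) e))
  (λ m → let (n , n< , h) = ∈-At m ; n<k = ℕ.≤-trans n< l in
    fromℕ< n<k , from (lookup-pad k xs _) (subst (λ a → At xs a _) (sym (Fin.toℕ-fromℕ< n<k)) h))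

concatMap-cong-∈ : {f g : A → List X} (xs : List A) → (∀ x → x ∈ xs → f x ≡ g x) →
  concatMap f xs ≡ concatMap g xs
concatMap-cong-∈ []       h = refl
concatMap-cong-∈ (x ∷ xs) h = cong₂ _++_ (h x (here refl)) (concatMap-cong-∈ xs (λ x m → h x (there m)))

filterᵇ-cong : {p q : A → Bool} → (∀ x → T (p x) ⇔ T (q x)) → (xs : List A) → filterᵇ p xs ≡ filterᵇ q xs
filterᵇ-cong {p = p} {q} h = filter-≐ (T? ∘ p) (T? ∘ q) ((λ {x} → to (h x)) , (λ {x} → from (h x)))

module TreeFacts (𝒯 : RootedTree) where

  infix 4 _↝_

  _↝_ : V 𝒯 → V 𝒯 → Set
  t ↝ u = T (edge 𝒯 t u)

  Below : V 𝒯 → V 𝒯 → Set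
  Below = Star _↝_

  private
    -- Uniqueness of walks is exploited through the vertices passed: two walks from the root to the
    -- same vertex yield equal lists, and comparing their last or first differing entries identifies
    -- parents or siblings.
    targets sources : ∀ {t u} → Below t u → List (V 𝒯)
    targets ε                   = []
    targets (_◅_ {j = c} e s)   = c ∷ targets s
    sources ε                   = []
    sources (_◅_ {i = t} e s)   = t ∷ sources s

    targets-◅◅ : ∀ {t u w} (p : Below t u) (q : Below u w) → targets (p ◅◅ q) ≡ targets p ++ targets q
    targets-◅◅ ε       q = refl
    targets-◅◅ (e ◅ p) q = cong (_ ∷_) (targets-◅◅ p q)

    sources-◅◅ : ∀ {t u w} (p : Below t u) (q : Below u w) → sources (p ◅◅ q) ≡ sources p ++ sources q
    sources-◅◅ ε       q = refl
    sources-◅◅ (e ◅ p) q = cong (_ ∷_) (sources-◅◅ p q)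

  parent-unique : ∀ {t t′ c} → t ↝ c → t′ ↝ c → t ≡ t′
  parent-unique {t} {t′} e e′ = proj₂ (∷ʳ-injective _ _
    (trans (sym (sources-◅◅ (walk 𝒯 t) (e ◅ ε)))
      (trans (cong sources (walk-unique 𝒯 _ _)) (sources-◅◅ (walk 𝒯 t′) (e′ ◅ ε)))))

  children-disjoint : ∀ {t c c′ d} → t ↝ c → t ↝ c′ → Below c d → Below c′ d → c ≡ c′
  children-disjoint {t} e e′ p p′ = ∷-injectiveˡ (++-cancelˡ (targets (walk 𝒯 t)) _ _
    (trans (sym (targets-◅◅ (walk 𝒯 t) (e ◅ p)))
      (trans (cong targets (walk-unique 𝒯 _ _)) (targets-◅◅ (walk 𝒯 t) (e′ ◅ p′)))))

  depth : V 𝒯 → ℕ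
  depth t = length (targets (walk 𝒯 t))

  depth-child : ∀ {t c} → t ↝ c → depth c ≡ suc (depth t)
  depth-child {t} {c} e = trans
    (cong (length ∘ targets) (walk-unique 𝒯 (walk 𝒯 c) (walk 𝒯 t ◅◅ (e ◅ ε))))
    (trans (cong length (targets-◅◅ (walk 𝒯 t) (e ◅ ε)))
      (trans (length-++ (targets (walk 𝒯 t))) (ℕ.+-comm _ 1)))

  Below-depth : ∀ {t d} → Below t d → depth t ≤ depth d
  Below-depth ε       = ℕ.≤-refl
  Below-depth (e ◅ p) = ℕ.≤-trans (ℕ.≤-trans (ℕ.n≤1+n _) (ℕ.≤-reflexive (sym (depth-child e))))
    (Below-depth p)

  no-cycle : ∀ {t c} → t ↝ c → ¬ Below c t
  no-cycle e p = ℕ.<-irrefl refl (ℕ.≤-trans (ℕ.≤-reflexive (sym (depth-child e))) (Below-depth p))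

  Below-antisym : ∀ {t u} → Below t u → Below u t → t ≡ u
  Below-antisym ε       q = refl
  Below-antisym (e ◅ p) q = ⊥-elim (no-cycle e (p ◅◅ q))

  last-step : ∀ {t d} → Below t d → t ≡ d ⊎ ∃ λ p → Below t p × p ↝ d
  last-step ε       = inj₁ refl
  last-step (e ◅ p) with last-step p
  ... | inj₁ refl         = inj₂ (_ , ε , e)
  ... | inj₂ (q , p′ , f) = inj₂ (q , e ◅ p′ , f)

  root-no-parent : ∀ {t} → ¬ t ↝ root 𝒯
  root-no-parent {t} e = no-cycle e (walk 𝒯 t)

  private
    maxDepth : ℕ
    maxDepth = max 0 (List.map depth (elements (V-finite 𝒯)))

    depth≤ : ∀ t → depth t ≤ maxDepth
    depth≤ t = All.lookup (xs≤max 0 (List.map depth (elements (V-finite 𝒯))))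
      (∈-map⁺ depth (complete (V-finite 𝒯) t))

    deeper : ∀ {t c n} → t ↝ c → maxDepth < depth t + suc n → maxDepth < depth c + n
    deeper {t} {n = n} e h =
      subst (maxDepth <_) (trans (ℕ.+-suc (depth t) n) (cong (_+ n) (sym (depth-child e)))) h

  induction : {P : V 𝒯 → Set} → (∀ t → (∀ c → t ↝ c → P c) → P t) → ∀ t → P t
  induction {P} step t = go (suc maxDepth) t (ℕ.m≤n⇒m≤o+n (depth t) ℕ.≤-refl)
    where
    go : ∀ n t → maxDepth < depth t + n → P t
    go zero    t h = ⊥-elim
      (ℕ.<-irrefl refl (ℕ.≤-trans (subst (maxDepth <_) (ℕ.+-identityʳ _) h) (depth≤ t)))
    go (suc n) t h = step t λ c e → go n c (deeper e h)

  -- Recursion from the leaves by iterating `step`. As `step` looks only at the children, the value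
  -- at a vertex is stable once the number of rounds exceeds the remaining depth, so the starting
  -- value `b` has no influence on the result.
  module Recursion {B : Set} (b : B) (step : V 𝒯 → (V 𝒯 → B) → B)
                   (step-cong : ∀ t f g → (∀ c → t ↝ c → f c ≡ g c) → step t f ≡ step t g) where

    private
      approx : ℕ → V 𝒯 → B
      approx zero    t = b
      approx (suc n) t = step t (approx n)

      approx-stable : ∀ n n′ t → maxDepth < depth t + n → maxDepth < depth t + n′ → approx n t ≡ approx n′ t
      approx-stable zero n′ t h h′ =
        ⊥-elim (ℕ.<-irrefl refl (ℕ.≤-trans (subst (maxDepth <_) (ℕ.+-identityʳ _) h) (depth≤ t)))
      approx-stable (suc n) zero t h h′ =
        ⊥-elim (ℕ.<-irrefl refl (ℕ.≤-trans (subst (maxDepth <_) (ℕ.+-identityʳ _) h′) (depth≤ t)))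
      approx-stable (suc n) (suc n′) t h h′ = step-cong t _ _ λ c e →
        approx-stable n n′ c (deeper e h) (deeper e h′)

    solution : V 𝒯 → B
    solution = approx (suc maxDepth)

    solution-step : ∀ t → solution t ≡ step t solution
    solution-step t = step-cong t _ _ λ c e →
      approx-stable maxDepth (suc maxDepth) c (deeper e (ℕ.m≤n⇒m≤o+n (depth t) ℕ.≤-refl))
        (ℕ.m≤n⇒m≤o+n (depth c) ℕ.≤-refl)

module OTXFacts {A : Structure τ} (E : OTX A) (k : ℕ) (adhesion≤k : adhesion (decomposition E) ≤ k) where

  𝒟 = decomposition E
  𝒯 = tree 𝒟

  open TreeFacts 𝒯 public

  Bag : V 𝒯 → U A → Set
  Bag t v = T (β 𝒟 t v)

  -- The owner of an element is the topmost vertex whose bag contains it. It exists and is unique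
  -- because these vertices are connected, so the owned sets partition the universe.
  Own : V 𝒯 → U A → Set
  Own t v = Bag t v × (∀ p → p ↝ t → ¬ Bag p v)

  own? : ∀ t v → Dec (Own t v)
  own? t v = T? _ ×-dec finite-all? (V-finite 𝒯) λ p → T? _ →-dec ¬? (T? _)

  -- A path through bags containing `v` cannot leave the subtree of `t`: it would have to pass the
  -- parent of `t`, whose bag lacks `v`. An upward step elsewhere retraces the last edge of the walk
  -- from `t`.
  Own-below : ∀ {t d v} → Own t v → Bag d v → Below t d
  Own-below {t} {d} {v} (tv , top) dv = go ε (connected 𝒟 v tv dv)
    where
    go : ∀ {a} → Below t a → Star _ a d → Below t d
    go p ε = p
    go p (fwd (_ , _ , e) ◅ s) = go (p ◅◅ (e ◅ ε)) s
    go p (bwd (bv , _ , e) ◅ s) with last-step p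
    ... | inj₁ refl          = ⊥-elim (top _ e bv)
    ... | inj₂ (q , p′ , e′) with parent-unique e e′
    ... | refl = go p′ s

  Own-unique : ∀ {t t′ v} → Own t v → Own t′ v → t ≡ t′
  Own-unique o o′ = Below-antisym (Own-below o (proj₁ o′)) (Own-below o′ (proj₁ o))

  parent? : ∀ c → Dec (∃ λ p → p ↝ c)
  parent? c = finite-any? (V-finite 𝒯) λ p → T? _

  -- Owned t v says that v belongs to the bags in the subtree of t only.
  Owned : V 𝒯 → U A → Set
  Owned t v = ∃ λ d → Below t d × Own d v

  Adhesion : V 𝒯 → U A → Set
  Adhesion c v = ∃ λ p → p ↝ c × Bag p v × Bag c v

  bag-cases : ∀ {t v} → Bag t v → Own t v ⊎ Adhesion t v
  bag-cases {t} {v} tv with finite-any? (V-finite 𝒯) (λ p → T? (edge 𝒯 p t) ×-dec T? (β 𝒟 p v))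
  ... | yes (p , e , pv) = inj₂ (p , e , pv , tv)
  ... | no ¬p            = inj₁ (tv , λ p e pv → ¬p (p , e , pv))

  -- On the way up from `d` to `c`, the element is either owned by the current vertex or still
  -- present in the bag of its parent.
  below-cases : ∀ {c d v} → Below c d → Bag d v → Owned c v ⊎ Adhesion c v
  below-cases {c} {d} {v} p dv = [ inj₁ , [ (λ o → inj₁ (c , ε , o)) , inj₂ ]′ ∘ bag-cases ]′ (climb p)
    where
    climb : ∀ {a} → Below a d → Owned a v ⊎ Bag a v
    climb ε = inj₂ dv
    climb (e ◅ p) with climb p
    ... | inj₁ (b , q , o) = inj₁ (b , e ◅ q , o)
    ... | inj₂ bv with bag-cases bv
    ... | inj₁ o = inj₁ (_ , e ◅ ε , o)
    ... | inj₂ (q , e′ , qv , _) with parent-unique e e′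
    ... | refl = inj₂ qv

  Own-exists : ∀ v → ∃ λ t → Own t v
  Own-exists v with nonempty 𝒟 v
  ... | t , tv with below-cases (walk 𝒯 t) tv
  ... | inj₁ (d , _ , o)     = d , o
  ... | inj₂ (_ , e , _ , _) = ⊥-elim (root-no-parent e)

  Owned-root : ∀ v → Owned (root 𝒯) v
  Owned-root v = let (t , o) = Own-exists v in t , walk 𝒯 t , o

  Owned-fresh : ∀ {c v} → Owned c v → ¬ Adhesion c v
  Owned-fresh (d , p , o) (q , e , qv , _) = no-cycle e (p ◅◅ Own-below o qv)

  -- The bag that covers the tuple lies below the owner of the given entry and hence below `c`;
  -- every other entry is in that bag, so it is owned below `c` or also occurs in the bags on both
  -- sides of the edge into `c`.
  Owned-closed : ∀ {c} R xs → T (rel A R xs) → (∃ λ i → Owned c (lookup xs i)) →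
                 ∀ i → Owned c (lookup xs i) ⊎ Adhesion c (lookup xs i)
  Owned-closed R xs r (i , d , p , o) j =
    let (t , all) = covers 𝒟 R xs r in below-cases (p ◅◅ Own-below o (VecAll.lookup all (VecMembership.∈-lookup i xs))) (VecAll.lookup all (VecMembership.∈-lookup j xs))

  Owned-cases : ∀ {t v} → Owned t v ⇔ (Own t v ⊎ ∃ λ c → t ↝ c × Owned c v)
  Owned-cases = mk⇔
    (λ { (d , ε , o) → inj₁ o ; (d , e ◅ p , o) → inj₂ (_ , e , d , p , o) })
    (λ { (inj₁ o) → _ , ε , o ; (inj₂ (c , e , d , p , o)) → d , e ◅ p , o })

  Owned-disjoint : ∀ {t c c′ v} → t ↝ c → t ↝ c′ → Owned c v → Owned c′ v → c ≡ c′
  Owned-disjoint e e′ (d , p , o) (d′ , p′ , o′) with Own-unique o o′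
  ... | refl = children-disjoint e e′ p p′

  Own-not-below : ∀ {t c v} → t ↝ c → Own t v → ¬ Owned c v
  Own-not-below e o (d , p , o′) with Own-unique o o′
  ... | refl = no-cycle e p

  private
    bag-finite : ∀ t → Finite ⟪ β 𝒟 t ⟫
    bag-finite t = ⟪⟫-finite (U-finite A) (β 𝒟 t)

    proj₁-injective : ∀ {t} {x y : ⟪ β 𝒟 t ⟫} → proj₁ x ≡ proj₁ y → x ≡ y
    proj₁-injective {x = x , p} {.x , q} refl = cong (x ,_) (T-irrelevant p q)

    extendOrder-≡ : ∀ (p : U A → Bool) (o : LinearOrder ⟪ p ⟫) {u v} (pu : T (p u)) (pv : T (p v)) →
                    extendOrder p o u v ≡ le o (u , pu) (v , pv)
    extendOrder-≡ p o {u} {v} pu pv with T? (p u) | T? (p v)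
    ... | yes pu′ | yes pv′ = cong₂ (λ a b → le o (u , a) (v , b)) (T-irrelevant pu′ pu)
      (T-irrelevant pv′ pv)
    ... | no ¬pu  | _       = ⊥-elim (¬pu pu)
    ... | yes _   | no ¬pv  = ⊥-elim (¬pv pv)

    extendOrder-∈ : ∀ (p : U A → Bool) (o : LinearOrder ⟪ p ⟫) {u v} → T (extendOrder p o u v) →
      T (p u) × T (p v)
    extendOrder-∈ p o {u} {v} h with T? (p u) | T? (p v)
    ... | yes pu | yes pv = pu , pv
    extendOrder-∈ p o () | no _  | _
    extendOrder-∈ p o () | yes _ | no _

  bag : V 𝒯 → List (U A)
  bag t = List.map proj₁ (linearize (bag-finite t) (order E t))

  ∈-bag : ∀ {t v} → v ∈ bag t ⇔ Bag t v
  ∈-bag {t} = mk⇔ (λ m → let ((_ , p) , _ , e) = ∈-map⁻ proj₁ m in subst (Bag t) (sym e) p)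
                  (λ p → ∈-map⁺ proj₁ (linearize-complete (bag-finite t) (order E t) (_ , p)))

  bag-unique : ∀ t → Unique (bag t)
  bag-unique t = Unique.map⁺ (proj₁-injective {t}) (linearize-unique (bag-finite t) (order E t))

  Before-bag : ∀ {t u v} → Before (bag t) u v ⇔ (T (extendOrder (β 𝒟 t) (order E t) u v) × u ≢ v)
  Before-bag {t} {u} {v} = mk⇔
    (λ b → let pu = to ∈-bag (Before-∈ˡ b) ; pv = to ∈-bag (Before-∈ʳ b)
               (l , ≢) = to (in-bag pu pv) b in
      subst T (sym (extendOrder-≡ (β 𝒟 t) (order E t) pu pv)) l , ≢ ∘ proj₁-injective)
    (λ (h , ≢) → let (pu , pv) = extendOrder-∈ (β 𝒟 t) (order E t) h in
      from (in-bag pu pv) (subst T (extendOrder-≡ (β 𝒟 t) (order E t) pu pv) h , ≢ ∘ cong proj₁))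
    where
    in-bag : ∀ pu pv → Before (bag t) u v ⇔ (T (le (order E t) (u , pu) (v , pv)) × (u , pu) ≢ (v , pv))
    in-bag pu pv = Before-map (proj₁-injective {t}) (linearize (bag-finite t) (order E t)) ⟩⇔⟨
                   Before-linearize (bag-finite t) (order E t)

  private
    adhesionListOf : ∀ c → Dec (∃ λ p → p ↝ c) → List (U A)
    adhesionListOf c (yes (p , _)) = filterᵇ (β 𝒟 c) (bag p)
    adhesionListOf c (no _)        = []

  -- Listed in the order of the parent's bag instead of the bag of `c`, so that siblings with the
  -- same adhesion set have the same vector of sources.
  adhesionList : V 𝒯 → List (U A)
  adhesionList c = adhesionListOf c (parent? c)

  adhesionList-child : ∀ {p c} → p ↝ c → adhesionList c ≡ filterᵇ (β 𝒟 c) (bag p)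
  adhesionList-child {p} {c} e = go (parent? c)
    where
    go : ∀ d → adhesionListOf c d ≡ filterᵇ (β 𝒟 c) (bag p)
    go (yes (q , e′)) with parent-unique e e′
    ... | refl = refl
    go (no ¬p) = ⊥-elim (¬p (p , e))

  ∈-adhesionList : ∀ {c v} → v ∈ adhesionList c ⇔ Adhesion c v
  ∈-adhesionList {c} {v} = go (parent? c)
    where
    go : ∀ d → v ∈ adhesionListOf c d ⇔ Adhesion c v
    go (yes (p , e)) = ∈-filterᵇ (β 𝒟 c) (bag p) ⟩⇔⟨ mk⇔
      (λ (m , cv) → p , e , to ∈-bag m , cv)
      (λ (q , e′ , qv , cv) → from ∈-bag (subst (λ q → Bag q v) (parent-unique e′ e) qv) , cv)
    go (no ¬p) = mk⇔ (λ ()) (λ (p , e , _) → ⊥-elim (¬p (p , e)))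

  adhesionList-unique : ∀ c → Unique (adhesionList c)
  adhesionList-unique c = go (parent? c)
    where
    go : ∀ d → Unique (adhesionListOf c d)
    go (yes (p , _)) = filterᵇ-unique (β 𝒟 c) (bag-unique p)
    go (no _)        = []

  adhesionList-length : ∀ c → length (adhesionList c) ≤ k
  adhesionList-length c = go (parent? c)
    where
    nodes = elements (V-finite 𝒯)
    common : V 𝒯 × V 𝒯 → U A → Bool
    common (t , u) v = β 𝒟 t v ∧ β 𝒟 u v
    is-edge : V 𝒯 × V 𝒯 → Bool
    is-edge (t , u) = edge 𝒯 t u
    size : V 𝒯 × V 𝒯 → ℕ
    size e = count (common e) (elements (U-finite A))
    go : ∀ d → length (adhesionListOf c d) ≤ k
    go (no _)        = z≤n
    go (yes (p , e)) = ℕ.≤-trans (ℕ.≤-reflexive (↭-length (unique∧set⇒↭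
        (filterᵇ-unique (β 𝒟 c) (bag-unique p)) (filterᵇ-unique (common (p , c)) (unique (U-finite A)))
        λ v → ∈-filterᵇ (β 𝒟 c) (bag p) ⟩⇔⟨ mk⇔
          (λ (m , cv) → from (∈-filterᵇ (common (p , c)) (elements (U-finite A)))
            (complete (U-finite A) v , from T-∧ (to ∈-bag m , cv)))
          (λ m → let (pv , cv) = to T-∧ (proj₂ (to (∈-filterᵇ (common (p , c)) (elements (U-finite A))) m)) in from ∈-bag pv , cv))))
      (ℕ.≤-trans (All.lookup (xs≤max 0 (List.map size (filterᵇ is-edge (cartesianProduct nodes nodes))))
          (∈-map⁺ size (from (∈-filterᵇ is-edge (cartesianProduct nodes nodes))
            (∈-cartesianProduct⁺ (complete (V-finite 𝒯) p) (complete (V-finite 𝒯) c) , e))))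
        adhesion≤k)

  source : V 𝒯 → Vec (Maybe (U A)) k
  source c = pad k (adhesionList c)

  source-Adhesion : ∀ {c v} → (∃ λ i → lookup (source c) i ≡ just v) ⇔ Adhesion c v
  source-Adhesion {c} = ∈-pad (adhesionList-length c) ⟩⇔⟨ ∈-adhesionList

  source-injective : ∀ {c i i′ v} → lookup (source c) i ≡ just v → lookup (source c) i′ ≡ just v → i ≡ i′
  source-injective {c} {i} {i′} h h′ = Fin.toℕ-injective (At-injective (adhesionList-unique c)
    (to (lookup-pad k (adhesionList c) i) h) (to (lookup-pad k (adhesionList c) i′) h′))

  source-root : ∀ {r} → (∀ p → ¬ p ↝ r) → source r ≡ replicate k nothing
  source-root {r} no-parent = vec-ext λ i → go i (lookup (source r) i) refl
    where
    go : ∀ i x → lookup (source r) i ≡ x → lookup (source r) i ≡ lookup (replicate k nothing) i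
    go i nothing  e = trans e (sym (Vec.lookup-replicate i nothing))
    go i (just v) e = let (p , h , _) = to source-Adhesion (i , e) in ⊥-elim (no-parent p h)

  entries : V 𝒯 → List (Maybe (U A))
  entries t = nothing ∷ List.map just (bag t)

  -- Siblings are ordered lexicographically by their source vectors.
  keys : V 𝒯 → List (Vec (Maybe (U A)) k)
  keys t = tuples (entries t) k

  keys-unique : ∀ t → Unique (keys t)
  keys-unique t = tuples-unique (All.tabulate (λ m e → nothing≢ m e) ∷ Unique.map⁺ (λ { refl → refl })
    (bag-unique t)) k
    where
    nothing≢ : ∀ {x} → x ∈ List.map just (bag t) → nothing ≢ x
    nothing≢ m refl with ∈-map⁻ just m
    ... | _ , _ , ()

  source-∈-entries : ∀ {t c} → t ↝ c → ∀ i → lookup (source c) i ∈ entries t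
  source-∈-entries {t} {c} e i = go (lookup (source c) i) refl
    where
    go : ∀ x → lookup (source c) i ≡ x → x ∈ entries t
    go nothing  _ = here refl
    go (just v) h = let (p , e′ , pv , _) = to source-Adhesion (i , h) in
      there (∈-map⁺ just (from ∈-bag (subst (λ q → Bag q v) (parent-unique e′ e) pv)))

  source-∈-keys : ∀ {t c} → t ↝ c → source c ∈ keys t
  source-∈-keys e = ∈-tuples⁺ (source-∈-entries e)

  ownList : V 𝒯 → List (U A)
  ownList t = filterᵇ (λ v → does (own? t v)) (bag t)

  ∈-ownList : ∀ {t v} → v ∈ ownList t ⇔ Own t v
  ∈-ownList {t} {v} = ∈-filterᵇ (λ v → does (own? t v)) (bag t) ⟩⇔⟨ mk⇔
    (λ (_ , o) → to (T-does (own? t v)) o)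
    (λ o → from ∈-bag (proj₁ o) , from (T-does (own? t v)) o)

-- Arranging the universe along the tree

module Arrangement {A : Structure τ} (E : OTX A) (k : ℕ) (adhesion≤k : adhesion (decomposition E) ≤ k)
                   (φ : SetFormula τ 0) where

  open States τ k
  open OTXFacts E k adhesion≤k public

  Key : Set
  Key = Sources A

  class? : ∀ t (ℓ : V 𝒯 → State φ) (κ : Key) σ c → Dec (t ↝ c × source c ≡ κ × ℓ c ≡ σ)
  class? t ℓ κ σ c = T? _ ×-dec Vec.≡-dec (Maybe.≡-dec (finite-≟ (U-finite A))) (source c) κ ×-dec
    finite-≟ (State-finite φ) (ℓ c) σ

  class : V 𝒯 → (V 𝒯 → State φ) → Key → State φ → List (V 𝒯)
  class t ℓ κ σ = filterᵇ (λ c → does (class? t ℓ κ σ c)) (elements (V-finite 𝒯))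

  ∈-class : ∀ {t ℓ κ σ c} → c ∈ class t ℓ κ σ ⇔ (t ↝ c × source c ≡ κ × ℓ c ≡ σ)
  ∈-class {t} {ℓ} {κ} {σ} {c} = ∈-filterᵇ (λ c → does (class? t ℓ κ σ c)) (elements (V-finite 𝒯)) ⟩⇔⟨ mk⇔
    (λ (_ , h) → to (T-does (class? t ℓ κ σ c)) h)
    (λ h → complete (V-finite 𝒯) c , from (T-does (class? t ℓ κ σ c)) h)

  -- With the states in the outer enumeration, siblings with the same sources are sorted by state.
  -- Inside a class the order is the arbitrary one of the enumeration of the vertices, which is
  -- harmless since equal states contribute equally.
  group : V 𝒯 → (V 𝒯 → State φ) → Key → List (V 𝒯)
  group t ℓ κ = concatMap (class t ℓ κ) (elements (State-finite φ))

  ∈-group : ∀ {t ℓ κ c} → c ∈ group t ℓ κ ⇔ (t ↝ c × source c ≡ κ)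
  ∈-group {t} {ℓ} {κ} {c} = ∈-concatMap {f = class t ℓ κ} ⟩⇔⟨ mk⇔
    (λ (σ , _ , m) → let (e , h , _) = to (∈-class {t} {ℓ} {κ} {σ}) m in e , h)
    (λ (e , h) → ℓ c , complete (State-finite φ) (ℓ c) , from (∈-class {t} {ℓ} {κ} {ℓ c}) (e , h , refl))

  group-unique : ∀ t ℓ κ → Unique (group t ℓ κ)
  group-unique t ℓ κ = concatMap-unique (unique (State-finite φ))
    (λ σ _ → filterᵇ-unique (λ c → does (class? t ℓ κ σ c)) (unique (V-finite 𝒯)))
    (λ {σ} {σ′} _ _ m m′ → trans (sym (proj₂ (proj₂ (to (∈-class {t} {ℓ} {κ} {σ}) m))))
      (proj₂ (proj₂ (to (∈-class {t} {ℓ} {κ} {σ′}) m′))))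

  module _ where
    stateAt : (V 𝒯 → List (U A)) → V 𝒯 → State φ
    stateAt L c = state A φ (L c) (source c) []

    groupOf : (V 𝒯 → List (U A)) → V 𝒯 → Key → List (U A)
    groupOf L t κ = concatMap L (group t (stateAt L) κ)

    arrange : V 𝒯 → (V 𝒯 → List (U A)) → List (U A)
    arrange t L = ownList t ++ concatMap (groupOf L t) (keys t)

    arrange-cong : ∀ t L L′ → (∀ c → t ↝ c → L c ≡ L′ c) → arrange t L ≡ arrange t L′
    arrange-cong t L L′ h = cong (ownList t ++_) (concatMap-cong (λ κ → trans
      (cong (concatMap L) (concatMap-cong (λ σ → filterᵇ-cong
        (λ c → T-does (class? t (stateAt L) κ σ c) ⟩⇔⟨ mk⇔
            (λ (e , s , l) → e , s , trans (cong (λ l → state A φ l (source c) []) (sym (h c e))) l)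
            (λ (e , s , l) → e , s , trans (cong (λ l → state A φ l (source c) []) (h c e)) l)
          ⟩⇔⟨ ⇔-sym (T-does (class? t (stateAt L′) κ σ c)))
        (elements (V-finite 𝒯))) (elements (State-finite φ))))
      (concatMap-cong-∈ (group t (stateAt L′) κ) λ c m → h c (proj₁ (to (∈-group {t} {stateAt L′}) m))))
        (keys t))

  -- `arrange t` consults its argument at the children of `t` only, both for their lists and for the
  -- states by which they are sorted; hence the recursion on the tree applies.
  arrangement-exists : ∃ λ L → ∀ t → L t ≡ arrange t L
  arrangement-exists = R.solution , R.solution-step
    where
    module R = Recursion [] arrange arrange-cong

module Arranged {A : Structure τ} (E : OTX A) (k : ℕ) (adhesion≤k : adhesion (decomposition E) ≤ k)
                (φ : SetFormula τ 0) (arrangement : V (tree (decomposition E)) → List (U A))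
                (arrangement-step : ∀ t → arrangement t ≡ Arrangement.arrange E k adhesion≤k φ t arrangement) where

  open States τ k
  open Arrangement E k adhesion≤k φ public

  label : V 𝒯 → State φ
  label = stateAt arrangement

  groupList : V 𝒯 → Key → List (U A)
  groupList = groupOf arrangement

  private
    ∈-groupList₀ : ∀ t κ {v} → v ∈ groupList t κ ⇔ ∃ λ c → (t ↝ c × source c ≡ κ) × v ∈ arrangement c
    ∈-groupList₀ t κ = ∈-concatMap {f = arrangement} {group t label κ} ⟩⇔⟨ Σ-⇔ λ c →
      ∈-group {t} {label} {κ} ×-⇔ ⇔-refl

  ∈-arrangement : ∀ t {v} → v ∈ arrangement t ⇔ Owned t v
  ∈-arrangement t {v} = induction {P = λ t → v ∈ arrangement t ⇔ Owned t v} step t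
    where
    step : ∀ t → (∀ c → t ↝ c → v ∈ arrangement c ⇔ Owned c v) → v ∈ arrangement t ⇔ Owned t v
    step t ih = subst (λ l → v ∈ l ⇔ Owned t v) (sym (arrangement-step t)) (mk⇔
      (λ m → [ (λ o → from Owned-cases (inj₁ (to ∈-ownList o))) ,
               (λ m′ → let (κ , _ , m″) = to (∈-concatMap {f = groupList t} {keys t}) m′
                           (c , (e , _) , m‴) = to (∈-groupList₀ t κ) m″ in
                 from Owned-cases (inj₂ (c , e , to (ih c e) m‴))) ]′ (∈-++⁻ (ownList t) m))
      (λ o → [ (λ o → ∈-++⁺ˡ (from ∈-ownList o)) ,
               (λ (c , e , o) → ∈-++⁺ʳ (ownList t) (from (∈-concatMap {f = groupList t} {keys t})
                 (source c , source-∈-keys e , from (∈-groupList₀ t (source c)) (c , (e , refl) ,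
                   from (ih c e) o)))) ]′ (to Owned-cases o)))

  ∈-groupList : ∀ t κ {v} → v ∈ groupList t κ ⇔ ∃ λ c → (t ↝ c × source c ≡ κ) × Owned c v
  ∈-groupList t κ = ∈-groupList₀ t κ ⟩⇔⟨ Σ-⇔ λ c → ⇔-refl ×-⇔ ∈-arrangement c

  groupList-disjoint : ∀ t {κ κ′ v} → v ∈ groupList t κ → v ∈ groupList t κ′ → κ ≡ κ′
  groupList-disjoint t {κ} {κ′} m m′ =
    let (c , (e , h) , o) = to (∈-groupList t κ) m ; (c′ , (e′ , h′) , o′) = to (∈-groupList t κ′) m′ in
    trans (sym h) (trans (cong source (Owned-disjoint e e′ o o′)) h′)

  group-disjoint : ∀ t κ {c c′ v} → c ∈ group t label κ → c′ ∈ group t label κ →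
                   v ∈ arrangement c → v ∈ arrangement c′ → c ≡ c′
  group-disjoint t κ {c} {c′} m m′ v∈ v∈′ = Owned-disjoint (proj₁ (to (∈-group {t} {label} {κ}) m))
    (proj₁ (to (∈-group {t} {label} {κ}) m′)) (to (∈-arrangement c) v∈) (to (∈-arrangement c′) v∈′)

  arrangement-unique : ∀ t → Unique (arrangement t)
  arrangement-unique = induction {P = λ t → Unique (arrangement t)} λ t ih →
    subst Unique (sym (arrangement-step t)) (Unique.++⁺
    (filterᵇ-unique (λ v → does (own? t v)) (bag-unique t))
    (concatMap-unique {f = groupList t} (keys-unique t)
      (λ κ _ → concatMap-unique {f = arrangement} (group-unique t label κ)
        (λ c m → ih c (proj₁ (to (∈-group {t} {label} {κ}) m))) (group-disjoint t κ))
      (λ _ _ → groupList-disjoint t))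
    λ (m , m′) → let (κ , _ , m″) = to (∈-concatMap {f = groupList t} {keys t}) m′ ; (c , (e , _) , o) = to (∈-groupList t κ) m″ in
      Own-not-below e (to ∈-ownList m) o)

  arrangement-closed : ∀ c → Closed A (arrangement c) (source c)
  arrangement-closed c R xs r (i , m) j = [ (λ o → inj₁ (from (∈-arrangement c) o)) ,
    (λ a → inj₂ (from source-Adhesion a)) ]′
    (Owned-closed R xs r (i , to (∈-arrangement c) m) j)

  arrangement-fresh : ∀ c → Fresh A (arrangement c) (source c)
  arrangement-fresh c v i m e = Owned-fresh (to (∈-arrangement c) m) (to source-Adhesion (i , e))

  module _ (t : V 𝒯) (κ : Key) where

    private
      closed : ∀ c → c ∈ group t label κ → Closed A (arrangement c) κ
      closed c m = subst (Closed A (arrangement c)) (proj₂ (to (∈-group {t} {label} {κ}) m))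
        (arrangement-closed c)
      fresh : ∀ c → c ∈ group t label κ → Fresh A (arrangement c) κ
      fresh c m = subst (Fresh A (arrangement c)) (proj₂ (to (∈-group {t} {label} {κ}) m))
        (arrangement-fresh c)

    groupList-closed : Closed A (groupList t κ) κ
    groupList-closed = Closed-concatMap A arrangement {κ} {group t label κ} closed

    -- The children of a group have the same sources, so their pieces compose; since they are sorted
    -- by state, the composition reduces to iterates that depend only on the sizes of the classes.
    groupList-state : state A φ (groupList t κ) κ [] ≡
                      sortedState φ (λ σ → length (class t label κ σ)) (elements (State-finite φ))
    groupList-state = trans
      (state-concatMap A arrangement φ [] (group-unique t label κ) closed fresh (group-disjoint t κ))
      (trans (foldr-cong-∈ (group t label κ) λ c m x →
        cong (λ s → compose φ (state A φ (arrangement c) s []) x)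
                (sym (proj₂ (to (∈-group {t} {label} {κ}) m))))
             (fold-sorted φ label (class t label κ) (λ σ c m →
               proj₂ (proj₂ (to (∈-class {t} {label} {κ} {σ}) m)))
               (elements (State-finite φ))))
      where
      foldr-cong-∈ : ∀ {f g : V 𝒯 → State φ → State φ} cs → (∀ c → c ∈ cs → ∀ x → f c x ≡ g c x) →
                     ∀ {x} → List.foldr f x cs ≡ List.foldr g x cs
      foldr-cong-∈ []       h = refl
      foldr-cong-∈ {f} (c ∷ cs) h {x} = trans (cong (f c) (foldr-cong-∈ cs (λ c m → h c (there m))))
        (h c (here refl) _)

-- The state of a subtree from the states of its groups

decided : ∀ {b σ} {Q : Set} → T b ⇔ Q → (T σ ⇔ Q) ⇔ (b ≡ σ)
decided e = mk⇔ (λ f → T-ext (e ⟩⇔⟨ ⇔-sym f)) λ { refl → e }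

cong-⇔ : {X : Set} (P : X → Set) {x x′ : X} → x ≡ x′ → P x ⇔ P x′
cong-⇔ P refl = ⇔-refl

cong₂-⇔ : {X Y : Set} (P : X → Y → Set) {x x′ : X} {y y′ : Y} → x ≡ x′ → y ≡ y′ → P x y ⇔ P x′ y′
cong₂-⇔ P refl refl = ⇔-refl

-- The state of the subtree of a vertex t, computed from the bag of t and from
-- the states ℓ c of the groups of its children c.
module NodeStates {τ : Vocabulary} {k : ℕ} (A : Structure τ) {C : Set} (Child : C → Set)
  (source : C → States.Sources τ k A) (s : States.Sources τ k A)
  (Own Bag : U A → Set) (BagBefore : U A → U A → Set) (ChildBefore : C → C → Set) where

  open States τ k

  bits : Sources A → (U A → Bool) → Bits
  bits κ S = Vec.map (maybe′ S false) κ

  assign : Sources A → Vec (U A → Bool) m → Vec (Assignment A) m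
  assign κ Z = Vec.map (λ S → S , bits κ S) Z

  RelatedInBag : ∀ {r} → (Vec (U A) r → Bool) → Vec (U A → Bool) m → Vec (Fin m) r → Set
  RelatedInBag {r = r} R Z Xs = Σ (Vec (U A) r) λ xs → T (R xs) ×
    (∀ i → Bag (lookup xs i) × T (lookup Z (lookup Xs i) (lookup xs i))) × ∃ λ i → Own (lookup xs i)

  SomeChild : (C → Set) → Set
  SomeChild P = ∃ λ c → Child c × P c

  NodeMeets : (U A → Bool) → (U A → Bool) → (C → Set) → Set
  NodeMeets S S′ P = (∃ λ v → Own v × T (S v) × T (S′ v)) ⊎ SomeChild P

  -- The cases mirror the arrangement: own elements come first, so no element of a group precedes an
  -- own one. `P`, `Q` and `Q′` stand for the three bits that `beforeₛ` keeps for the group of a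
  -- child: a pair inside the group, and nonemptiness of the two sets.
  NodePrecedes : (U A → Bool) → (U A → Bool) → (C → Set) → (C → Set) → (C → Set) → Set
  NodePrecedes S S′ P Q Q′ =
    (∃ λ v → ∃ λ v′ → (Own v × Own v′ × BagBefore v v′) × T (S v) × T (S′ v′)) ⊎
    ((∃ λ v → Own v × T (S v)) × SomeChild Q′) ⊎
    SomeChild P ⊎
    (∃ λ c → ∃ λ c′ → (Child c × Child c′ × ChildBefore c c′) × Q c × Q′ c′)

  -- In the quantifier case `S` matters only on the bag; outside the bag it is replaced by the new
  -- states `ℓ′`, which must be reachable from the old ones with the trace of `S` on the sources.
  -- Groups are addressed by their children, hence the demand that children with equal sources
  -- receive equal new states.
  Node : (φ : SetFormula τ m) → Vec (U A → Bool) m → (C → State φ) → State φ → Set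
  Node (relₛ R Xs) Z ℓ σ = T σ ⇔ (SomeChild (T ∘ ℓ) ⊎ RelatedInBag (rel A R) Z Xs)
  Node (beforeₛ X Y) Z ℓ (b , x , y) =
    (T b ⇔ NodePrecedes (lookup Z X) (lookup Z Y) (T ∘ proj₁ ∘ ℓ) (T ∘ proj₁ ∘ proj₂ ∘ ℓ)
      (T ∘ proj₂ ∘ proj₂ ∘ ℓ)) ×
    (T x ⇔ NodeMeets (lookup Z X) (lookup Z X) (T ∘ proj₁ ∘ proj₂ ∘ ℓ)) ×
    (T y ⇔ NodeMeets (lookup Z Y) (lookup Z Y) (T ∘ proj₂ ∘ proj₂ ∘ ℓ))
  Node (meetsₛ X Y) Z ℓ σ = T σ ⇔ NodeMeets (lookup Z X) (lookup Z Y) (T ∘ ℓ)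
  Node (¬ₛ φ)   Z ℓ σ = Node φ Z ℓ σ
  Node (φ ∧ₛ ψ) Z ℓ σ = Node φ Z (proj₁ ∘ ℓ) (proj₁ σ) × Node ψ Z (proj₂ ∘ ℓ) (proj₂ σ)
  Node (∃ₛ φ)   Z ℓ p = ∀ zσ → T (mem (Choices-finite φ) p zσ) ⇔
    ∃ λ (S : U A → Bool) → ∃ λ (ℓ′ : C → State φ) →
      (∀ c → Child c → T (mem (Choices-finite φ) (ℓ c) (bits (source c) S , ℓ′ c))) ×
      (∀ c c′ → Child c × Child c′ → source c ≡ source c′ → ℓ′ c ≡ ℓ′ c′) ×
      (∀ i v → lookup s i ≡ just v → S v ≡ lookup (proj₁ zσ) i) ×
      Node φ (S ∷ Z) ℓ′ (proj₂ zσ)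

  -- What the composition argument has to know of the tree and of the arrangement: `L` lists the
  -- subtree, and `piece κ` the union of the subtrees of the children with sources `κ`.
  record Gluing : Set where
    field
      C-finite       : Finite C
      child?         : ∀ c → Dec (Child c)
      L              : List (U A)
      piece          : Sources A → List (U A)
      ∈-L            : ∀ v → v ∈ L ⇔ (Own v ⊎ SomeChild λ c → v ∈ piece (source c))
      Before-L       : ∀ v v′ → Before L v v′ ⇔
        ((Own v × Own v′ × BagBefore v v′) ⊎ (Own v × SomeChild λ c → v′ ∈ piece (source c)) ⊎
         (SomeChild λ c → Before (piece (source c)) v v′) ⊎
         (∃ λ c → ∃ λ c′ → (Child c × Child c′ × ChildBefore c c′) × v ∈ piece (source c) ×
           v′ ∈ piece (source c′)))
      piece-closed   : ∀ c → Child c → Closed A (piece (source c)) (source c)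
      piece-disjoint : ∀ {c c′ v} → Child c → Child c′ → v ∈ piece (source c) → v ∈ piece (source c′) →
        source c ≡ source c′
      own-disjoint   : ∀ {c v} → Child c → Own v → ¬ v ∈ piece (source c)
      fresh          : Fresh A L s
      Own⇒Bag        : ∀ {v} → Own v → Bag v
      bag-cases      : ∀ {v} → Bag v → Own v ⊎ ∃ λ i → lookup s i ≡ just v
      s⇒Bag          : ∀ {i v} → lookup s i ≡ just v → Bag v
      s-injective    : ∀ {i i′ v} → lookup s i ≡ just v → lookup s i′ ≡ just v → i ≡ i′
      source⇒Bag     : ∀ {c i v} → Child c → lookup (source c) i ≡ just v → Bag v

  module Composition (gluing : Gluing) where

    open Gluing gluing

    private
      F = U-finite A

    In : List (U A) → Sources A → U A → Set
    In L κ v = v ∈ L ⊎ ∃ λ i → lookup κ i ≡ just v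

    lookup-bits : ∀ κ S {i v} → lookup κ i ≡ just v → lookup (bits κ S) i ≡ S v
    lookup-bits κ S {i} e = trans (Vec.lookup-map i (maybe′ S false) κ) (cong (maybe′ S false) e)

    Held-assign : ∀ {L κ S v} → Held A L κ (S , bits κ S) v ⇔ (In L κ v × T (S v))
    Held-assign {L} {κ} {S} = mk⇔
      (λ { (owned m t) → inj₁ m , t ; (sourced i e t) → inj₂ (i , e) , subst T (lookup-bits κ S e) t })
      (λ { (inj₁ m , t) → owned m t ; (inj₂ (i , e) , t) →
        sourced i e (subst T (sym (lookup-bits κ S e)) t) })

    Related-assign : ∀ {r} (R : Vec (U A) r → Bool) L κ (Z : Vec (U A → Bool) m) Xs →
      Related A R L κ (assign κ Z) Xs ⇔
      (Σ (Vec (U A) r) λ xs → T (R xs) ×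
        (∀ i → In L κ (lookup xs i) × T (lookup Z (lookup Xs i) (lookup xs i))) × ∃ λ i → lookup xs i ∈ L)
    Related-assign R L κ Z Xs = Σ-⇔ λ xs → ⇔-refl ×-⇔ ((Π-⇔ λ i →
      mk⇔ (subst (λ a → Held A L κ a (lookup xs i)) (Vec.lookup-map (lookup Xs i) _ Z))
          (subst (λ a → Held A L κ a (lookup xs i)) (sym (Vec.lookup-map (lookup Xs i) _ Z))) ⟩⇔⟨
            Held-assign) ×-⇔ ⇔-refl)

    proj₁-assign : ∀ (κ : Sources A) (Z : Vec (U A → Bool) m) X → proj₁ (lookup (assign κ Z) X) ≡ lookup Z X
    proj₁-assign κ Z X = cong proj₁ (Vec.lookup-map X _ Z)

    -- `Z` is the assignment that the formula sees, `Z′` the actual sets on the subtree. Agreement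
    -- on the bag suffices, since everything below is known through the group states alone.
    Agree : Vec (U A → Bool) m → Vec (U A → Bool) m → Set
    Agree Z Z′ = ∀ X v → Bag v → lookup Z X v ≡ lookup Z′ X v

    in-bag : ∀ {v} → Bag v → In L s v
    in-bag {v} b = [ (λ o → inj₁ (from (∈-L v) (inj₁ o))) , inj₂ ]′ (bag-cases b)

    -- A tuple that touches the piece of a child stays, by closedness, in this piece and its
    -- sources. Any other tuple consists of own elements and sources of the node and so lies in the
    -- bag.
    related-node : ∀ {r} (R : Vec (U A) r → Bool) (Xs : Vec (Fin m) r) (Z Z′ : Vec (U A → Bool) m) →
      Agree Z Z′ →
      (∀ c → Child c → ∀ xs → T (R xs) → (∃ λ i → lookup xs i ∈ piece (source c)) → ∀ i →
        In (piece (source c)) (source c) (lookup xs i)) →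
      Related A R L s (assign s Z′) Xs ⇔
      ((SomeChild λ c → Related A R (piece (source c)) (source c) (assign (source c) Z′) Xs) ⊎
        RelatedInBag R Z Xs)
    related-node {r = r} R Xs Z Z′ agree closed = Related-assign R L s Z′ Xs ⟩⇔⟨ mk⇔ down
      [ (λ (c , ch , h) → let (xs , r , hs , i , m) = to (Related-assign R (piece (source c)) (source c) Z′ Xs) h in
           xs , r , (λ j → up c ch (proj₁ (hs j)) , proj₂ (hs j)) , i , from (∈-L _) (inj₂ (c , ch , m))) ,
        (λ (xs , r , hs , i , o) → xs , r ,
           (λ j → in-bag (proj₁ (hs j)) , subst T (agree _ _ (proj₁ (hs j))) (proj₂ (hs j))) , i ,
             from (∈-L _) (inj₁ o)) ]′
      where
      up : ∀ c → Child c → ∀ {v} → In (piece (source c)) (source c) v → In L s v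
      up c ch (inj₁ m)       = inj₁ (from (∈-L _) (inj₂ (c , ch , m)))
      up c ch (inj₂ (i , e)) = in-bag (source⇒Bag ch e)
      down : (Σ (Vec (U A) r) λ xs → T (R xs) ×
        (∀ i → In L s (lookup xs i) × T (lookup Z′ (lookup Xs i) (lookup xs i))) × ∃ λ i →
        lookup xs i ∈ L) →
             (SomeChild λ c → Related A R (piece (source c)) (source c) (assign (source c) Z′) Xs) ⊎
               RelatedInBag R Z Xs
      down (xs , r , hs , i , m) with finite-any? (Fin-finite _) (λ j → finite-any? C-finite λ c →
                                        child? c ×-dec ∈-finite? F (lookup xs j) (piece (source c)))
      ... | yes (j , c , ch , m′) =
        inj₁ (c , ch , from (Related-assign R (piece (source c)) (source c) Z′ Xs)
              (xs , r , (λ i → closed c ch xs r (j , m′) i , proj₂ (hs i)) , j , m′))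
      ... | no ¬below = inj₂ (xs , r ,
        (λ j → bag j , subst T (sym (agree _ _ (bag j))) (proj₂ (hs j))) , i , own i m)
        where
        own : ∀ j → lookup xs j ∈ L → Own (lookup xs j)
        own j m = [ id , (λ (c , ch , m′) → ⊥-elim (¬below (j , c , ch , m′))) ]′ (to (∈-L _) m)
        bag : ∀ j → Bag (lookup xs j)
        bag j = [ (λ m → Own⇒Bag (own j m)) , (λ (i , e) → s⇒Bag e) ]′ (proj₁ (hs j))

    private
      own-agree : ∀ (Z Z′ : Vec (U A → Bool) m) → Agree Z Z′ → ∀ X {v} → Own v → T (lookup Z X v) ⇔
        T (lookup Z′ X v)
      own-agree Z Z′ agree X o = T-≡ (agree X _ (Own⇒Bag o))

    module _ (Z Z′ : Vec (U A → Bool) m) (agree : Agree Z Z′) (X Y : Fin m) where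

      private
        S  = lookup Z X
        S₁ = lookup Z′ X
        R  = lookup Z Y
        R₁ = lookup Z′ Y

        X-agree : ∀ {v} → Own v → T (S v) ⇔ T (S₁ v)
        X-agree = own-agree Z Z′ agree X

        Y-agree : ∀ {v} → Own v → T (R v) ⇔ T (R₁ v)
        Y-agree = own-agree Z Z′ agree Y

      meets-node : Meets A L S₁ R₁ ⇔ NodeMeets S R (λ c → Meets A (piece (source c)) S₁ R₁)
      meets-node = mk⇔
        (λ (v , m , t , t′) → [ (λ o → inj₁ (v , o , from (X-agree o) t , from (Y-agree o) t′)) ,
                                (λ (c , ch , m′) → inj₂ (c , ch , v , m′ , t , t′)) ]′ (to (∈-L v) m))
        (λ where (inj₁ (v , o , t , t′)) → v , from (∈-L v) (inj₁ o) , to (X-agree o) t , to (Y-agree o) t′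
                 (inj₂ (c , ch , v , m , q)) → v , from (∈-L v) (inj₂ (c , ch , m)) , q)

      precedes-node : Precedes A L S₁ R₁ ⇔ NodePrecedes S R (λ c → Precedes A (piece (source c)) S₁ R₁)
          (λ c → Meets A (piece (source c)) S₁ S₁) (λ c → Meets A (piece (source c)) R₁ R₁)
      precedes-node = mk⇔
        (λ (v , v′ , b , t , t′) →
          [ (λ h@(o , o′ , _) → inj₁ (v , v′ , h , from (X-agree o) t , from (Y-agree o′) t′)) ,
          [ (λ (o , c , ch , m) → inj₂ (inj₁ ((v , o , from (X-agree o) t) , c , ch , v′ , m , t′ , t′))) ,
          [ (λ (c , ch , b) → inj₂ (inj₂ (inj₁ (c , ch , v , v′ , b , t , t′)))) ,
            (λ (c , c′ , h , m , m′) →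
              inj₂ (inj₂ (inj₂ (c , c′ , h , (v , m , t , t) , (v′ , m′ , t′ , t′))))) ]′ ]′ ]′
          (to (Before-L v v′) b))
        (λ where
          (inj₁ (v , v′ , h@(o , o′ , _) , t , t′)) →
            v , v′ , from (Before-L v v′) (inj₁ h) , to (X-agree o) t , to (Y-agree o′) t′
          (inj₂ (inj₁ ((v , o , t) , c , ch , v′ , m , t′ , _))) →
            v , v′ , from (Before-L v v′) (inj₂ (inj₁ (o , c , ch , m))) , to (X-agree o) t , t′
          (inj₂ (inj₂ (inj₁ (c , ch , v , v′ , b , q)))) → v , v′ ,
            from (Before-L v v′) (inj₂ (inj₂ (inj₁ (c , ch , b)))) , q
          (inj₂ (inj₂ (inj₂ (c , c′ , h , (v , m , t , _) , (v′ , m′ , t′ , _))))) →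
            v , v′ , from (Before-L v v′) (inj₂ (inj₂ (inj₂ (c , c′ , h , m , m′)))) , t , t′)

    SomeChild-⇔ : {P Q : C → Set} → (∀ c → Child c → P c ⇔ Q c) → SomeChild P ⇔ SomeChild Q
    SomeChild-⇔ h = mk⇔ (λ (c , ch , p) → c , ch , to (h c ch) p) (λ (c , ch , q) → c , ch ,
      from (h c ch) q)

    NodeMeets-⇔ : ∀ {S S′} {P Q : C → Set} → (∀ c → Child c → P c ⇔ Q c) → NodeMeets S S′ P ⇔
      NodeMeets S S′ Q
    NodeMeets-⇔ h = ⇔-refl ⊎-⇔ SomeChild-⇔ h

    NodePrecedes-⇔ : ∀ {S S′} {P P₁ Q Q₁ Q′ Q₁′ : C → Set} → (∀ c → Child c → P c ⇔ P₁ c) →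
      (∀ c → Child c → Q c ⇔ Q₁ c) → (∀ c → Child c → Q′ c ⇔ Q₁′ c) → NodePrecedes S S′ P Q Q′ ⇔
        NodePrecedes S S′ P₁ Q₁ Q₁′
    NodePrecedes-⇔ p q q′ = ⇔-refl ⊎-⇔ (⇔-refl ×-⇔ SomeChild-⇔ q′) ⊎-⇔ SomeChild-⇔ p ⊎-⇔ mk⇔
      (λ (c , c′ , h@(ch , ch′ , _) , a , b) → c , c′ , h , to (q c ch) a , to (q′ c′ ch′) b)
      (λ (c , c′ , h@(ch , ch′ , _) , a , b) → c , c′ , h , from (q c ch) a , from (q′ c′ ch′) b)

    GroupStates : (φ : SetFormula τ m) → Vec (U A → Bool) m → (C → State φ) → Set
    GroupStates φ Z ℓ = ∀ c → Child c → ℓ c ≡ state A φ (piece (source c)) (source c) (assign (source c) Z)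

    module Extension (φ : SetFormula τ (suc m)) (Z′ : Vec (U A → Bool) m) where

      private
        held-set : (U A → Bool) → Bits → ∀ v → Dec (v ∈ L) → Dec (∃ λ i → lookup s i ≡ just v) → Bool
        held-set S₀ z v (yes _) _             = S₀ v
        held-set S₀ z v (no _)  (yes (i , _)) = lookup z i
        held-set S₀ z v (no _)  (no _)        = false

        onSource? : ∀ v → Dec (∃ λ i → lookup s i ≡ just v)
        onSource? v = finite-any? (Fin-finite k) λ i → Maybe.≡-dec (finite-≟ F) _ _

      -- A choice for `∃ₛ` consists of a set and a separate trace on the sources. Freshness of the
      -- sources, and their occurring only once, allow both to be united in one set.
      extend : (U A → Bool) → Bits → U A → Bool
      extend S₀ z v = held-set S₀ z v (∈-finite? F v L) (onSource? v)

      extend-inside : ∀ S₀ z v → v ∈ L → extend S₀ z v ≡ S₀ v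
      extend-inside S₀ z v m with ∈-finite? F v L
      ... | yes _ = refl
      ... | no ∉  = ⊥-elim (∉ m)

      extend-source : ∀ S₀ z i v → lookup s i ≡ just v → extend S₀ z v ≡ lookup z i
      extend-source S₀ z i v e with ∈-finite? F v L | onSource? v
      ... | yes m | _           = ⊥-elim (fresh v i m e)
      ... | no _  | yes (j , h) = cong (lookup z) (s-injective h e)
      ... | no _  | no ¬s       = ⊥-elim (¬s (i , e))

      extend-state : ∀ S₀ z → state A φ L s (assign s (extend S₀ z ∷ Z′)) ≡ state A φ L s
        ((S₀ , z) ∷ assign s Z′)
      extend-state S₀ z = state-local A φ (SameAll-∷ A
        (same (extend-inside S₀ z) λ i v e →
          trans (lookup-bits s (extend S₀ z) e) (extend-source S₀ z i v e)) (λ X → Same-refl A))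

      module Merging (ℓ′ : C → State φ) (S : U A → Bool)
        (const : ∀ c c′ → Child c × Child c′ → source c ≡ source c′ → ℓ′ c ≡ ℓ′ c′)
        (choice : ∀ c → Child c → ∃ λ S′ →
          state A φ (piece (source c)) (source c) ((S′ , bits (source c) S) ∷ assign (source c) Z′) ≡ ℓ′ c)
        where

        private
          Chosen : (κ : Sources A) → State φ → (U A → Bool) → Set
          Chosen κ σ S′ = state A φ (piece κ) κ ((S′ , bits κ S) ∷ assign κ Z′) ≡ σ

          -- The witness is chosen per vector of sources and not per child, as children with equal
          -- sources share one piece. By `const` the witness of any one of them serves all.
          pick : ∀ κ → Dec (∃ λ c → Child c × source c ≡ κ) → U A → Bool
          pick κ (yes (c , ch , _)) = proj₁ (choice c ch)
          pick κ (no _)             = S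

          inGroup? : ∀ κ → Dec (∃ λ c → Child c × source c ≡ κ)
          inGroup? κ = finite-any? C-finite λ c → child? c ×-dec Vec.≡-dec (Maybe.≡-dec (finite-≟ F))
            (source c) κ

          pick-spec : ∀ c → Child c → ∀ d → Chosen (source c) (ℓ′ c) (pick (source c) d)
          pick-spec c ch (yes (c′ , ch′ , e)) =
            subst (λ κ → Chosen κ (ℓ′ c) (proj₁ (choice c′ ch′))) e
              (trans (proj₂ (choice c′ ch′)) (const c′ c (ch′ , ch) e))
          pick-spec c ch (no ¬c) = ⊥-elim (¬c (c , ch , refl))

          below? : ∀ v → Dec (SomeChild λ c → v ∈ piece (source c))
          below? v = finite-any? C-finite λ c → child? c ×-dec ∈-finite? F v (piece (source c))

          merged : ∀ v → Dec (SomeChild λ c → v ∈ piece (source c)) → Bool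
          merged v (yes (c , _)) = pick (source c) (inGroup? (source c)) v
          merged v (no _)        = S v

        merge : U A → Bool
        merge v = merged v (below? v)

        merge-bag : ∀ v → Bag v → merge v ≡ S v
        merge-bag v b = go (below? v)
          where
          go : ∀ d → merged v d ≡ S v
          go (no _) = refl
          go (yes (c , ch , m)) = ⊥-elim ([ (λ o → own-disjoint ch o m) ,
            (λ (i , e) → fresh v i (from (∈-L v) (inj₂ (c , ch , m))) e) ]′ (bag-cases b))

        merge-groups : GroupStates φ (merge ∷ Z′) ℓ′
        merge-groups c ch = trans (sym (pick-spec c ch (inGroup? (source c)))) (state-local A φ (SameAll-∷ A
          (same (λ v m → sym (in-piece v m (below? v))) λ i v e →
            trans (lookup-bits (source c) S e)
              (trans (sym (merge-bag v (source⇒Bag ch e))) (sym (lookup-bits (source c) merge e))))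
          (λ X → Same-refl A)))
          where
          in-piece : ∀ v → v ∈ piece (source c) → ∀ d → merged v d ≡ pick (source c) (inGroup? (source c)) v
          in-piece v m (yes (c′ , ch′ , m′)) =
            cong (λ κ → pick κ (inGroup? κ) v) (piece-disjoint ch′ ch m′ m)
          in-piece v m (no ¬b)               = ⊥-elim (¬b (c , ch , m))

    private
      meets⇔ : ∀ (Z : Vec (U A → Bool) m) X Y L κ →
        T (does (meets? A L (proj₁ (lookup (assign κ Z) X)) (proj₁ (lookup (assign κ Z) Y)))) ⇔
          Meets A L (lookup Z X) (lookup Z Y)
      meets⇔ Z X Y L κ = T-does (meets? A L _ _) ⟩⇔⟨ cong₂-⇔ (Meets A L) (proj₁-assign κ Z X)
        (proj₁-assign κ Z Y)

      precedes⇔ : ∀ (Z : Vec (U A → Bool) m) X Y L κ →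
        T (does (precedes? A L (proj₁ (lookup (assign κ Z) X)) (proj₁ (lookup (assign κ Z) Y)))) ⇔
          Precedes A L (lookup Z X) (lookup Z Y)
      precedes⇔ Z X Y L κ = T-does (precedes? A L _ _) ⟩⇔⟨ cong₂-⇔ (Precedes A L) (proj₁-assign κ Z X)
        (proj₁-assign κ Z Y)

    NodeCorrect : (φ : SetFormula τ m) → Set
    NodeCorrect {m} φ = ∀ {Z Z′ : Vec (U A → Bool) m} → Agree Z Z′ → ∀ ℓ → GroupStates φ Z′ ℓ → ∀ σ →
                        Node φ Z ℓ σ ⇔ (state A φ L s (assign s Z′) ≡ σ)

    -- A set on the subtree yields the guess consisting of its trace on the bag and the states it
    -- induces on the groups. Conversely, sets that witness the guessed states on the groups are
    -- merged with `S` on the bag; locality of states shows that the merged set realizes the guess.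
    Node-correct-∃ : (φ : SetFormula τ (suc m)) → NodeCorrect φ → NodeCorrect (∃ₛ φ)
    Node-correct-∃ φ ih {Z} {Z′} agree ℓ h p = mk⇔
      (λ f → Pow-≡ (Choices-finite φ) λ (z , σ) → choices z σ ⟩⇔⟨ ⇔-sym (f (z , σ)))
      (λ { refl (z , σ) → choices z σ })
      where
      choices : ∀ z σ → T (mem (Choices-finite φ) (state A (∃ₛ φ) L s (assign s Z′)) (z , σ)) ⇔
        ∃ λ (S : U A → Bool) → ∃ λ (ℓ′ : C → State φ) →
          (∀ c → Child c → T (mem (Choices-finite φ) (ℓ c) (bits (source c) S , ℓ′ c))) ×
          (∀ c c′ → Child c × Child c′ → source c ≡ source c′ → ℓ′ c ≡ ℓ′ c′) ×
          (∀ i v → lookup s i ≡ just v → S v ≡ lookup z i) ×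
          Node φ (S ∷ Z) ℓ′ σ
      choices z σ = ∈-state-∃ A φ L s (assign s Z′) z σ ⟩⇔⟨
        mk⇔ (λ (S₀ , e) → realized S₀ e) (λ (S , ℓ′ , hℓ , const , hs , node) →
        realize S ℓ′ hℓ const hs node)
        where
        module E = Extension φ Z′
        realized : ∀ S₀ → state A φ L s ((S₀ , z) ∷ assign s Z′) ≡ σ → _
        realized S₀ e = S , ℓ′ , member , const , (λ i v → E.extend-source S₀ z i v) ,
             from (ih {S ∷ Z} {S ∷ Z′} (λ { zero _ _ → refl ; (suc X) → agree X }) ℓ′ (λ c ch → refl) σ)
               (trans (E.extend-state S₀ z) e)
          where
          S  = E.extend S₀ z
          ℓ′ : C → State φ
          ℓ′ c = state A φ (piece (source c)) (source c) (assign (source c) (S ∷ Z′))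
          member : ∀ c → Child c → T (mem (Choices-finite φ) (ℓ c) (bits (source c) S , ℓ′ c))
          member c ch = subst (λ p → T (mem (Choices-finite φ) p (bits (source c) S , ℓ′ c))) (sym (h c ch))
                (from (∈-state-∃ A φ (piece (source c)) (source c) (assign (source c) Z′)
                  (bits (source c) S) (ℓ′ c)) (S , refl))
          const : ∀ c c′ → Child c × Child c′ → source c ≡ source c′ → ℓ′ c ≡ ℓ′ c′
          const c c′ _ e = cong (λ κ → state A φ (piece κ) κ (assign κ (S ∷ Z′))) e
        realize : ∀ S (ℓ′ : C → State φ) →
          (∀ c → Child c → T (mem (Choices-finite φ) (ℓ c) (bits (source c) S , ℓ′ c))) →
          (∀ c c′ → Child c × Child c′ → source c ≡ source c′ → ℓ′ c ≡ ℓ′ c′) →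
          (∀ i v → lookup s i ≡ just v → S v ≡ lookup z i) →
          Node φ (S ∷ Z) ℓ′ σ → ∃ λ S₀ → state A φ L s ((S₀ , z) ∷ assign s Z′) ≡ σ
        realize S ℓ′ hℓ const hs node = M.merge , trans
               (state-local A φ (SameAll-∷ A {L = L} {s} (same (λ _ _ → refl) λ i v e →
                  trans (sym (hs i v e))
                    (trans (sym (M.merge-bag v (s⇒Bag e))) (sym (lookup-bits s M.merge e))))
                    (λ X → Same-refl A)))
               (to (ih {S ∷ Z} {M.merge ∷ Z′}
                      (λ { zero v b → sym (M.merge-bag v b) ; (suc X) → agree X }) ℓ′ M.merge-groups σ)
                        node)
          where
          choice : ∀ c → Child c → ∃ λ S′ →
            state A φ (piece (source c)) (source c) ((S′ , bits (source c) S) ∷ assign (source c) Z′) ≡ ℓ′ c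
          choice c ch = to (∈-state-∃ A φ (piece (source c)) (source c) (assign (source c) Z′)
            (bits (source c) S) (ℓ′ c))
                (subst (λ p → T (mem (Choices-finite φ) p (bits (source c) S , ℓ′ c))) (h c ch) (hℓ c ch))
          module M = E.Merging ℓ′ S const choice

    Node-correct : (φ : SetFormula τ m) → NodeCorrect φ
    Node-correct (relₛ R Xs) {Z} {Z′} agree ℓ h σ = decided
      (T-does (related? A (rel A R) L s (assign s Z′) Xs) ⟩⇔⟨
       related-node (rel A R) Xs Z Z′ agree (λ c ch → piece-closed c ch R) ⟩⇔⟨
       (SomeChild-⇔ (λ c ch → ⇔-sym (T-≡ (h c ch) ⟩⇔⟨
         T-does (related? A (rel A R) (piece (source c)) (source c) (assign (source c) Z′) Xs))) ⊎-⇔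
           ⇔-refl))
    Node-correct (meetsₛ X Y) {Z} {Z′} agree ℓ h σ = decided
      (meets⇔ Z′ X Y L s ⟩⇔⟨ meets-node Z Z′ agree X Y ⟩⇔⟨
       NodeMeets-⇔ (λ c ch → ⇔-sym (T-≡ (h c ch) ⟩⇔⟨ meets⇔ Z′ X Y (piece (source c)) (source c))))
    Node-correct (beforeₛ X Y) {Z} {Z′} agree ℓ h (b , x , y) =
      (decided (precedes⇔ Z′ X Y L s ⟩⇔⟨ precedes-node Z Z′ agree X Y ⟩⇔⟨ NodePrecedes-⇔
          (λ c ch → ⇔-sym (T-≡ (cong proj₁ (h c ch)) ⟩⇔⟨
            precedes⇔ Z′ X Y (piece (source c)) (source c))) x⇔ y⇔)
       ×-⇔ decided (meets⇔ Z′ X X L s ⟩⇔⟨ meets-node Z Z′ agree X X ⟩⇔⟨ NodeMeets-⇔ x⇔)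
       ×-⇔ decided (meets⇔ Z′ Y Y L s ⟩⇔⟨ meets-node Z Z′ agree Y Y ⟩⇔⟨ NodeMeets-⇔ y⇔))
      ⟩⇔⟨ mk⇔ (λ { (refl , refl , refl) → refl }) (λ { refl → refl , refl , refl })
      where
      x⇔ : ∀ c → Child c → Meets A (piece (source c)) (lookup Z′ X) (lookup Z′ X) ⇔ T (proj₁ (proj₂ (ℓ c)))
      x⇔ c ch = ⇔-sym (T-≡ (cong (proj₁ ∘ proj₂) (h c ch)) ⟩⇔⟨ meets⇔ Z′ X X (piece (source c)) (source c))
      y⇔ : ∀ c → Child c → Meets A (piece (source c)) (lookup Z′ Y) (lookup Z′ Y) ⇔ T (proj₂ (proj₂ (ℓ c)))
      y⇔ c ch = ⇔-sym (T-≡ (cong (proj₂ ∘ proj₂) (h c ch)) ⟩⇔⟨ meets⇔ Z′ Y Y (piece (source c)) (source c))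
    Node-correct (¬ₛ φ) = Node-correct φ
    Node-correct (φ ∧ₛ ψ) agree ℓ h (σ , ρ) =
      (Node-correct φ agree (proj₁ ∘ ℓ) (λ c ch → cong proj₁ (h c ch)) σ ×-⇔
       Node-correct ψ agree (proj₂ ∘ ℓ) (λ c ch → cong proj₂ (h c ch)) ρ)
      ⟩⇔⟨ mk⇔ (λ (p , q) → cong₂ _,_ p q) ,-injective
    Node-correct (∃ₛ φ) = Node-correct-∃ φ (Node-correct φ)

-- Lexicographic comparison of sources, and the gluing data of an arrangement

Lex : (X → X → Set) → ∀ r → (Fin r → X) → (Fin r → X) → Set
Lex R zero    f g = ⊥
Lex R (suc r) f g = R (f zero) (g zero) ⊎ (f zero ≡ g zero × Lex R r (f ∘ suc) (g ∘ suc))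

Lex-⇔ : {R R′ : X → X → Set} → ∀ r {f g : Fin r → X} → (∀ j → R (f j) (g j) ⇔ R′ (f j) (g j)) →
  Lex R r f g ⇔ Lex R′ r f g
Lex-⇔ zero    h = ⇔-refl
Lex-⇔ (suc r) h = h zero ⊎-⇔ (⇔-refl ×-⇔ Lex-⇔ r (h ∘ suc))

Before-tuples : {xs : List X} {r : ℕ} (v v′ : Vec X r) → (∀ i → lookup v i ∈ xs) →
  (∀ i → lookup v′ i ∈ xs) →
                Before (tuples xs r) v v′ ⇔ Lex (Before xs) r (lookup v) (lookup v′)
Before-tuples []      []        h h′ = mk⇔ (λ { (inj₁ (_ , ())) ; (inj₂ ()) }) (λ ())
Before-tuples (x ∷ v) (x′ ∷ v′) h h′ = Before-tuples-∷ (h zero) (∈-tuples⁺ (h ∘ suc))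
  (∈-tuples⁺ (h′ ∘ suc)) ⟩⇔⟨
  (⇔-refl ⊎-⇔ (⇔-refl ×-⇔ Before-tuples v v′ (h ∘ suc) (h′ ∘ suc)))

MaybeBefore : List X → Maybe X → Maybe X → Set
MaybeBefore xs x y = (x ≡ nothing × (∃ λ v → y ≡ just v)) ⊎
  (∃ λ u → ∃ λ v → (x ≡ just u × y ≡ just v) × Before xs u v)

Before-nothing-just : (xs : List X) {x y : Maybe X} → y ∈ nothing ∷ List.map just xs →
                      Before (nothing ∷ List.map just xs) x y ⇔ MaybeBefore xs x y
Before-nothing-just {X} xs {x} {y} y∈ = mk⇔ f g
  where
  f : Before (nothing ∷ List.map just xs) x y → MaybeBefore xs x y
  f (inj₁ (e , m)) = let (v , _ , h) = ∈-map⁻ just m in inj₁ (e , v , h)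
  f (inj₂ b) with ∈-map⁻ just (Before-∈ˡ b) | ∈-map⁻ just (Before-∈ʳ b)
  ... | u , _ , refl | v , _ , refl =
    inj₂ (u , v , (refl , refl) , to (Before-map (λ { refl → refl }) xs) b)
  g : MaybeBefore xs x y → Before (nothing ∷ List.map just xs) x y
  g (inj₁ (refl , v , refl)) = inj₁ (refl , tail y∈)
    where
    tail : ∀ {v : X} → just v ∈ nothing ∷ List.map just xs → just v ∈ List.map just xs
    tail (there m) = m
  g (inj₂ (u , v , (refl , refl) , b)) = inj₂ (from (Before-map (λ { refl → refl }) xs) b)

module ArrangedGluing {A : Structure τ} (E : OTX A) (k : ℕ) (adhesion≤k : adhesion (decomposition E) ≤ k)
                      (φ : SetFormula τ 0) (arrangement : V (tree (decomposition E)) → List (U A))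
                      (arrangement-step : ∀ t → arrangement t ≡ Arrangement.arrange E k adhesion≤k φ t arrangement) where

  open Arranged E k adhesion≤k φ arrangement arrangement-step public
  open States τ k

  module _ (t : V 𝒯) where

    open NodeStates A (t ↝_) source (source t) (Own t) (Bag t) (Before (bag t)) (λ c c′ →
      Before (keys t) (source c) (source c′))
      using (Gluing; SomeChild)

    private
      below : U A → Set
      below v = SomeChild λ c → v ∈ groupList t (source c)

      ∈-below : ∀ {v} → below v ⇔ (∃ λ c → t ↝ c × Owned c v)
      ∈-below = mk⇔
        (λ (c , e , m) → let (c′ , (e′ , _) , o) = to (∈-groupList t (source c)) m in c′ , e′ , o)
        (λ (c , e , o) → c , e , from (∈-groupList t (source c)) (c , (e , refl) , o))

      ∈-groups : ∀ {v} → v ∈ concatMap (groupList t) (keys t) ⇔ below v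
      ∈-groups = mk⇔
        (λ m → let (κ , _ , m′) = to (∈-concatMap {f = groupList t} {keys t}) m
                   (c , (e , h) , o) = to (∈-groupList t κ) m′ in from ∈-below (c , e , o))
        (λ (c , e , m) → from (∈-concatMap {f = groupList t} {keys t}) (source c , source-∈-keys e , m))

      ofChild : ∀ {κ v} → v ∈ groupList t κ → ∃ λ c → t ↝ c × κ ≡ source c
      ofChild {κ} m = let (c , (e , h) , _) = to (∈-groupList t κ) m in c , e , sym h

      groups-before : ∀ {v v′} → Before (concatMap (groupList t) (keys t)) v v′ ⇔
        ((SomeChild λ c → Before (groupList t (source c)) v v′) ⊎
         (∃ λ c → ∃ λ c′ → (t ↝ c × t ↝ c′ × Before (keys t) (source c) (source c′)) ×
            v ∈ groupList t (source c) × v′ ∈ groupList t (source c′)))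
      groups-before {v} {v′} = Before-concatMap (groupList t) (keys t) ⟩⇔⟨ mk⇔ f g
        where
        P : Set
        P = (SomeChild λ c → Before (groupList t (source c)) v v′) ⊎
            (∃ λ c → ∃ λ c′ → (t ↝ c × t ↝ c′ × Before (keys t) (source c) (source c′)) ×
               v ∈ groupList t (source c) × v′ ∈ groupList t (source c′))
        Q : Set
        Q = (∃ λ κ → κ ∈ keys t × Before (groupList t κ) v v′) ⊎
            (∃ λ κ → ∃ λ κ′ → Before (keys t) κ κ′ × v ∈ groupList t κ × v′ ∈ groupList t κ′)
        f : Q → P
        f (inj₁ (κ , _ , b)) = let (c , e , h) = ofChild {κ} (Before-∈ˡ b) in
          inj₁ (c , e , subst (λ κ → Before (groupList t κ) v v′) h b)
        f (inj₂ (κ , κ′ , b , m , m′)) = let (c , e , h) = ofChild {κ} m ; (c′ , e′ , h′) = ofChild {κ′} m′ in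
          inj₂ (c , c′ , (e , e′ , subst (λ κ → Before (keys t) κ (source c′)) h
            (subst (Before (keys t) κ) h′ b)) ,
            subst (λ κ → v ∈ groupList t κ) h m , subst (λ κ → v′ ∈ groupList t κ) h′ m′)
        g : P → Q
        g (inj₁ (c , e , b)) = inj₁ (source c , source-∈-keys e , b)
        g (inj₂ (c , c′ , (_ , _ , b) , q)) = inj₂ (source c , source c′ , b , q)

      before-ownList : ∀ {v v′} → Before (ownList t) v v′ ⇔ (Own t v × Own t v′ × Before (bag t) v v′)
      before-ownList {v} {v′} = Before-filterᵇ (λ v → does (own? t v)) (bag t) ⟩⇔⟨
        (⇔-refl ×-⇔ (T-does (own? t v) ×-⇔ T-does (own? t v′))) ⟩⇔⟨
        mk⇔ (λ (b , o , o′) → o , o′ , b) (λ (o , o′ , b) → b , o , o′)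

    -- The cases of the order come from the equation that the arrangement satisfies, the other
    -- conditions from ownership in the tree decomposition.
    gluing : Gluing
    gluing = record
      { C-finite       = V-finite 𝒯
      ; child?         = λ c → T? _
      ; L              = arrangement t
      ; piece          = groupList t
      ; ∈-L            = λ v → ∈-arrangement t ⟩⇔⟨ Owned-cases ⟩⇔⟨ (⇔-refl ⊎-⇔ ⇔-sym ∈-below)
      ; Before-L       = λ v v′ →
        subst (λ l → Before l v v′ ⇔ Before (ownList t ++ concatMap (groupList t) (keys t)) v v′)
                                        (sym (arrangement-step t)) ⇔-refl ⟩⇔⟨
          Before-++ (ownList t) ⟩⇔⟨
            (before-ownList ⊎-⇔ (groups-before ⊎-⇔ (∈-ownList ×-⇔ ∈-groups))) ⟩⇔⟨ mk⇔
            (λ where (inj₁ h) → inj₁ h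
                     (inj₂ (inj₁ (inj₁ h))) → inj₂ (inj₂ (inj₁ h))
                     (inj₂ (inj₁ (inj₂ h))) → inj₂ (inj₂ (inj₂ h))
                     (inj₂ (inj₂ h)) → inj₂ (inj₁ h))
            (λ where (inj₁ h) → inj₁ h
                     (inj₂ (inj₁ h)) → inj₂ (inj₂ h)
                     (inj₂ (inj₂ (inj₁ h))) → inj₂ (inj₁ (inj₁ h))
                     (inj₂ (inj₂ (inj₂ h))) → inj₂ (inj₁ (inj₂ h)))
      ; piece-closed   = λ c _ → groupList-closed t (source c)
      ; piece-disjoint = λ _ _ → groupList-disjoint t
      ; own-disjoint   = λ {c} _ o m → let (c′ , (e′ , _) , o′) = to (∈-groupList t (source c)) m in Own-not-below e′ o o′
      ; fresh          = arrangement-fresh t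
      ; Own⇒Bag        = proj₁
      ; bag-cases      = λ b → [ inj₁ , (λ a → inj₂ (from source-Adhesion a)) ]′ (bag-cases b)
      ; s⇒Bag          = λ {i} e → let (_ , _ , _ , b) = to source-Adhesion (i , e) in b
      ; s-injective    = source-injective {t}
      ; source⇒Bag     = λ {c} {i} {v} e h → let (p , e′ , b , _) = to (source-Adhesion {c}) (i , h) in
                           subst (λ q → Bag q v) (parent-unique e′ e) b
      }

  root-unique : ∀ {t} → (∀ p → ¬ p ↝ t) → t ≡ root 𝒯
  root-unique {t} no-parent = [ sym , (λ (p , _ , e) → ⊥-elim (no-parent p e)) ]′ (last-step (walk 𝒯 t))

-- Definability in ordered tree extensions

data OTXSort : Set where
  element vertex : OTXSort

data OTXKind (τ : Vocabulary) : Set where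
  subset  : OTXKind τ
  stateOf : SetFormula τ m → OTXKind τ

-- The index type of the coding: a structure with parameters whose output is presented as an ordered
-- tree extension. Elements and vertices are coded through the isomorphism.
record Interpreted {τ : Vocabulary} (Λ : Transduction τ (τ ⊕ otxVoc)) (k : ℕ) : Set₁ where
  field
    base        : Structure τ
    parameters  : Parameters Λ base
    extension   : OTX base
    adhesion≤k  : adhesion (decomposition extension) ≤ k
    isomorphism : output Λ base parameters ≅ otxStructure extension

  Universe : Set
  Universe = U base ⊎ V (tree (decomposition extension))

  private
    module Iso = Inverse (_≅_.bijection isomorphism)

  toOutput : Universe → U (output Λ base parameters)
  toOutput = Iso.from

  fromOutput : U (output Λ base parameters) → Universe
  fromOutput = Iso.to

  from-to : ∀ v → fromOutput (toOutput v) ≡ v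
  from-to = Iso.strictlyInverseˡ

  to-from : ∀ x → toOutput (fromOutput x) ≡ x
  to-from = Iso.strictlyInverseʳ

  codeOf : Universe → U base × Fin (width Λ)
  codeOf v = proj₁ (toOutput v)

  codeOf-fromOutput : ∀ x → codeOf (fromOutput x) ≡ proj₁ x
  codeOf-fromOutput x = cong proj₁ (to-from x)

  inUniverse? : ∀ a j → Dec (Sat (base ◂ parameters) (a ∷ []) [] (λ-U Λ j))
  inUniverse? a j = sat? (base ◂ parameters) (a ∷ []) [] (λ-U Λ j)

  decodeWith : ∀ {a j} → Dec (T (does (inUniverse? a j))) → Maybe Universe
  decodeWith (yes h) = just (fromOutput (_ , h))
  decodeWith (no _)  = nothing

  decodeOf : U base × Fin (width Λ) → Maybe Universe
  decodeOf (a , j) = decodeWith (T? (does (inUniverse? a j)))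

  decodeOf-codeOf : ∀ v → decodeOf (codeOf v) ≡ just v
  decodeOf-codeOf v = go (T? _)
    where
    go : ∀ d → decodeWith {proj₁ (codeOf v)} {proj₂ (codeOf v)} d ≡ just v
    go (yes h) = cong just
      (trans (cong (λ q → fromOutput (codeOf v , q)) (T-irrelevant h (proj₂ (toOutput v)))) (from-to v))
    go (no ¬h) = ⊥-elim (¬h (proj₂ (toOutput v)))

  rel-sat : ∀ R vs → Sat (base ◂ parameters) (Vec.map (proj₁ ∘ codeOf) vs) []
    (λ-R Λ R (Vec.map (proj₂ ∘ codeOf) vs)) ⇔
                     T (rel (otxStructure extension) R vs)
  rel-sat R vs = cong₂-⇔ (λ as js → Sat (base ◂ parameters) as [] (λ-R Λ R js))
      (Vec.map-∘ (proj₁ ∘ proj₁) toOutput vs) (Vec.map-∘ (proj₂ ∘ proj₁) toOutput vs) ⟩⇔⟨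
    ⇔-sym (T-does (sat? (base ◂ parameters) (Vec.map (proj₁ ∘ proj₁) xs) []
      (λ-R Λ R (Vec.map (proj₂ ∘ proj₁) xs)))) ⟩⇔⟨
    T-≡ (trans (_≅_.preserves isomorphism R xs) (cong (rel (otxStructure extension) R)
      (trans (sym (Vec.map-∘ fromOutput toOutput vs)) (trans (Vec.map-cong from-to vs) (Vec.map-id vs)))))
    where
    xs = Vec.map toOutput vs

module OTXDefinability {τ : Vocabulary} (Λ : Transduction τ (τ ⊕ otxVoc)) (k : ℕ) where

  open Interpreted

  private
    I = Interpreted Λ k

    Sorted : I → OTXSort → Set
    Sorted i element = U (base i)
    Sorted i vertex  = V (tree (decomposition (extension i)))

    Sorted-finite : ∀ i κ → Finite (Sorted i κ)
    Sorted-finite i element = U-finite (base i)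
    Sorted-finite i vertex  = V-finite (tree (decomposition (extension i)))

    inject : ∀ i κ → Sorted i κ → Universe i
    inject i element v = inj₁ v
    inject i vertex  t = inj₂ t

    project : ∀ i κ → Universe i → Maybe (Sorted i κ)
    project i element (inj₁ v) = just v
    project i element (inj₂ t) = nothing
    project i vertex  (inj₁ v) = nothing
    project i vertex  (inj₂ t) = just t

    project-inject : ∀ i κ v → project i κ (inject i κ v) ≡ just v
    project-inject i element v = refl
    project-inject i vertex  t = refl

    decodeMaybe : ∀ i κ → Maybe (Universe i) → Maybe (Sorted i κ)
    decodeMaybe i κ (just v) = project i κ v
    decodeMaybe i κ nothing  = nothing

    sortSymbol : OTXSort → OTXSymbol
    sortSymbol element = V-S
    sortSymbol vertex  = V-T

    sortFormula : OTXSort → Fin (width Λ) → Formula (τ ⊕ setsVoc (params Λ)) cmso 1 0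
    sortFormula element j = λ-U Λ j ∧̇ λ-R Λ (inj₂ V-S) (j ∷ [])
    sortFormula vertex  j = λ-U Λ j ∧̇ λ-R Λ (inj₂ V-T) (j ∷ [])

    inSort : ∀ i κ → Universe i → Set
    inSort i κ v = ∃ λ v′ → inject i κ v′ ≡ v

    image : ∀ i κ a j (φ : Formula (τ ⊕ setsVoc (params Λ)) cmso 1 0) →
      (∀ v → codeOf i v ≡ (a , j) → Sat (base i ◂ parameters i) (a ∷ []) [] φ ⇔ inSort i κ v) →
      Sat (base i ◂ parameters i) (a ∷ []) [] (λ-U Λ j ∧̇ φ) ⇔ ∃ λ v → codeOf i (inject i κ v) ≡ (a , j)
    image i κ a j φ h = mk⇔
      (λ (u , s) → let x = (a , j) , from (T-does (inUniverse? i a j)) u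
                       (v , e) = to (h (fromOutput i x) (codeOf-fromOutput i x)) s in
        v , trans (cong (codeOf i) e) (codeOf-fromOutput i x))
      (λ (v , e) → to (T-does (inUniverse? i a j)) (subst (λ (a , j) → T (does (inUniverse? i a j))) e
        (proj₂ (toOutput i (inject i κ v)))) ,
        from (h (inject i κ v) e) (v , refl))

    sortFormula-sat : ∀ i κ a j → Sat (base i ◂ parameters i) (a ∷ []) [] (sortFormula κ j) ⇔
                      ∃ λ v → codeOf i (inject i κ v) ≡ (a , j)
    sortFormula-sat i element a j = image i element a j (λ-R Λ (inj₂ V-S) (j ∷ [])) λ { v refl →
      rel-sat i (inj₂ V-S) (v ∷ []) ⟩⇔⟨ cases v }
      where
      cases : ∀ v → T (rel (otxStructure (extension i)) (inj₂ V-S) (v ∷ [])) ⇔ inSort i element v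
      cases (inj₁ v) = mk⇔ (λ _ → v , refl) (λ _ → tt)
      cases (inj₂ t) = mk⇔ (λ ()) λ { (_ , ()) }
    sortFormula-sat i vertex a j = image i vertex a j (λ-R Λ (inj₂ V-T) (j ∷ [])) λ { v refl →
      rel-sat i (inj₂ V-T) (v ∷ []) ⟩⇔⟨ cases v }
      where
      cases : ∀ v → T (rel (otxStructure (extension i)) (inj₂ V-T) (v ∷ [])) ⇔ inSort i vertex v
      cases (inj₁ v) = mk⇔ (λ ()) λ { (_ , ()) }
      cases (inj₂ t) = mk⇔ (λ _ → t , refl) (λ _ → tt)

    open States τ k using (State; State-finite)

    sortOfKind : OTXKind τ → OTXSort
    sortOfKind subset      = element
    sortOfKind (stateOf _) = vertex

    Value : OTXKind τ → Set
    Value subset      = Bool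
    Value (stateOf φ) = State φ

    Value-finite : ∀ κ → Finite (Value κ)
    Value-finite subset      = Bool-finite
    Value-finite (stateOf φ) = State-finite φ

  otxCoding : Coding (lsuc lzero) cmso (τ ⊕ setsVoc (params Λ))
  otxCoding = record
    { I = I ; M = λ i → base i ◂ parameters i ; w = width Λ
    ; Sort = OTXSort ; Car = Sorted ; Car-finite = Sorted-finite
    ; code = λ i κ v → codeOf i (inject i κ v)
    ; decode = λ i κ c → decodeMaybe i κ (decodeOf i c)
    ; decode-code = λ i κ v → trans (cong (decodeMaybe i κ) (decodeOf-codeOf i (inject i κ v)))
      (project-inject i κ v)
    ; image = sortFormula ; image-sat = sortFormula-sat
    ; Kind = OTXKind τ ; sortOf = sortOfKind ; Val = Value ; Val-finite = Value-finite
    }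

  open Coding otxCoding using () renaming (Car to Car)
  open Definability otxCoding

  module Atoms {E : OTXSort → Set} {S : OTXKind τ → Set} where

    otxD : (R : Symbol (τ ⊕ otxVoc)) (xs : Vec (Σ OTXSort E) (arity (τ ⊕ otxVoc) R)) → Def E S (λ i η Θ →
      T (rel (otxStructure (extension i)) R
        (Vec.map (λ (κ , v) → inject i κ v) (Vec.map (λ (κ , x) → κ , η κ x) xs))))
    otxD R = atomD (λ-R Λ R) {λ i vs →
      T (rel (otxStructure (extension i)) R (Vec.map (λ (κ , v) → inject i κ v) vs))}
      (λ i vs → cong₂-⇔ (λ as js → Sat (base i ◂ parameters i) as [] (λ-R Λ R js))
        (Vec.map-∘ (proj₁ ∘ codeOf i) (λ (κ , v) → inject i κ v) vs)
          (Vec.map-∘ (proj₂ ∘ codeOf i) (λ (κ , v) → inject i κ v) vs)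
        ⟩⇔⟨ rel-sat i R (Vec.map (λ (κ , v) → inject i κ v) vs))

    edgeD : (t u : E vertex) →
      Def E S (λ i η Θ → T (edge (tree (decomposition (extension i))) (η vertex t) (η vertex u)))
    edgeD t u = otxD (inj₂ E-T) ((vertex , t) ∷ (vertex , u) ∷ [])

    bagD : (t : E vertex) (v : E element) →
      Def E S (λ i η Θ → T (β (decomposition (extension i)) (η vertex t) (η element v)))
    bagD t v = otxD (inj₂ R-β) ((vertex , t) ∷ (element , v) ∷ [])

    orderD : (t : E vertex) (u v : E element) → Def E S (λ i η Θ →
      T (extendOrder (β (decomposition (extension i)) (η vertex t)) (order (extension i) (η vertex t))
        (η element u) (η element v)))
    orderD t u v = otxD (inj₂ R-≼) ((vertex , t) ∷ (element , u) ∷ (element , v) ∷ [])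

    relD : (R : Symbol τ) (xs : Vec (E element) (arity τ R)) →
      Def E S (λ i η Θ → T (rel (base i) R (Vec.map (η element) xs)))
    relD R xs = resp (λ i η Θ →
      T-≡ (trans (cong (liftRel (rel (base i) R)) (lifted i η xs))
      (liftRel-map (rel (base i) R) (Vec.map (η element) xs))))
      (otxD (inj₁ R) (Vec.map (element ,_) xs))
      where
      liftRel-map : ∀ {A B : Set} {r} (R : Vec A r → Bool) (vs : Vec A r) →
        liftRel {B = B} R (Vec.map inj₁ vs) ≡ R vs
      liftRel-map R []       = refl
      liftRel-map R (v ∷ vs) = liftRel-map (λ as → R (v ∷ as)) vs
      lifted : ∀ i (η : Elts E i) {r} (xs : Vec (E element) r) →
        Vec.map (λ (κ , v) → inject i κ v) (Vec.map (λ (κ , x) → κ , η κ x) (Vec.map (element ,_) xs)) ≡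
          Vec.map inj₁ (Vec.map (η element) xs)
      lifted i η []       = refl
      lifted i η (x ∷ xs) = cong (_ ∷_) (lifted i η xs)

    setD : {n : ℕ} (Xs : Vec (S subset) n) (X : Fin n) (x : E element) →
           Def E S (λ i η Θ → T (lookup (Vec.map (Θ subset) Xs) X (η element x)))
    setD Xs X x = resp (λ i η Θ → ⇔-sym T-true ⟩⇔⟨
      T-≡ (cong (λ f → f (η element x)) (sym (Vec.lookup-map X (Θ subset) Xs))))
      (labD (lookup Xs X) x true)

  open Atoms

  module Facts (i : I) = OTXFacts (extension i) k (adhesion≤k i)
  open Facts

  private variable
    E : OTXSort → Set
    S : OTXKind τ → Set

  ownD : (t : E vertex) (v : E element) → Def E S (λ i η Θ → Own i (η vertex t) (η element v))
  ownD t v = bagD t v ∧D ∀D vertex (edgeD new (old t) ⇒D ¬D (bagD new (old v)))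

  parentlessD : (t : E vertex) → Def E S (λ i η Θ → ∀ p → ¬ _↝_ i p (η vertex t))
  parentlessD t = ∀D vertex (¬D (edgeD new (old t)))

  bagBeforeD : (t : E vertex) (u v : E element) →
    Def E S (λ i η Θ → Before (bag i (η vertex t)) (η element u) (η element v))
  bagBeforeD t u v = resp (λ i η Θ → ⇔-sym (Before-bag i)) (orderD t u v ∧D ¬D (≡D u v))

  adhesionBeforeD : (c : E vertex) (u v : E element) →
    Def E S (λ i η Θ → Before (adhesionList i (η vertex c)) (η element u) (η element v))
  adhesionBeforeD c u v = resp
    (λ i η Θ → mk⇔
      (λ (p , e , b , cu , cv) → subst (λ l → Before l _ _) (sym (adhesionList-child i e))
        (from (Before-filterᵇ (β (decomposition (extension i)) (η vertex c)) (bag i p)) (b , cu , cv)))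
      (λ b → let (p , e , _) = to (∈-adhesionList i) (Before-∈ˡ b) in p , e ,
        to (Before-filterᵇ (β (decomposition (extension i)) (η vertex c)) (bag i p))
          (subst (λ l → Before l _ _) (adhesionList-child i e) b)))
    (∃D vertex (edgeD new (old c) ∧D bagBeforeD new (old u) (old v) ∧D bagD (old c) (old u) ∧D
      bagD (old c) (old v)))

  fromD : (n : ℕ) (c : E vertex) (v : E element) →
    Def E S (λ i η Θ → From (adhesionList i (η vertex c)) n (η element v))
  fromD zero    c v = resp (λ i η Θ → ⇔-sym (∈-adhesionList i))
    (∃D vertex (edgeD new (old c) ∧D bagD new (old v) ∧D bagD (old c) (old v)))
  fromD (suc n) c v = ∃D element (adhesionBeforeD (old c) new (old v) ∧D fromD n (old c) new)

  sourceD : (j : Fin k) (c : E vertex) (v : E element) →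
    Def E S (λ i η Θ → lookup (source i (η vertex c)) j ≡ just (η element v))
  sourceD j c v = resp
    (λ i η Θ → ⇔-sym (lookup-pad k (adhesionList i (η vertex c)) j ⟩⇔⟨
      At⇔From (adhesionList-unique i (η vertex c)) (toℕ j)))
    (fromD (toℕ j) c v ∧D ¬D (fromD (suc (toℕ j)) c v))

  private
    just-ext : {X : Set} (x y : Maybe X) → (∀ v → (x ≡ just v) ⇔ (y ≡ just v)) ⇔ (x ≡ y)
    just-ext nothing  nothing  = mk⇔ (λ _ → refl) (λ _ v → mk⇔ (λ ()) (λ ()))
    just-ext (just u) y        = mk⇔ (λ h → sym (to (h u) refl)) (λ { refl v → ⇔-refl })
    just-ext nothing  (just v) = mk⇔ (λ h → from (h v) refl) (λ ())

    none : {X : Set} (x : Maybe X) → (∀ v → ¬ (x ≡ just v)) ⇔ (x ≡ nothing)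
    none nothing  = mk⇔ (λ _ → refl) (λ _ _ ())
    none (just v) = mk⇔ (λ h → ⊥-elim (h v refl)) (λ ())

  sameSourceAtD : (j : Fin k) (c c′ : E vertex) →
    Def E S (λ i η Θ → lookup (source i (η vertex c)) j ≡ lookup (source i (η vertex c′)) j)
  sameSourceAtD j c c′ =
    resp (λ i η Θ → just-ext _ _) (∀D element (sourceD j (old c) new ⇔D sourceD j (old c′) new))

  sameSourceD : (c c′ : E vertex) → Def E S (λ i η Θ → source i (η vertex c) ≡ source i (η vertex c′))
  sameSourceD c c′ = resp (λ i η Θ → mk⇔ vec-ext (λ e j → cong (λ κ → lookup κ j) e))
    (⋀D (Fin-finite k) λ j → sameSourceAtD j c c′)

  entryBeforeD : (j : Fin k) (t c c′ : E vertex) → Def E S (λ i η Θ →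
    MaybeBefore (bag i (η vertex t)) (lookup (source i (η vertex c)) j) (lookup (source i (η vertex c′)) j))
  entryBeforeD j t c c′ = resp
    (λ i η Θ → (none (lookup (source i (η vertex c)) j) ×-⇔ ⇔-refl) ⊎-⇔ ⇔-refl)
    ((∀D element (¬D (sourceD j (old c) new)) ∧D ∃D element (sourceD j (old c′) new)) ∨D
      ∃D element (∃D element ((sourceD j (old (old c)) (old new) ∧D sourceD j (old (old c′)) new) ∧D
        bagBeforeD (old (old t)) (old new) new)))

  lexD : ∀ r (ι : Fin r → Fin k) (t c c′ : E vertex) → Def E S (λ i η Θ →
    Lex (MaybeBefore (bag i (η vertex t))) r (lookup (source i (η vertex c)) ∘ ι)
      (lookup (source i (η vertex c′)) ∘ ι))
  lexD zero    ι t c c′ = constD (no id)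
  lexD (suc r) ι t c c′ = entryBeforeD (ι zero) t c c′ ∨D
    (sameSourceAtD (ι zero) c c′ ∧D lexD r (ι ∘ suc) t c c′)

  -- There is no quantification over vectors of sources: the lexicographic comparison unfolds into
  -- `k` comparisons of entries in the bag of the parent, with missing entries first.
  childrenBeforeD : (t c c′ : E vertex) → Def E S (λ i η Θ →
    _↝_ i (η vertex t) (η vertex c) × _↝_ i (η vertex t) (η vertex c′) ×
    Before (keys i (η vertex t)) (source i (η vertex c)) (source i (η vertex c′)))
  childrenBeforeD t c c′ = resp
    (λ i η Θ → mk⇔
      (λ (e , e′ , l) → e , e′ , from (before i (η vertex t) (η vertex c) (η vertex c′) e e′) l)
      (λ (e , e′ , b) → e , e′ , to (before i (η vertex t) (η vertex c) (η vertex c′) e e′) b))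
    (edgeD t c ∧D edgeD t c′ ∧D lexD k id t c c′)
    where
    before : ∀ i t c c′ → _↝_ i t c → _↝_ i t c′ → Before (keys i t) (source i c) (source i c′) ⇔
      Lex (MaybeBefore (bag i t)) k (lookup (source i c)) (lookup (source i c′))
    before i t c c′ e e′ =
      Before-tuples (source i c) (source i c′) (source-∈-entries i e) (source-∈-entries i e′) ⟩⇔⟨
      Lex-⇔ k (λ j → Before-nothing-just (bag i t) (source-∈-entries i e′ j))

-- Definability of the node conditions

module NodeDefinability {τ : Vocabulary} (Λ : Transduction τ (τ ⊕ otxVoc)) (k : ℕ) where

  open Interpreted
  open OTXDefinability Λ k
  open Coding otxCoding using (I; Car)
  open Definability otxCoding
  open Atoms
  open Facts
  open States τ k

  private variable
    E : OTXSort → Set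
    S : OTXKind τ → Set

  module At (i : I) (t : Car i vertex) = NodeStates (base i) (_↝_ i t) (source i) (source i t) (Own i t)
    (Bag i t)
    (Before (bag i t)) (λ c c′ → Before (keys i t) (source i c) (source i c′))

  -- A labelling of the vertices by states, given by the formulas that define
  -- the vertices with a given label.
  record Labelling (φ : SetFormula τ m) (E : OTXSort → Set) (S : OTXKind τ → Set) : Set₁ where
    field
      value  : ∀ i → Elts E i → Labs S i → Car i vertex → State φ
      valueD : ∀ σ → Def (E ▹ vertex) S (λ i η Θ → value i (λ κ x → η κ (old x)) Θ (η vertex new) ≡ σ)

  open Labelling

  satisfiesD : {φ : SetFormula τ m} (ℓ : Labelling φ E S) {Q : State φ → Set} → (∀ σ → Dec (Q σ)) →
    Def (E ▹ vertex) S (λ i η Θ → Q (value ℓ i (λ κ x → η κ (old x)) Θ (η vertex new)))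
  satisfiesD {φ = φ} ℓ {Q} Q? = resp
    (λ i η Θ → mk⇔ (λ (σ , e , q) → subst Q (sym e) q) (λ q → _ , refl , q))
    (⋁D (State-finite φ) λ σ → valueD ℓ σ ∧D constD (Q? σ))

  -- `Node` descends into components of the labels, which are no longer values of a label variable;
  -- this is why labellings are given by defining formulas.
  mapLabelling : {φ : SetFormula τ m} {n : ℕ} {ψ : SetFormula τ n} → (State φ → State ψ) →
    Labelling φ E S → Labelling ψ E S
  mapLabelling {ψ = ψ} f ℓ .value i η Θ c = f (value ℓ i η Θ c)
  mapLabelling {ψ = ψ} f ℓ .valueD σ = satisfiesD ℓ (λ ρ → finite-≟ (State-finite ψ) (f ρ) σ)

  variableLabelling : (φ : SetFormula τ m) → S (stateOf φ) → Labelling φ E S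
  variableLabelling φ X .value i η Θ = Θ (stateOf φ) X
  variableLabelling φ X .valueD σ = labD X new σ

  ∃tupleD : ∀ r {Q : ∀ i → Elts E i → Labs S i → Vec (Car i element) r → Set} →
    (∀ {E′} (f : ∀ κ → E κ → E′ κ) (xs : Vec (E′ element) r) →
      Def E′ S (λ i η Θ → Q i (λ κ x → η κ (f κ x)) Θ (Vec.map (η element) xs))) →
    Def E S (λ i η Θ → Σ (Vec (Car i element) r) λ vs → Q i η Θ vs)
  ∃tupleD zero    d = resp (λ i η Θ → mk⇔ ([] ,_) λ { ([] , q) → q }) (d (λ _ → id) [])
  ∃tupleD (suc r) {Q} d = resp
    (λ i η Θ → mk⇔ (λ (v , vs , q) → v ∷ vs , q) λ { (v ∷ vs , q) → v , vs , q })
    (∃D element (∃tupleD r {λ i η Θ vs → Q i (λ κ x → η κ (old x)) Θ (η element new ∷ vs)}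
      (λ f xs → d (λ κ x → f κ (old x)) (f element new ∷ xs))))

  module _ {φ : SetFormula τ m} (ℓ : Labelling φ E S) (t : E vertex) where

    someChildD : {Q : State φ → Set} → (∀ σ → Dec (Q σ)) →
      Def E S (λ i η Θ → ∃ λ c → _↝_ i (η vertex t) c × Q (value ℓ i η Θ c))
    someChildD Q? = ∃D vertex (edgeD (old t) new ∧D satisfiesD ℓ Q?)

    childrenD : {Q Q′ : State φ → Set} → (∀ σ → Dec (Q σ)) → (∀ σ → Dec (Q′ σ)) →
      Def E S (λ i η Θ → ∃ λ c → ∃ λ c′ →
      (_↝_ i (η vertex t) c × _↝_ i (η vertex t) c′ × Before (keys i (η vertex t)) (source i c)
        (source i c′)) ×
      Q (value ℓ i η Θ c) × Q′ (value ℓ i η Θ c′))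
    childrenD Q? Q′? = ∃D vertex (∃D vertex (childrenBeforeD (old (old t)) (old new) new ∧D
      along (λ _ → λ { new → old new ; (old x) → old (old x) }) (λ _ → id) (satisfiesD ℓ Q?) ∧D
      along (λ _ → λ { new → new ; (old x) → old (old x) }) (λ _ → id) (satisfiesD ℓ Q′?)))

    nodeMeetsD : {n : ℕ} (Zs : Vec (S subset) n) (X Y : Fin n) {Q : State φ → Set} → (∀ σ → Dec (Q σ)) →
      Def E S (λ i η Θ → At.NodeMeets i (η vertex t) (lookup (Vec.map (Θ subset) Zs) X)
        (lookup (Vec.map (Θ subset) Zs) Y)
        (λ c → Q (value ℓ i η Θ c)))
    nodeMeetsD Zs X Y Q? = ∃D element (ownD (old t) new ∧D setD Zs X new ∧D setD Zs Y new) ∨D someChildD Q?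

    nodePrecedesD : {n : ℕ} (Zs : Vec (S subset) n) (X Y : Fin n) {P Q Q′ : State φ → Set} →
      (∀ σ → Dec (P σ)) → (∀ σ → Dec (Q σ)) → (∀ σ → Dec (Q′ σ)) →
      Def E S (λ i η Θ → At.NodePrecedes i (η vertex t) (lookup (Vec.map (Θ subset) Zs) X)
        (lookup (Vec.map (Θ subset) Zs) Y)
        (λ c → P (value ℓ i η Θ c)) (λ c → Q (value ℓ i η Θ c)) (λ c → Q′ (value ℓ i η Θ c)))
    nodePrecedesD Zs X Y P? Q? Q′? =
      ∃D element (∃D element ((ownD (old (old t)) (old new) ∧D ownD (old (old t)) new ∧D
        bagBeforeD (old (old t)) (old new) new)
        ∧D setD Zs X (old new) ∧D setD Zs Y new)) ∨D
      (∃D element (ownD (old t) new ∧D setD Zs X new) ∧D someChildD Q′?) ∨D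
      someChildD P? ∨D
      childrenD Q? Q′?

  relatedInBagD : (R : Symbol τ) {n : ℕ} (Zs : Vec (S subset) n) (Xs : Vec (Fin n) (arity τ R))
    (t : E vertex) →
    Def E S (λ i η Θ → At.RelatedInBag i (η vertex t) (rel (base i) R) (Vec.map (Θ subset) Zs) Xs)
  relatedInBagD R Zs Xs t = ∃tupleD (arity τ R) λ f xs → relD R xs ∧D
    ⋀D (Fin-finite _) (λ j → resp
      (λ i η Θ → cong₂-⇔ (λ a b → T (β (decomposition (extension i)) (η vertex (f vertex t)) a) ×
        T (lookup (Vec.map (Θ subset) Zs) (lookup Xs j) b))
        (sym (Vec.lookup-map j (η element) xs)) (sym (Vec.lookup-map j (η element) xs)))
      (bagD (f vertex t) (lookup xs j) ∧D setD Zs (lookup Xs j) (lookup xs j))) ∧D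
    ⋁D (Fin-finite _) (λ j → resp
      (λ i η Θ → cong-⇔ (Own i (η vertex (f vertex t))) (sym (Vec.lookup-map j (η element) xs)))
      (ownD (f vertex t) (lookup xs j)))

  bitsD : (X : S subset) (c : E vertex) (z : Bits) → Def E S (λ i η Θ →
    At.bits i (η vertex c) (source i (η vertex c)) (Θ subset X) ≡ z)
  bitsD X c z = resp
    (λ i η Θ → mk⇔
      (λ h → vec-ext λ j → trans (Vec.lookup-map j (maybe′ (Θ subset X) false) (source i (η vertex c)))
        (T-ext (⇔-sym (bit (Θ subset X) (lookup (source i (η vertex c)) j)) ⟩⇔⟨ h j)))
      (λ { refl j → bit (Θ subset X) (lookup (source i (η vertex c)) j) ⟩⇔⟨
        T-≡ (sym (Vec.lookup-map j (maybe′ (Θ subset X) false) (source i (η vertex c)))) }))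
    (⋀D (Fin-finite k) λ j → ∃D element (sourceD j (old c) new ∧D labD X new true) ⇔D constD
      (T? (lookup z j)))
    where
    bit : {A : Set} (S : A → Bool) (x : Maybe A) → (∃ λ v → x ≡ just v × S v ≡ true) ⇔ T (maybe′ S false x)
    bit S nothing  = mk⇔ (λ { (_ , () , _) }) (λ ())
    bit S (just v) = mk⇔ (λ { (_ , refl , h) → from T-true h }) (λ h → v , refl , to T-true h)

  nodeD : (φ : SetFormula τ m) (ℓ : Labelling φ E S) (t : E vertex) (Zs : Vec (S subset) m) (σ : State φ) →
          Def E S (λ i η Θ → At.Node i (η vertex t) φ (Vec.map (Θ subset) Zs) (value ℓ i η Θ) σ)
  nodeD (relₛ R Xs) ℓ t Zs σ = constD (T? σ) ⇔D (someChildD ℓ t (λ σ → T? σ) ∨D relatedInBagD R Zs Xs t)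
  nodeD (beforeₛ X Y) ℓ t Zs (b , x , y) =
    (constD (T? b) ⇔D nodePrecedesD ℓ t Zs X Y (λ σ → T? (proj₁ σ)) (λ σ → T? (proj₁ (proj₂ σ)))
      (λ σ → T? (proj₂ (proj₂ σ)))) ∧D
    (constD (T? x) ⇔D nodeMeetsD ℓ t Zs X X (λ σ → T? (proj₁ (proj₂ σ)))) ∧D
    (constD (T? y) ⇔D nodeMeetsD ℓ t Zs Y Y (λ σ → T? (proj₂ (proj₂ σ))))
  nodeD (meetsₛ X Y) ℓ t Zs σ = constD (T? σ) ⇔D nodeMeetsD ℓ t Zs X Y (λ σ → T? σ)
  nodeD (¬ₛ φ) ℓ t Zs σ = nodeD φ (mapLabelling id ℓ) t Zs σ
  nodeD (φ ∧ₛ ψ) ℓ t Zs (σ , ρ) = nodeD φ (mapLabelling proj₁ ℓ) t Zs σ ∧D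
    nodeD ψ (mapLabelling proj₂ ℓ) t Zs ρ
  nodeD {E = E} {S} (∃ₛ φ) ℓ t Zs p = ⋀D (Choices-finite φ) λ (z , σ) →
    constD (T? (mem (Choices-finite φ) p (z , σ))) ⇔D
    ∃L {κ = subset} (∃L {κ = stateOf φ}
      (∀D vertex (edgeD (old t) new ⇒D memberD) ∧D
       ∀D vertex (∀D vertex ((edgeD (old (old t)) (old new) ∧D edgeD (old (old t)) new) ⇒D
         sameSourceD (old new) new ⇒D sameLabelD) ) ∧D
       ⋀D (Fin-finite k) (λ j → ∀D element (sourceD j (old t) new ⇒D labD (old new) new (lookup z j))) ∧D
       resp (λ i η Θ → cong-⇔ (λ Z → At.Node i (η vertex t) φ (Θ subset (old new) ∷ Z)
         (Θ (stateOf φ) new) σ) (sym (Vec.map-∘ (Θ subset) (λ x → old (old x)) Zs)))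
         (nodeD φ (variableLabelling φ new) t (old new ∷ Vec.map (λ x → old (old x)) Zs) σ)))
    where
    S₂ : OTXKind τ → Set
    S₂ = S ▹ subset ▹ stateOf φ
    -- Membership in a state is a fact about fixed finite data and not about the structure. Hence
    -- the disjunction over all old labels, traces and new labels, with membership tested outside
    -- the logic.
    memberD : Def (E ▹ vertex) S₂ (λ i η Θ → T (mem (Choices-finite φ)
      (value ℓ i (λ κ x → η κ (old x)) (λ κ X → Θ κ (old (old X))) (η vertex new))
      (At.bits i (η vertex (old t)) (source i (η vertex new)) (Θ subset (old new)) ,
        Θ (stateOf φ) new (η vertex new))))
    memberD = resp
      (λ i η Θ → mk⇔ (λ { (p , z , σ , refl , refl , refl , h) → h }) (λ h → _ , _ , _ , refl , refl ,
        refl , h))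
      (⋁D (State-finite (∃ₛ φ)) λ p → ⋁D Bits-finite λ z → ⋁D (State-finite φ) λ σ →
        along (λ _ → id) (λ _ X → old (old X)) (valueD ℓ p) ∧D bitsD (old new) new z ∧D labD new new σ ∧D
        constD (T? (mem (Choices-finite φ) p (z , σ))))
    sameLabelD : Def (E ▹ vertex ▹ vertex) S₂ (λ i η Θ → Θ (stateOf φ) new (η vertex (old new)) ≡ Θ
      (stateOf φ) new (η vertex new))
    sameLabelD = resp
      (λ i η Θ → mk⇔ (λ { (σ , e , e′) → trans e (sym e′) }) (λ e → _ , refl , sym e))
      (⋁D (State-finite φ) λ σ → labD new (old new) σ ∧D labD new new σ)

-- Guessing and verifying the states

module Evaluation {τ : Vocabulary} (Λ : Transduction τ (τ ⊕ otxVoc)) (k : ℕ) where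

  open Interpreted
  open OTXDefinability Λ k
  open NodeDefinability Λ k
  open Coding otxCoding using (I; Car)
  open Definability otxCoding
  open Counting otxCoding
  open Atoms
  open Facts
  open States τ k
  open Labelling

  private variable
    E : OTXSort → Set
    S : OTXKind τ → Set

  acceptD : (φ : SetFormula τ m) (σ : State φ) → Def E S (λ i η Θ → accept (base i) φ σ)
  acceptD (relₛ R Xs)   σ = constD (T? σ) ∨D
    ∃tupleD (arity τ R) (λ f xs → relD R xs ∧D constD (arity τ R ℕ.≟ 0))
  acceptD (beforeₛ X Y) σ = constD (T? _)
  acceptD (meetsₛ X Y)  σ = constD (T? _)
  acceptD (¬ₛ φ)        σ = ¬D (acceptD φ σ)
  acceptD (φ ∧ₛ ψ)      σ = acceptD φ _ ∧D acceptD ψ _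
  acceptD (∃ₛ φ)        p = ⋁D (State-finite φ) λ σ → constD (T? _) ∧D acceptD φ σ

  module _ (φ : SetFormula τ 0) where

    module Arr (i : I) = Arrangement (extension i) k (adhesion≤k i) φ

    groupState : ∀ i → Car i vertex → (Car i vertex → State φ) → Car i vertex → List (State φ) → State φ
    groupState i t ℓ c = sortedState φ (λ σ → length (Arr.class i t ℓ (source i c) σ))

    -- The states are treated one by one, with a disjunction over the state reached so far; the
    -- number of children of each state enters through `countD`. Apart from the formulas of the
    -- transduction, divisibility atoms are used only here.
    groupStateD : (ℓ : Labelling φ E S) (t c : E vertex) → ∀ σs ρ →
      Def E S (λ i η Θ → groupState i (η vertex t) (value ℓ i η Θ) (η vertex c) σs ≡ ρ)
    groupStateD ℓ t c []       ρ = constD (finite-≟ (State-finite φ) (unit φ) ρ)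
    groupStateD ℓ t c (σ ∷ σs) ρ = resp
      (λ i η Θ → mk⇔ (λ { (_ , refl , e) → e }) (λ e → _ , refl , e))
      (⋁D (State-finite φ) λ ρ′ → groupStateD ℓ t c σs ρ′ ∧D
        countD {p = λ i η Θ →
          does (Arr.class? i (η vertex (old t)) (value ℓ i (λ κ x → η κ (old x)) Θ)
          (source i (η vertex (old c))) σ (η vertex new))}
          (resp (λ i η Θ → ⇔-sym
            (T-does (Arr.class? i (η vertex (old t)) (value ℓ i (λ κ x → η κ (old x)) Θ)
            (source i (η vertex (old c))) σ (η vertex new))))
            (edgeD (old t) new ∧D sameSourceD new (old c) ∧D valueD ℓ σ))
          (State-finite φ) (compose φ σ) ρ′ ρ)

    -- ℓ t is the state of the subtree of t, ℓ′ c the state of the union of the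
    -- subtrees of those siblings of c (and c itself) with the same sources as c.
    Evaluates : I → Set
    Evaluates i = Σ (Car i vertex → State φ) λ ℓ → Σ (Car i vertex → State φ) λ ℓ′ →
      (∀ t c → _↝_ i t c → ∀ ρ → ℓ′ c ≡ ρ → groupState i t ℓ c (elements (State-finite φ)) ≡ ρ) ×
      (∀ t ρ → ℓ t ≡ ρ → At.Node i t φ [] ℓ′ ρ) ×
      (∃ λ t → (∀ p → ¬ _↝_ i p t) × ∃ λ ρ → ℓ t ≡ ρ × accept (base i) φ ρ)

    evaluatesD : Def E S (λ i η Θ → Evaluates i)
    evaluatesD = ∃L {κ = stateOf φ} (∃L {κ = stateOf φ}
      (∀D vertex (∀D vertex (edgeD (old new) new ⇒D ⋀D (State-finite φ) λ ρ → labD new new ρ ⇒D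
          groupStateD (variableLabelling φ (old new)) (old new) new (elements (State-finite φ)) ρ)) ∧D
       ∀D vertex (⋀D (State-finite φ) λ ρ → labD (old new) new ρ ⇒D
         nodeD φ (variableLabelling φ new) new [] ρ) ∧D
       ∃D vertex (parentlessD new ∧D ⋁D (State-finite φ) λ ρ → labD (old new) new ρ ∧D acceptD φ ρ)))

    module _ (i : I) (L : Car i vertex → List (U (base i))) (step : ∀ t → L t ≡ Arr.arrange i t L) where

      private
        module G = ArrangedGluing (extension i) k (adhesion≤k i) φ L step

        σs : List (State φ)
        σs = elements (State-finite φ)

        groupState-cong : ∀ t ℓ ℓ′ c → (∀ c′ → _↝_ i t c′ → ℓ c′ ≡ ℓ′ c′) → ∀ σs →
          groupState i t ℓ c σs ≡ groupState i t ℓ′ c σs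
        groupState-cong t ℓ ℓ′ c h []       = refl
        groupState-cong t ℓ ℓ′ c h (σ ∷ σs) = cong₂ (λ cs ρ → iter (compose φ σ) (length cs) ρ)
          (filterᵇ-cong (λ c′ → T-does (Arr.class? i t ℓ (source i c) σ c′) ⟩⇔⟨
              mk⇔ (λ (e , s , l) → e , s , trans (sym (h c′ e)) l) (λ (e , s , l) → e , s ,
                trans (h c′ e) l) ⟩⇔⟨
              ⇔-sym (T-does (Arr.class? i t ℓ′ (source i c) σ c′)))
            (elements (V-finite (tree (decomposition (extension i))))))
          (groupState-cong t ℓ ℓ′ c h σs)

        node-correct : ∀ t ℓ′ → (∀ c → _↝_ i t c → ℓ′ c ≡ groupState i t G.label c σs) → ∀ σ →
                       At.Node i t φ [] ℓ′ σ ⇔ (G.label t ≡ σ)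
        node-correct t ℓ′ h = At.Composition.Node-correct i t (G.gluing t) φ {[]} {[]} (λ ()) ℓ′
          (λ c e → trans (h c e) (sym (G.groupList-state t (source i c))))

        groupLabelOf : ∀ c → Dec (∃ λ p → _↝_ i p c) → State φ
        groupLabelOf c (yes (p , _)) = groupState i p G.label c σs
        -- A default for the root: group states are consulted only at children.
        groupLabelOf c (no _)        = unit φ

        groupLabel : Car i vertex → State φ
        groupLabel c = groupLabelOf c (parent? i c)

        groupLabel-child : ∀ t c → _↝_ i t c → groupLabel c ≡ groupState i t G.label c σs
        groupLabel-child t c e = go (parent? i c)
          where
          go : ∀ d → groupLabelOf c d ≡ groupState i t G.label c σs
          go (yes (p , e′)) = cong (λ t → groupState i t G.label c σs) (parent-unique i e′ e)
          go (no ¬p)        = ⊥-elim (¬p (t , e))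

        -- Induction from the leaves: true labels at the children give true group states, and the
        -- node condition then has the true state as its only solution.
        determined : ∀ ℓ ℓ′ →
          (∀ t c → _↝_ i t c → ∀ ρ → ℓ′ c ≡ ρ → groupState i t ℓ c σs ≡ ρ) →
          (∀ t ρ → ℓ t ≡ ρ → At.Node i t φ [] ℓ′ ρ) → ∀ t → ℓ t ≡ G.label t
        determined ℓ ℓ′ groups nodes = induction i {P = λ t → ℓ t ≡ G.label t} λ t ih →
          sym (to (node-correct t ℓ′ (λ c e →
            trans (sym (groups t c e _ refl)) (groupState-cong t ℓ G.label c ih σs)) (ℓ t))
                  (nodes t _ refl))

      -- Any verified guess consists of the true states, and the true states together with the true
      -- group states can be verified. The vertex without a parent is the root.
      evaluates⇔accept : Evaluates i ⇔
        accept (base i) φ (G.label (root (tree (decomposition (extension i)))))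
      evaluates⇔accept = mk⇔
        (λ { (ℓ , ℓ′ , groups , nodes , t , no-parent , ρ , refl , acc) →
          subst (accept (base i) φ)
            (trans (determined ℓ ℓ′ groups nodes t) (cong G.label (G.root-unique no-parent))) acc })
        (λ acc → G.label , groupLabel ,
          (λ { t c e _ refl → sym (groupLabel-child t c e) }) ,
          (λ { t _ refl → from (node-correct t groupLabel (groupLabel-child t) (G.label t)) refl }) ,
          root (tree (decomposition (extension i))) , (λ p → root-no-parent i) , _ , refl , acc)

  module _ (φ : Sentence (τ ⊕ orderVoc) mso) where

    private
      φₛ : SetFormula τ 0
      φₛ = toSetFormula (λ ()) (λ ()) φ

    evaluation : Sentence (τ ⊕ setsVoc (params Λ)) cmso
    evaluation = fm (evaluatesD φₛ {λ _ → ⊥} {λ _ → ⊥}) (λ _ ()) (λ _ ())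

    -- The order is the arrangement at the root. It varies with the parameters, with the extension
    -- and with `φ`, so a statement about a prescribed order has to wait for order-invariance.
    evaluation-correct : ∀ i → Σ (LinearOrder (U (base i))) λ o →
      (base i ◂ parameters i ⊨ evaluation) ⇔ (base i ◃ o ⊨ φ)
    evaluation-correct i = go (Arr.arrangement-exists φₛ i)
      where
      r = root (tree (decomposition (extension i)))
      go : (∃ λ L → ∀ t → L t ≡ Arr.arrange φₛ i t L) →
           Σ (LinearOrder (U (base i))) λ o → (base i ◂ parameters i ⊨ evaluation) ⇔ (base i ◃ o ⊨ φ)
      go (L , step) = listOrder (U-finite (base i)) u c ,
        (sat (evaluatesD φₛ) i {λ _ ()} {λ _ ()} (λ _ ()) (λ _ ()) [] [] record { elts = λ _ () ; labs =
          λ _ () } ⟩⇔⟨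
         evaluates⇔accept φₛ i L step ⟩⇔⟨
         cong-⇔ (λ s → accept (base i) φₛ (state (base i) φₛ (L r) s []))
           (source-root i (λ p → root-no-parent i)) ⟩⇔⟨
         ⇔-sym (toSetFormula-correct (base i) u c φ (λ ()) (λ ()) [] [] [] ((λ ()) , (λ ()))))
        where
        module G = ArrangedGluing (extension i) k (adhesion≤k i) φₛ L step
        u = G.arrangement-unique r
        c : ∀ v → v ∈ L r
        c v = from (G.∈-arrangement r) (Owned-root i v)

-- Quantifying the parameters, and the equivalence of the two logics

∃params : {τ : Vocabulary} {p : ℕ} → Sentence (τ ⊕ setsVoc p) cmso → Sentence τ cmso
-- The renaming only passes from `p` set variables to `p + 0`, the form that `∃ₛ*` expects.
∃params {p = p} φ = ∃ₛ* p (rename id (_↑ˡ 0) (bindParams p φ))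

∃params-sat : {τ : Vocabulary} {p : ℕ} (A : Structure τ) (φ : Sentence (τ ⊕ setsVoc p) cmso) →
              (A ⊨ ∃params φ) ⇔ (Σ (Fin p → U A → Bool) λ P → A ◂ P ⊨ φ)
∃params-sat {p = p} A φ = ∃ₛ*-sat A p (rename id (_↑ˡ 0) (bindParams p φ)) ⟩⇔⟨
  Σ-⇔ (λ Ys → rename-sat A {Ξ = Ys} (λ ()) (λ X a → cong (λ Y → Y a) (Vec.lookup-++ˡ Ys [] X))
    (bindParams p φ)) ⟩⇔⟨ mk⇔
    (λ (Ys , s) → lookup Ys , to (bindParams-sat A (lookup Ys) {Ξ = []} {Ys} (λ ()) (λ _ _ → refl) φ) s)
    (λ (P , s) → tabulate P ,
      from (bindParams-sat A P {Ξ = []} {tabulate P} (λ ()) (λ j a →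
      cong (λ Y → Y a) (Vec.lookup∘tabulate P j)) φ) s)

theorem3p1 : ∀ {ℓ} (τ : Vocabulary) (C : Structure τ → Set ℓ) →
    AdmitsOrderedTreeDecompositions C →
    ( (φ : Sentence (τ ⊕ orderVoc) mso) → OrderInvariant φ →
    Σ (Sentence τ cmso) λ ψ →
    (A : Structure τ) → C A → (A ⊨≤ φ) ⇔ (A ⊨ ψ) )
    ×
    ( (ψ : Sentence τ cmso) →
    Σ (Sentence (τ ⊕ orderVoc) mso) λ φ →
    OrderInvariant φ ×
    ((A : Structure τ) → C A → (A ⊨≤ φ) ⇔ (A ⊨ ψ)) )
theorem3p1 τ C admits =
  -- Validity is a conjunct because only valid parameters are known to give ordered tree extensions.
  (λ φ invariant → ∃params (λ-valid Λ⋆ ∧̇ evaluation φ) , λ A A∈C → mk⇔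
    -- The given order `o` is exchanged by invariance for the arranged order `o′` that belongs to
    -- some valid parameters.
    (λ (o , s) → let (P , v) = inhabited A A∈C
                     (o′ , e) = evaluation-correct φ (interpreted A A∈C P v) in
      from (∃params-sat A _) (P , v , from e (to (invariant A o o′) s)))
    -- Satisfaction in the order-invariant sense asks for one order, and the arranged one is a
    -- witness.
    (λ s → let (P , v , s′) = to (∃params-sat A (λ-valid Λ⋆ ∧̇ evaluation φ)) s
               (o , e) = evaluation-correct φ (interpreted A A∈C P v) in
      o , to e s′)) ,
  (λ ψ → let (φ , invariant , e) = cmso⇒order-invariant ψ in φ , invariant , λ A _ → e A)
  where
  open AdmitsOrderedTreeDecompositions admits
  open Evaluation Λ⋆ k
  interpreted : ∀ A → C A → ∀ P → Valid Λ⋆ A P → Interpreted Λ⋆ k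
  interpreted A A∈C P v = let (E , adhesion≤ , iso) = outputs-otx A A∈C P v in record
    { base = A ; parameters = P ; extension = E ; adhesion≤k = adhesion≤ ; isomorphism = iso }
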